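{- Let $G$ be a graph, let $n\equiv 0 \pmod 4$, and let $v$ be a vertex of $G$ with $\sigma_v(G)\subset\mathbb{Z}$. Let $T_v=\{(j,v):j\in\mathbb{Z}_n\}\subseteq V(\uparrow^{n}G)$, and let $X$ be the graph obtained from $\uparrow^{n}G$ by adding a matching $M$ (a set of pairwise vertex-disjoint edges) each of whose edges joins two vertices of $T_v$. Then $X$ has Laplacian perfect state transfer at time $\frac{\pi}{2}$ between the two end vertices of every edge of $M$. Moreover, $X$ is periodic, with period $\frac{\pi}{2}$, at every vertex of $T_v$ not incident to an edge of $M$.
   Context: All graphs are simple, undirected and unweighted. $\sigma_v(G)$ is the Laplacian eigenvalue support of $v$: the set of distinct eigenvalues $\lambda$ of the Laplacian $L=D-A$ of $G$ with $E_\lambda\mathbf{e}_v\neq\mathbf{0}$, $E_\lambda$ the orthogonal projection onto the $\lambda$-eigenspace. The blow-up $\uparrow^{n}G$ has vertex set $\mathbb{Z}_n\times V(G)$, with $(l,u)\sim(m,w)$ iff $u\sim w$ in $G$. For a graph with Laplacian $L$ and $U(t)=\exp(itL)$: Laplacian perfect state transfer between $a,b$ at time $\tau$ means $U(\tau)\mathbf{e}_a=\gamma\mathbf{e}_b$ for some $\gamma\in\mathbb{C}$; the graph is periodic at $a$ at time $\tau>0$ if $|U(\tau)_{a,a}|=1$. -}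

module Defs where

open import Algebra.Bundles.Raw using (RawRing)
import Algebra.Definitions.RawSemiring as RawSemiringDefs
open import Data.Bool.Base using (Bool; true; false; _∨_; if_then_else_)
open import Data.Fin.Base using (Fin; combine; remainder)
import Data.Fin.Properties as Fin
open import Data.Integer.Base as ℤ using (ℤ; +_)
open import Data.Nat.Base as ℕ using (ℕ; zero; suc; _!)
import Data.Nat.Properties as ℕ
open import Data.Product.Base using (∃-syntax; _×_; _,_)
open import Data.Rational.Base as ℚ using (ℚ; 0ℚ; 1ℚ; ½; ∣_∣)
import Data.Rational.Properties as ℚ
open import Data.Rational.Solver using (module +-*-Solver)
open import Data.Vec.Functional using (Vector)
open import Level using (0ℓ)
open import Relation.Binary.PropositionalEquality
  using (_≡_; refl; sym; cong; cong₂; subst)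
open import Relation.Nullary using (¬_)
open import Relation.Nullary.Decidable using (does)
open import Relation.Unary using (Pred)

------------------------------------------------------------------------
-- Real numbers: Cauchy sequences of rationals, as a setoid

IsCauchy : (ℕ → ℚ) → Set
IsCauchy s = ∀ ε → 0ℚ ℚ.< ε →
  ∃[ N ] (∀ m n → N ℕ.≤ m → N ℕ.≤ n → ∣ s m ℚ.- s n ∣ ℚ.< ε)

record ℝ : Set where
  constructor mkℝ
  field
    seq      : ℕ → ℚ
    isCauchy : IsCauchy seq

open ℝ public

infix 4 _≈_ _<_ _≤_

record _≈_ (x y : ℝ) : Set where
  constructor mk≈
  field
    close : ∀ ε → 0ℚ ℚ.< ε →
      ∃[ N ] (∀ n → N ℕ.≤ n → ∣ seq x n ℚ.- seq y n ∣ ℚ.< ε)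

open _≈_ public

record _<_ (x y : ℝ) : Set where
  constructor mk<
  field
    gap       : ℚ
    gap>0     : 0ℚ ℚ.< gap
    separated : ∃[ N ] (∀ n → N ℕ.≤ n → seq x n ℚ.+ gap ℚ.≤ seq y n)

open _<_ public

_≤_ : ℝ → ℝ → Set
x ≤ y = ¬ (y < x)

private
  open ℚ.≤-Reasoning

  half : ∀ {ε} → 0ℚ ℚ.< ε → 0ℚ ℚ.< ½ ℚ.* ε
  half {ε} ε>0 =
    ℚ.positive⁻¹ (½ ℚ.* ε) {{ℚ.pos*pos⇒pos ½ ε {{ℚ.positive ε>0}}}}

  halves : ∀ ε → ½ ℚ.* ε ℚ.+ ½ ℚ.* ε ≡ ε
  halves = solve 1 (λ e → con ½ :* e :+ con ½ :* e := e) refl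
    where open +-*-Solver

  bounded : ∀ (x : ℝ) → ∃[ B ] 0ℚ ℚ.< B ×
    ∃[ N ] (∀ n → N ℕ.≤ n → ∣ seq x n ∣ ℚ.< B)
  bounded x with isCauchy x 1ℚ (ℚ.positive⁻¹ 1ℚ)
  ... | N , tail = B , ℚ.≤-<-trans (ℚ.0≤∣p∣ (seq x N)) (below N ℕ.≤-refl)
                     , N , below
    where
    B = 1ℚ ℚ.+ ∣ seq x N ∣
    below : ∀ n → N ℕ.≤ n → ∣ seq x n ∣ ℚ.< B
    below n N≤n = begin-strict
      ∣ seq x n ∣
        ≡⟨ cong ∣_∣ (solve 2 (λ a b → a := (a :- b) :+ b) refl
                       (seq x n) (seq x N)) ⟩
      ∣ (seq x n ℚ.- seq x N) ℚ.+ seq x N ∣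
        ≤⟨ ℚ.∣p+q∣≤∣p∣+∣q∣ (seq x n ℚ.- seq x N) (seq x N) ⟩
      ∣ seq x n ℚ.- seq x N ∣ ℚ.+ ∣ seq x N ∣
        <⟨ ℚ.+-monoˡ-< ∣ seq x N ∣ (tail n N N≤n ℕ.≤-refl) ⟩
      B ∎
      where open +-*-Solver

fromℚ : ℚ → ℝ
fromℚ q = mkℝ (λ _ → q) λ ε ε>0 → 0 , λ _ _ _ _ →
  subst (λ r → ∣ r ∣ ℚ.< ε) (sym (ℚ.+-inverseʳ q)) ε>0

fromℤ : ℤ → ℝ
fromℤ z = fromℚ (z ℚ./ 1)

0ℝ 1ℝ : ℝ
0ℝ = fromℚ 0ℚ
1ℝ = fromℚ 1ℚ

infix  8 -_
infixl 7 _*_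
infixl 6 _+_ _-_

_+_ : ℝ → ℝ → ℝ
seq (x + y) n = seq x n ℚ.+ seq y n
isCauchy (x + y) ε ε>0
  with isCauchy x (½ ℚ.* ε) (half ε>0) | isCauchy y (½ ℚ.* ε) (half ε>0)
... | M , f | N , g = M ℕ.⊔ N , λ m n p q → begin-strict
  ∣ (a m ℚ.+ b m) ℚ.- (a n ℚ.+ b n) ∣
    ≡⟨ cong ∣_∣ (solve 4 (λ s t u v →
         (s :+ t) :- (u :+ v) := (s :- u) :+ (t :- v)) refl
         (a m) (b m) (a n) (b n)) ⟩
  ∣ (a m ℚ.- a n) ℚ.+ (b m ℚ.- b n) ∣
    ≤⟨ ℚ.∣p+q∣≤∣p∣+∣q∣ (a m ℚ.- a n) (b m ℚ.- b n) ⟩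
  ∣ a m ℚ.- a n ∣ ℚ.+ ∣ b m ℚ.- b n ∣
    <⟨ ℚ.+-mono-<
         (f m n (ℕ.m⊔n≤o⇒m≤o M N p) (ℕ.m⊔n≤o⇒m≤o M N q))
         (g m n (ℕ.m⊔n≤o⇒n≤o M N p) (ℕ.m⊔n≤o⇒n≤o M N q)) ⟩
  ½ ℚ.* ε ℚ.+ ½ ℚ.* ε
    ≡⟨ halves ε ⟩
  ε ∎
  where
  open +-*-Solver
  a = seq x
  b = seq y

-_ : ℝ → ℝ
seq (- x) n = ℚ.- seq x n
isCauchy (- x) ε ε>0 with isCauchy x ε ε>0
... | N , f = N , λ m n p q → begin-strict
  ∣ ℚ.- a m ℚ.- (ℚ.- a n) ∣
    ≡⟨ cong ∣_∣ (solve 2 (λ s t → (:- s) :- (:- t) := :- (s :- t)) refl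
         (a m) (a n)) ⟩
  ∣ ℚ.- (a m ℚ.- a n) ∣
    ≡⟨ ℚ.∣-p∣≡∣p∣ (a m ℚ.- a n) ⟩
  ∣ a m ℚ.- a n ∣
    <⟨ f m n p q ⟩
  ε ∎
  where
  open +-*-Solver
  a = seq x

_-_ : ℝ → ℝ → ℝ
x - y = x + (- y)

private
  -- A δ > 0 with B δ + C δ = ε.
  split : ∀ B C ε → 0ℚ ℚ.< B → 0ℚ ℚ.< C → 0ℚ ℚ.< ε →
          ∃[ δ ] 0ℚ ℚ.< δ × B ℚ.* δ ℚ.+ C ℚ.* δ ≡ ε
  split B C ε B>0 C>0 ε>0 = δ , δ>0 , total
    where
    D = B ℚ.+ C
    D⁺ : ℚ.Positive D
    D⁺ = ℚ.positive (ℚ.+-mono-< B>0 C>0)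
    D≢0 : ℚ.NonZero D
    D≢0 = ℚ.pos⇒nonZero D {{D⁺}}
    D⁻¹ = (ℚ.1/ D) {{D≢0}}
    δ = ε ℚ.* D⁻¹
    δ>0 : 0ℚ ℚ.< δ
    δ>0 = ℚ.positive⁻¹ δ
      {{ℚ.pos*pos⇒pos ε {{ℚ.positive ε>0}} D⁻¹ {{ℚ.1/pos⇒pos D {{D⁺}}}}}}
    total : B ℚ.* δ ℚ.+ C ℚ.* δ ≡ ε
    total = begin-equality
      B ℚ.* δ ℚ.+ C ℚ.* δ  ≡⟨ ℚ.*-distribʳ-+ δ B C ⟨
      D ℚ.* (ε ℚ.* D⁻¹)    ≡⟨ ℚ.*-comm D δ ⟩
      ε ℚ.* D⁻¹ ℚ.* D      ≡⟨ ℚ.*-assoc ε D⁻¹ D ⟩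
      ε ℚ.* (D⁻¹ ℚ.* D)    ≡⟨ cong (ε ℚ.*_) (ℚ.*-inverseˡ D {{D≢0}}) ⟩
      ε ℚ.* 1ℚ             ≡⟨ ℚ.*-identityʳ ε ⟩
      ε                    ∎

  product-< : ∀ {D δ p q} → 0ℚ ℚ.< D → ∣ p ∣ ℚ.< D → ∣ q ∣ ℚ.< δ →
              ∣ p ℚ.* q ∣ ℚ.< D ℚ.* δ
  product-< {D} {δ} {p} {q} D>0 p<D q<δ = begin-strict
    ∣ p ℚ.* q ∣      ≡⟨ ℚ.∣p*q∣≡∣p∣*∣q∣ p q ⟩
    ∣ p ∣ ℚ.* ∣ q ∣  ≤⟨ ℚ.*-monoʳ-≤-nonNeg ∣ q ∣ {{ℚ.∣-∣-nonNeg q}} (ℚ.<⇒≤ p<D) ⟩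
    D ℚ.* ∣ q ∣      <⟨ ℚ.*-monoʳ-<-pos D {{ℚ.positive D>0}} q<δ ⟩
    D ℚ.* δ          ∎

  difference-of-products : ∀ p q r s →
    p ℚ.* q ℚ.- r ℚ.* s ≡ p ℚ.* (q ℚ.- s) ℚ.+ s ℚ.* (p ℚ.- r)
  difference-of-products = solve 4 (λ p q r s →
    p :* q :- r :* s := p :* (q :- s) :+ s :* (p :- r)) refl
    where open +-*-Solver

_*_ : ℝ → ℝ → ℝ
seq (x * y) n = seq x n ℚ.* seq y n
isCauchy (x * y) ε ε>0 =
  let a = seq x
      b = seq y
      B , B>0 , N₁ , f = bounded x
      C , C>0 , N₂ , g = bounded y
      δ , δ>0 , total  = split B C ε B>0 C>0 ε>0
      N₃ , h = isCauchy x δ δ>0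
      N₄ , k = isCauchy y δ δ>0
      N₁₂ = N₁ ℕ.⊔ N₂
      N₃₄ = N₃ ℕ.⊔ N₄
  in N₁₂ ℕ.⊔ N₃₄ , λ m n p q →
    let p₁ = ℕ.m⊔n≤o⇒m≤o N₁₂ N₃₄ p
        p₂ = ℕ.m⊔n≤o⇒n≤o N₁₂ N₃₄ p
        q₁ = ℕ.m⊔n≤o⇒m≤o N₁₂ N₃₄ q
        q₂ = ℕ.m⊔n≤o⇒n≤o N₁₂ N₃₄ q
    in begin-strict
    ∣ a m ℚ.* b m ℚ.- a n ℚ.* b n ∣
      ≡⟨ cong ∣_∣ (difference-of-products (a m) (b m) (a n) (b n)) ⟩
    ∣ a m ℚ.* (b m ℚ.- b n) ℚ.+ b n ℚ.* (a m ℚ.- a n) ∣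
      ≤⟨ ℚ.∣p+q∣≤∣p∣+∣q∣ (a m ℚ.* (b m ℚ.- b n)) (b n ℚ.* (a m ℚ.- a n)) ⟩
    ∣ a m ℚ.* (b m ℚ.- b n) ∣ ℚ.+ ∣ b n ℚ.* (a m ℚ.- a n) ∣
      <⟨ ℚ.+-mono-<
           (product-< {p = a m} {q = b m ℚ.- b n} B>0
             (f m (ℕ.m⊔n≤o⇒m≤o N₁ N₂ p₁))
             (k m n (ℕ.m⊔n≤o⇒n≤o N₃ N₄ p₂) (ℕ.m⊔n≤o⇒n≤o N₃ N₄ q₂)))
           (product-< {p = b n} {q = a m ℚ.- a n} C>0
             (g n (ℕ.m⊔n≤o⇒n≤o N₁ N₂ q₁))
             (h m n (ℕ.m⊔n≤o⇒m≤o N₃ N₄ p₂) (ℕ.m⊔n≤o⇒m≤o N₃ N₄ q₂))) ⟩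
    B ℚ.* δ ℚ.+ C ℚ.* δ
      ≡⟨ total ⟩
    ε ∎

ℝ-rawRing : RawRing 0ℓ 0ℓ
ℝ-rawRing = record
  { Carrier = ℝ ; _≈_ = _≈_ ; _+_ = _+_ ; _*_ = _*_ ; -_ = -_
  ; 0# = 0ℝ ; 1# = 1ℝ }

IsInteger : Pred ℝ 0ℓ
IsInteger x = ∃[ m ] x ≈ fromℤ m

_ConvergesTo_ : (ℕ → ℝ) → ℝ → Set
s ConvergesTo x = ∀ ε → 0ℝ < ε →
  ∃[ N ] (∀ n → N ℕ.≤ n → x - ε < s n × s n < x + ε)

partialSum : (ℕ → ℝ) → ℕ → ℝ
partialSum s zero    = 0ℝ
partialSum s (suc n) = partialSum s n + s n

HasSum : (ℕ → ℝ) → ℝ → Set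
HasSum s x = partialSum s ConvergesTo x

1/_! : ℕ → ℝ
1/ k ! = fromℚ ((+ 1 ℚ./ (k !)) {{ℕ._!≢0 k}})

module _ where
  open RawSemiringDefs (RawRing.rawSemiring ℝ-rawRing) using (_^_)

  Cos : ℝ → ℝ → Set
  Cos x = HasSum (λ k → (- 1ℝ) ^ k * (1/ (2 ℕ.* k) ! * x ^ (2 ℕ.* k)))

-- π is twice the least positive zero of the cosine.
IsPi : ℝ → Set
IsPi π = 0ℝ < π
       × Cos (fromℚ ½ * π) 0ℝ
       × (∀ x → 0ℝ < x → x < fromℚ ½ * π → ¬ Cos x 0ℝ)

------------------------------------------------------------------------
-- Complex numbers

record ℂ : Set where
  constructor _+i_
  field
    re im : ℝ

open ℂ public

fromℝ : ℝ → ℂ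
fromℝ x = x +i 0ℝ

𝕚 : ℂ
𝕚 = 0ℝ +i 1ℝ

ℂ-rawRing : RawRing 0ℓ 0ℓ
ℂ-rawRing = record
  { Carrier = ℂ
  ; _≈_ = λ z w → re z ≈ re w × im z ≈ im w
  ; _+_ = λ z w → (re z + re w) +i (im z + im w)
  ; _*_ = λ z w → (re z * re w - im z * im w) +i (re z * im w + im z * re w)
  ; -_  = λ z → (- re z) +i (- im z)
  ; 0#  = fromℝ 0ℝ
  ; 1#  = fromℝ 1ℝ
  }

private
  module ℂ-ring = RawRing ℂ-rawRing

HasSumℂ : (ℕ → ℂ) → ℂ → Set
HasSumℂ s z = HasSum (λ k → re (s k)) (re z) × HasSum (λ k → im (s k)) (im z)

-- The modulus is given by its graph: r is the nonnegative square root of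
-- re² + im².
HasModulus : ℂ → ℝ → Set
HasModulus z r = 0ℝ ≤ r × r * r ≈ re z * re z + im z * im z

------------------------------------------------------------------------
-- Vectors and square matrices

module LinearAlgebra (R : RawRing 0ℓ 0ℓ) where

  private
    module R = RawRing R
    open R using (0#; 1#) renaming (Carrier to A)
    open RawSemiringDefs R.rawSemiring using (sum)

  Matrix : ℕ → Set
  Matrix n = Fin n → Fin n → A

  𝐞 : ∀ {n} → Fin n → Vector A n
  𝐞 i j = if does (i Fin.≟ j) then 1# else 0#

  infix  4 _≋_
  infixr 7 _·_ _*ᵥ_
  infixl 6 _-ᵥ_

  _≋_ : ∀ {n} → Vector A n → Vector A n → Set
  x ≋ y = ∀ i → x i R.≈ y i

  𝟎 : ∀ {n} → Vector A n
  𝟎 _ = 0#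

  _·_ : ∀ {n} → A → Vector A n → Vector A n
  (c · x) i = c R.* x i

  _-ᵥ_ : ∀ {n} → Vector A n → Vector A n → Vector A n
  (x -ᵥ y) i = x i R.+ (R.- y i)

  dot : ∀ {n} → Vector A n → Vector A n → A
  dot x y = sum (λ i → x i R.* y i)

  _*ᵥ_ : ∀ {n} → Matrix n → Vector A n → Vector A n
  (M *ᵥ x) i = dot (M i) x

  matrixRawRing : ℕ → RawRing 0ℓ 0ℓ
  matrixRawRing n = record
    { Carrier = Matrix n
    ; _≈_ = λ M N → ∀ i j → M i j R.≈ N i j
    ; _+_ = λ M N i j → M i j R.+ N i j
    ; _*_ = λ M N i j → sum (λ k → M i k R.* N k j)
    ; -_  = λ M i j → R.- M i j
    ; 0#  = λ _ _ → 0#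
    ; 1#  = 𝐞
    }

module Mℝ = LinearAlgebra ℝ-rawRing
module Mℂ = LinearAlgebra ℂ-rawRing

-- U = exp(A), the entrywise sum of the series of the A^k / k!.
IsMatrixExp : ∀ {n} → Mℂ.Matrix n → Mℂ.Matrix n → Set
IsMatrixExp {n} A U = ∀ i j →
  HasSumℂ (λ k → fromℝ (1/ k !) ℂ-ring.* (A ^ k) i j) (U i j)
  where
  open RawSemiringDefs (RawRing.rawSemiring (Mℂ.matrixRawRing n)) using (_^_)

Subspace : ℕ → Set₁
Subspace n = Pred (Vector ℝ n) 0ℓ

IsOrthogonalProjectionOnto : ∀ {n} → Mℝ.Matrix n → Subspace n → Set
IsOrthogonalProjectionOnto P S =
  (∀ x → S (P *ᵥ x)) × (∀ x y → S y → dot (x -ᵥ P *ᵥ x) y ≈ 0ℝ)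
  where open Mℝ

Eigenspace : ∀ {n} → Mℝ.Matrix n → ℝ → Subspace n
Eigenspace L λ′ x = L *ᵥ x ≋ λ′ · x
  where open Mℝ

IsEigenvalue : ∀ {n} → Mℝ.Matrix n → Pred ℝ 0ℓ
IsEigenvalue L λ′ = ∃[ x ] Eigenspace L λ′ x × ¬ (x Mℝ.≋ Mℝ.𝟎)

------------------------------------------------------------------------
-- Graphs

record Graph (n : ℕ) : Set where
  field
    adj    : Fin n → Fin n → Bool
    symm   : ∀ a b → adj a b ≡ adj b a
    irrefl : ∀ a → adj a a ≡ false

open Graph public

infix 4 _∼[_]_

_∼[_]_ : ∀ {n} → Fin n → Graph n → Fin n → Set
a ∼[ G ] b = adj G a b ≡ true

-- Vertex (l , u) of the blow-up is encoded as combine l u.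
blowUp : ∀ {k} n → Graph k → Graph (n ℕ.* k)
blowUp {k} n G = record
  { adj    = λ a b → adj G (remainder {n} k a) (remainder {n} k b)
  ; symm   = λ a b → symm G (remainder {n} k a) (remainder {n} k b)
  ; irrefl = λ a → irrefl G (remainder {n} k a)
  }

infixl 6 _∪_

_∪_ : ∀ {n} → Graph n → Graph n → Graph n
G ∪ H = record
  { adj    = λ a b → adj G a b ∨ adj H a b
  ; symm   = λ a b → cong₂ _∨_ (symm G a b) (symm H a b)
  ; irrefl = λ a → cong₂ _∨_ (irrefl G a) (irrefl H a)
  }

-- An edge set is represented by the graph it spans on the same vertices.
IsMatching : ∀ {n} → Graph n → Set
IsMatching M = ∀ a b c → a ∼[ M ] b → a ∼[ M ] c → b ≡ c

Copies : ∀ {k} n → Fin k → Pred (Fin (n ℕ.* k)) 0ℓ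
Copies n v a = ∃[ j ] a ≡ combine {n} j v

adjacencyMatrix : ∀ {n} → Graph n → Mℝ.Matrix n
adjacencyMatrix G a b = if adj G a b then 1ℝ else 0ℝ

degreeMatrix : ∀ {n} → Graph n → Mℝ.Matrix n
degreeMatrix G a b = if does (a Fin.≟ b) then sum (adjacencyMatrix G a) else 0ℝ
  where open RawSemiringDefs (RawRing.rawSemiring ℝ-rawRing) using (sum)

laplacian : ∀ {n} → Graph n → Mℝ.Matrix n
laplacian G a b = degreeMatrix G a b - adjacencyMatrix G a b

-- E_λ is pinned down by its defining property, which has exactly one solution.
eigenvalueSupport : ∀ {n} → Graph n → Fin n → Pred ℝ 0ℓ
eigenvalueSupport G v λ′ =
  IsEigenvalue L λ′ ×
  ∃[ E ] IsOrthogonalProjectionOnto E (Eigenspace L λ′) × ¬ (E *ᵥ 𝐞 v ≋ 𝟎)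
  where
  open Mℝ
  L = laplacian G

-- U = exp(itL)
IsTransitionMatrix : ∀ {n} → Graph n → ℝ → Mℂ.Matrix n → Set
IsTransitionMatrix G t =
  IsMatrixExp (λ a b → (𝕚 ℂ-ring.* fromℝ t) ℂ-ring.* fromℝ (laplacian G a b))

LaplacianPST : ∀ {n} → Graph n → ℝ → Fin n → Fin n → Set
LaplacianPST G τ a b =
  ∃[ U ] IsTransitionMatrix G τ U × ∃[ γ ] U *ᵥ 𝐞 a ≋ γ · 𝐞 b
  where open Mℂ

PeriodicAt : ∀ {n} → Graph n → ℝ → Fin n → Set
PeriodicAt G τ a =
  0ℝ < τ × ∃[ U ] IsTransitionMatrix G τ U × HasModulus (U a a) 1ℝ

{-# OPTIONS --safe #-}

-- Write τ = π/2 and let a = (j , v).  The Laplacian of the blow-up commutes with that of M, and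
-- it maps 1 ⊗ x to n (1 ⊗ Lx), where L is the Laplacian of G.  If a is matched with b, then e_a is the
-- sum of (e_a − e_b)/2, of (e_a + e_b)/2 − (1 ⊗ e_v)/n, and of (1 ⊗ e_v)/n.  The first two vectors are
-- eigenvectors of X for n deg v + 2 and n deg v, and the third is a sum of eigenvectors for n m with m
-- in σ_v(G).  Since 4 ∣ n and m is an integer, exp (iτL_X) negates the first vector and fixes the
-- others, so it sends e_a to e_b; for an unmatched a, the vector e_a − (1 ⊗ e_v)/n replaces the first two.
--
-- There is no spectral theorem to appeal to.  That e_v is a sum of rational eigenvectors with integer
-- eigenvalues is proved by contradiction.  Put w = ∏ (L − m) e_v, over all integers m up to a bound for the
-- spectrum.  If w ≠ 0, the Lanczos recurrence started at w produces rational polynomials p₁, …, p_d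
-- with w_d = p_d (L) w = 0.  Bisecting the decidable set where p₁, …, p_d are all positive gives a
-- real root λ of p_d, and the Christoffel–Darboux identity an eigenvector y for λ with ⟨y , w⟩ = 1.
-- Hence λ is in σ_v(G), so it is one of the integers m, and then ⟨y , w⟩ = 0.
module Submission where

open import Algebra.Bundles using (CommutativeRing)
open import Algebra.Bundles.Raw using (RawRing; RawSemiring)
import Algebra.Definitions.RawMonoid as RawMonoidDefs
import Algebra.Definitions.RawSemiring as RawSemiringDefs
open import Algebra.Structures using (IsCommutativeRing)
open import Data.Bool.Base using (Bool; true; false; if_then_else_)
open import Data.Fin.Base using (Fin; zero; suc)
import Data.Fin.Properties as Fin
open import Data.Nat.Base as ℕ using (ℕ; zero; suc; z≤n; s≤s)
open import Data.Nat.Divisibility using (_∣_)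
import Data.Nat.Properties as ℕ
open import Data.Product.Base using (∃-syntax; _×_; _,_; proj₁; proj₂)
open import Data.Rational.Base using (ℚ; ½)
import Data.Rational.Properties as ℚ
open import Data.Sum.Base using (_⊎_; inj₁; inj₂)
open import Data.Unit.Base using (⊤; tt)
open import Data.Vec.Functional using (Vector)
open import Function.Base using (_∘_)
open import Level using (0ℓ)
open import Relation.Binary.PropositionalEquality as ≡ using (_≡_)
open import Relation.Nullary using (¬_; Dec; yes; no; contradiction)
open import Relation.Nullary.Decidable using (does; dec⇒maybe; _×-dec_)
open import Relation.Unary using (Decidable; _∈_; _⊆_)
open import Tactic.RingSolver using (solve-∀)
open import Tactic.RingSolver.Core.AlmostCommutativeRing using (AlmostCommutativeRing; fromCommutativeRing)
import Defs as ℝ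
open import Defs using
  ( module LinearAlgebra; module Mℝ; module Mℂ; ℝ; mkℝ; seq; isCauchy; IsCauchy; mk≈; close; mk<; gap; gap>0; separated
  ; fromℚ; 0ℝ; 1ℝ; ℝ-rawRing; ℂ; re; im; fromℝ; ℂ-rawRing; HasSum; partialSum; Cos; HasModulus
  ; eigenvalueSupport; IsInteger; IsTransitionMatrix
  ; Graph; adj; symm; irrefl; adjacencyMatrix; laplacian; LaplacianPST; PeriodicAt )

-- Equality and order of Cauchy reals are undecidable, so Gram-Schmidt and the choice of a root over
-- ℝ are available only under a double negation. It disappears because their purpose, `w ≋ 𝟎`,
-- concerns a rational vector and is decidable. Apart from τ and the eigenpair of that
-- contradiction, all data are rational: an equation between reals is read as a null sequence of
-- rationals, and identities are checked stage by stage.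
--
-- Trigonometry is finite in the same way. The addition formulas hold for partial sums up to an
-- exponential tail, and cos τ = 0 gives sin² τ = 1, hence exp (2iτ) = -1 and exp (4iτ) = 1. So an
-- eigenvalue n m with 4 ∣ n contributes the factor 1, and only the 2 added by a matching edge is
-- visible.
--
-- The vector (1 ⊗ e_v)/n is subtracted because it makes the remaining vectors sum to zero over the
-- copies of v: neighbours outside these copies then see nothing, and the blow-up acts by the scalar
-- n deg v.

-- Linear algebra over a commutative ring: Gram-Schmidt and eigenprojections.

module LinearAlgebraProperties (R : RawRing 0ℓ 0ℓ)
  (isCommutativeRing : IsCommutativeRing (RawRing._≈_ R) (RawRing._+_ R) (RawRing._*_ R)
                                         (RawRing.-_ R) (RawRing.0# R) (RawRing.1# R)) where

  open RawRing R

  private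
    commutativeRing : CommutativeRing 0ℓ 0ℓ
    commutativeRing = record { isCommutativeRing = isCommutativeRing }

  open CommutativeRing commutativeRing
    hiding (zero; rawRing; isCommutativeRing; Carrier; _≈_; _+_; _*_; -_; 0#; 1#)
  open LinearAlgebra R public
  open import Algebra.Properties.Semiring.Sum semiring public
    using (sum; sum-cong-≋; ∑-distrib-+; ∑-comm; *-distribˡ-sum; *-distribʳ-sum; sum-replicate-zero)
  open import Algebra.Properties.Ring ring using (-1*x≈-x)
  open import Algebra.Properties.CommutativeSemigroup *-commutativeSemigroup using (x∙yz≈y∙xz; xy∙z≈y∙xz; xy∙z≈xz∙y)
  open import Algebra.Properties.AbelianGroup +-abelianGroup
    using (xyx⁻¹≈y; ε⁻¹≈ε; x∙y⁻¹≈ε⇒x≈y; x≈y⇒x∙y⁻¹≈ε; ⁻¹-anti-homo-//)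
  open import Relation.Binary.Reasoning.Setoid setoid

  infixl 6 _+ᵥ_
  _+ᵥ_ : ∀ {n} → Vector Carrier n → Vector Carrier n → Vector Carrier n
  (x +ᵥ y) i = x i + y i

  Symmetric : ∀ {n} → Matrix n → Set
  Symmetric M = ∀ i j → M i j ≈ M j i

  dot-cong : ∀ {n} {x x′ y y′ : Vector Carrier n} → x ≋ x′ → y ≋ y′ → dot x y ≈ dot x′ y′
  dot-cong p q = sum-cong-≋ (λ i → *-cong (p i) (q i))

  dot-congʳ : ∀ {n} (x : Vector Carrier n) {y y′} → y ≋ y′ → dot x y ≈ dot x y′
  dot-congʳ x = dot-cong (λ _ → refl)

  dot-congˡ : ∀ {n} {x x′ : Vector Carrier n} y → x ≋ x′ → dot x y ≈ dot x′ y
  dot-congˡ y p = dot-cong p (λ _ → refl)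

  dot-comm : ∀ {n} (x y : Vector Carrier n) → dot x y ≈ dot y x
  dot-comm x y = sum-cong-≋ (λ i → *-comm (x i) (y i))

  dot-+ʳ : ∀ {n} (x y z : Vector Carrier n) → dot x (y +ᵥ z) ≈ dot x y + dot x z
  dot-+ʳ x y z = trans (sum-cong-≋ (λ i → distribˡ (x i) (y i) (z i)))
    (∑-distrib-+ (λ i → x i * y i) (λ i → x i * z i))

  dot-·ʳ : ∀ {n} (x : Vector Carrier n) c y → dot x (c · y) ≈ c * dot x y
  dot-·ʳ x c y = trans (sum-cong-≋ (λ i → x∙yz≈y∙xz (x i) c (y i)))
    (sym (*-distribˡ-sum c (λ i → x i * y i)))

  dot--ʳ : ∀ {n} (x y z : Vector Carrier n) → dot x (y -ᵥ z) ≈ dot x y - dot x z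
  dot--ʳ x y z = begin
    dot x (y -ᵥ z)              ≈⟨ dot-congʳ x (λ i → +-congˡ (sym (-1*x≈-x (z i)))) ⟩
    dot x (y +ᵥ - 1# · z)       ≈⟨ dot-+ʳ x y (- 1# · z) ⟩
    dot x y + dot x (- 1# · z)  ≈⟨ +-congˡ (trans (dot-·ʳ x (- 1#) z) (-1*x≈-x (dot x z))) ⟩
    dot x y - dot x z           ∎

  dot-+ˡ : ∀ {n} (x y z : Vector Carrier n) → dot (x +ᵥ y) z ≈ dot x z + dot y z
  dot-+ˡ x y z = trans (dot-comm (x +ᵥ y) z)
    (trans (dot-+ʳ z x y) (+-cong (dot-comm z x) (dot-comm z y)))

  dot-·ˡ : ∀ {n} c (x y : Vector Carrier n) → dot (c · x) y ≈ c * dot x y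
  dot-·ˡ c x y = trans (dot-comm (c · x) y) (trans (dot-·ʳ y c x) (*-congˡ (dot-comm y x)))

  dot--ˡ : ∀ {n} (x y z : Vector Carrier n) → dot (x -ᵥ y) z ≈ dot x z - dot y z
  dot--ˡ x y z = trans (dot-comm (x -ᵥ y) z)
    (trans (dot--ʳ z x y) (+-cong (dot-comm z x) (-‿cong (dot-comm z y))))

  dot-0ʳ : ∀ {n} (x : Vector Carrier n) → dot x 𝟎 ≈ 0#
  dot-0ʳ {n} x = trans (sum-cong-≋ (λ i → zeroʳ (x i))) (sum-replicate-zero n)

  dot-0ˡ : ∀ {n} (x : Vector Carrier n) → dot 𝟎 x ≈ 0#
  dot-0ˡ x = trans (dot-comm 𝟎 x) (dot-0ʳ x)

  dot-𝐞ˡ : ∀ {n} (i : Fin n) (x : Vector Carrier n) → dot (𝐞 i) x ≈ x i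
  dot-𝐞ˡ {suc n} zero x = trans (+-cong (*-identityˡ (x zero)) (dot-0ˡ (x ∘ suc))) (+-identityʳ (x zero))
  dot-𝐞ˡ (suc i) x = trans (+-cong (zeroˡ (x zero)) (dot-𝐞ˡ i (x ∘ suc))) (+-identityˡ (x (suc i)))

  *ᵥ-cong : ∀ {n} (M : Matrix n) {x y} → x ≋ y → M *ᵥ x ≋ M *ᵥ y
  *ᵥ-cong M p i = dot-congʳ (M i) p

  *ᵥ-+ : ∀ {n} (M : Matrix n) x y → M *ᵥ (x +ᵥ y) ≋ M *ᵥ x +ᵥ M *ᵥ y
  *ᵥ-+ M x y i = dot-+ʳ (M i) x y

  *ᵥ-· : ∀ {n} (M : Matrix n) c x → M *ᵥ (c · x) ≋ c · M *ᵥ x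
  *ᵥ-· M c x i = dot-·ʳ (M i) c x

  *ᵥ-- : ∀ {n} (M : Matrix n) x y → M *ᵥ (x -ᵥ y) ≋ M *ᵥ x -ᵥ M *ᵥ y
  *ᵥ-- M x y i = dot--ʳ (M i) x y

  *ᵥ-adjoint : ∀ {n} (M : Matrix n) → Symmetric M → ∀ x y → dot (M *ᵥ x) y ≈ dot x (M *ᵥ y)
  *ᵥ-adjoint {n} M M-sym x y = begin
    sum (λ i → dot (M i) x * y i)
      ≈⟨ sum-cong-≋ (λ i → *-distribʳ-sum (y i) (λ j → M i j * x j)) ⟩
    sum (λ i → sum (λ j → M i j * x j * y i))
      ≈⟨ ∑-comm (λ i j → M i j * x j * y i) ⟩
    sum (λ j → sum (λ i → M i j * x j * y i))
      ≈⟨ sum-cong-≋ (λ j → sum-cong-≋ (λ i →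
           trans (*-congʳ (*-congʳ (M-sym i j))) (xy∙z≈y∙xz (M j i) (x j) (y i)))) ⟩
    sum (λ j → sum (λ i → x j * (M j i * y i)))
      ≈⟨ sum-cong-≋ (λ j → sym (*-distribˡ-sum (x j) (λ i → M j i * y i))) ⟩
    sum (λ j → x j * dot (M j) y) ∎

  x+[y-x]≈y : ∀ x y → x + (y - x) ≈ y
  x+[y-x]≈y x y = trans (sym (+-assoc x y (- x))) (xyx⁻¹≈y x y)

  x-0≈x : ∀ x → x - 0# ≈ x
  x-0≈x x = trans (+-congˡ ε⁻¹≈ε) (+-identityʳ x)

  -- The orthogonal projection onto the span of the `b i`, described without naming the span: its
  -- values on the generators and on their common orthogonal complement. In this form it can be
  -- extended by one generator at a time.
  record SpanProjection {r k} (b : Fin r → Vector Carrier k) : Set where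
    field
      P           : Matrix k
      P-symmetric : Symmetric P
      P-fixes     : ∀ i → P *ᵥ b i ≋ b i
      P-kills     : ∀ y → (∀ i → dot (b i) y ≈ 0#) → P *ᵥ y ≋ 𝟎

    adjoint : ∀ x y → dot (P *ᵥ x) y ≈ dot x (P *ᵥ y)
    adjoint = *ᵥ-adjoint P P-symmetric

  emptySpan : ∀ {k} (b : Fin 0 → Vector Carrier k) → SpanProjection b
  emptySpan b = record
    { P = λ _ _ → 0# ; P-symmetric = λ _ _ → refl ; P-fixes = λ () ; P-kills = λ y _ i → dot-0ˡ y }

  module GramSchmidtStep {r k} (b : Fin (suc r) → Vector Carrier k) (S : SpanProjection (b ∘ suc)) where
    open SpanProjection S
    b₀ = b zero

    u : Vector Carrier k
    u = b₀ -ᵥ P *ᵥ b₀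

    u⊥ : ∀ y → (∀ i → dot (b i) y ≈ 0#) → dot u y ≈ 0#
    u⊥ y b⊥y = begin
      dot u y                      ≈⟨ dot--ˡ b₀ (P *ᵥ b₀) y ⟩
      dot b₀ y - dot (P *ᵥ b₀) y   ≈⟨ +-cong (b⊥y zero) (-‿cong (adjoint b₀ y)) ⟩
      0# - dot b₀ (P *ᵥ y)         ≈⟨ +-congˡ (-‿cong (dot-congʳ b₀ (P-kills y (b⊥y ∘ suc)))) ⟩
      0# - dot b₀ 𝟎                ≈⟨ +-congˡ (-‿cong (dot-0ʳ b₀)) ⟩
      0# - 0#                      ≈⟨ -‿inverseʳ 0# ⟩
      0#                           ∎

    b⊥u : ∀ i → dot (b (suc i)) u ≈ 0#
    b⊥u i = begin
      dot (b (suc i)) u                                  ≈⟨ dot--ʳ (b (suc i)) b₀ (P *ᵥ b₀) ⟩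
      dot (b (suc i)) b₀ - dot (b (suc i)) (P *ᵥ b₀)     ≈⟨ +-congˡ (-‿cong (sym (adjoint (b (suc i)) b₀))) ⟩
      dot (b (suc i)) b₀ - dot (P *ᵥ b (suc i)) b₀       ≈⟨ +-congˡ (-‿cong (dot-congˡ b₀ (P-fixes i))) ⟩
      dot (b (suc i)) b₀ - dot (b (suc i)) b₀            ≈⟨ -‿inverseʳ _ ⟩
      0#                                                 ∎

    u·b₀≈u·u : dot u b₀ ≈ dot u u
    u·b₀≈u·u = sym (begin
      dot u (b₀ -ᵥ P *ᵥ b₀)            ≈⟨ dot--ʳ u b₀ (P *ᵥ b₀) ⟩
      dot u b₀ - dot u (P *ᵥ b₀)       ≈⟨ +-congˡ (-‿cong (trans (sym (adjoint u b₀)) (dot-congˡ b₀ (P-kills u b⊥u)))) ⟩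
      dot u b₀ - dot 𝟎 b₀              ≈⟨ +-congˡ (-‿cong (dot-0ˡ b₀)) ⟩
      dot u b₀ - 0#                    ≈⟨ x-0≈x (dot u b₀) ⟩
      dot u b₀                         ∎)

    degenerate : u ≋ 𝟎 → SpanProjection b
    degenerate u≋0 = record
      { P = P ; P-symmetric = P-symmetric
      ; P-fixes = λ { zero j → sym (x∙y⁻¹≈ε⇒x≈y (b₀ j) ((P *ᵥ b₀) j) (u≋0 j)) ; (suc i) → P-fixes i }
      ; P-kills = λ y b⊥y → P-kills y (b⊥y ∘ suc) }

    -- The rank-one projection `c u uᵀ` with c = 1/⟨u , u⟩ is added. It vanishes on the old
    -- generators, which are orthogonal to `u`, and sends `b₀` to `u` because ⟨u , b₀⟩ = ⟨u , u⟩; so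
    -- `b₀` goes to P b₀ + u = b₀.
    extend : ∀ c → c * dot u u ≈ 1# → SpanProjection b
    extend c c*uu≈1 = record
      { P = P′
      ; P-symmetric = λ i j → +-cong (P-symmetric i j) (*-congˡ (*-comm (u i) (u j)))
      ; P-fixes = λ
        { zero j → begin
            (P′ *ᵥ b₀) j                            ≈⟨ P′-apply b₀ j ⟩
            (P *ᵥ b₀) j + c * dot u b₀ * u j        ≈⟨ +-congˡ (*-congʳ (trans (*-congˡ u·b₀≈u·u) c*uu≈1)) ⟩
            (P *ᵥ b₀) j + 1# * u j                  ≈⟨ +-congˡ (*-identityˡ (u j)) ⟩
            (P *ᵥ b₀) j + (b₀ j - (P *ᵥ b₀) j)      ≈⟨ x+[y-x]≈y ((P *ᵥ b₀) j) (b₀ j) ⟩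
            b₀ j                                    ∎
        ; (suc i) j → trans (unchanged (b (suc i)) (trans (dot-comm u (b (suc i))) (b⊥u i)) j) (P-fixes i j) }
      ; P-kills = λ y b⊥y j → trans (unchanged y (u⊥ y b⊥y) j) (P-kills y (b⊥y ∘ suc) j)
      }
      where
      P′ : Matrix k
      P′ i j = P i j + c * (u i * u j)
      P′-apply : ∀ y i → (P′ *ᵥ y) i ≈ (P *ᵥ y) i + c * dot u y * u i
      P′-apply y i = begin
        dot (P i +ᵥ (λ j → c * (u i * u j))) y      ≈⟨ dot-+ˡ (P i) (λ j → c * (u i * u j)) y ⟩
        (P *ᵥ y) i + dot (λ j → c * (u i * u j)) y  ≈⟨ +-congˡ (dot-congˡ y (λ j → sym (*-assoc c (u i) (u j)))) ⟩
        (P *ᵥ y) i + dot ((c * u i) · u) y          ≈⟨ +-congˡ (dot-·ˡ (c * u i) u y) ⟩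
        (P *ᵥ y) i + c * u i * dot u y              ≈⟨ +-congˡ (xy∙z≈xz∙y c (u i) (dot u y)) ⟩
        (P *ᵥ y) i + c * dot u y * u i              ∎
      unchanged : ∀ y → dot u y ≈ 0# → P′ *ᵥ y ≋ P *ᵥ y
      unchanged y u⊥y i = begin
        (P′ *ᵥ y) i                     ≈⟨ P′-apply y i ⟩
        (P *ᵥ y) i + c * dot u y * u i  ≈⟨ +-congˡ (*-congʳ (trans (*-congˡ u⊥y) (zeroʳ c))) ⟩
        (P *ᵥ y) i + 0# * u i           ≈⟨ +-congˡ (zeroˡ (u i)) ⟩
        (P *ᵥ y) i + 0#                 ≈⟨ +-identityʳ _ ⟩
        (P *ᵥ y) i                      ∎

  -- ker (L − λ) is the orthogonal complement of the rows of L − λ, so I minus the projection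
  -- onto their span is the projection onto the eigenspace.
  module EigenspaceComplement {k} (L : Matrix k) (λ′ : Carrier) where
    rows : Fin k → Vector Carrier k
    rows i = L i -ᵥ λ′ · 𝐞 i

    rows-dot : ∀ i y → dot (rows i) y ≈ (L *ᵥ y) i - λ′ * y i
    rows-dot i y = trans (dot--ˡ (L i) (λ′ · 𝐞 i) y)
      (+-congˡ (-‿cong (trans (dot-·ˡ λ′ (𝐞 i) y) (*-congˡ (dot-𝐞ˡ i y)))))

    module _ (S : SpanProjection rows) where
      open SpanProjection S

      E : Matrix k
      E i j = 𝐞 i j - P i j

      E-apply : ∀ x → E *ᵥ x ≋ x -ᵥ P *ᵥ x
      E-apply x i = trans (dot--ˡ (𝐞 i) (P i) x) (+-congʳ (dot-𝐞ˡ i x))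

      E-eigen : ∀ x → L *ᵥ (E *ᵥ x) ≋ λ′ · E *ᵥ x
      E-eigen x i = x∙y⁻¹≈ε⇒x≈y _ _ (trans (sym (rows-dot i (E *ᵥ x))) (begin
        dot (rows i) (E *ᵥ x)                       ≈⟨ dot-congʳ (rows i) (E-apply x) ⟩
        dot (rows i) (x -ᵥ P *ᵥ x)                  ≈⟨ dot--ʳ (rows i) x (P *ᵥ x) ⟩
        dot (rows i) x - dot (rows i) (P *ᵥ x)      ≈⟨ +-congˡ (-‿cong (sym (adjoint (rows i) x))) ⟩
        dot (rows i) x - dot (P *ᵥ rows i) x        ≈⟨ +-congˡ (-‿cong (dot-congˡ x (P-fixes i))) ⟩
        dot (rows i) x - dot (rows i) x             ≈⟨ -‿inverseʳ _ ⟩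
        0#                                          ∎))

      E-orthogonal : ∀ x y → L *ᵥ y ≋ λ′ · y → dot (x -ᵥ E *ᵥ x) y ≈ 0#
      E-orthogonal x y Ly≋λy = begin
        dot (x -ᵥ E *ᵥ x) y           ≈⟨ dot-congˡ y (λ i → +-congˡ (-‿cong (E-apply x i))) ⟩
        dot (x -ᵥ (x -ᵥ P *ᵥ x)) y    ≈⟨ dot-congˡ y (λ i → trans (+-congˡ (⁻¹-anti-homo-// (x i) ((P *ᵥ x) i)))
                                                           (x+[y-x]≈y (x i) ((P *ᵥ x) i))) ⟩
        dot (P *ᵥ x) y                ≈⟨ adjoint x y ⟩
        dot x (P *ᵥ y)                ≈⟨ dot-congʳ x (P-kills y (λ i → trans (rows-dot i y) (x≈y⇒x∙y⁻¹≈ε (Ly≋λy i)))) ⟩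
        dot x 𝟎                       ≈⟨ dot-0ʳ x ⟩
        0#                            ∎

      -- If E e_i = 0, then e_i = e_i - E e_i is orthogonal to the whole eigenspace. Read
      -- contrapositively: an eigenvector with a nonzero entry at i puts its eigenvalue into the
      -- support of i.
      E-kernel : ∀ i y → L *ᵥ y ≋ λ′ · y → (∀ j → E j i ≈ 0#) → y i ≈ 0#
      E-kernel i y Ly≋λy Ee≋0 = begin
        y i                           ≈⟨ dot-𝐞ˡ i y ⟨
        dot (𝐞 i) y                   ≈⟨ dot-congˡ y (λ j → sym (trans (+-congˡ (-‿cong (column j))) (x-0≈x (𝐞 i j)))) ⟩
        dot (𝐞 i -ᵥ E *ᵥ 𝐞 i) y       ≈⟨ E-orthogonal (𝐞 i) y Ly≋λy ⟩
        0#                            ∎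
        where
        column : E *ᵥ 𝐞 i ≋ 𝟎
        column j = trans (dot-comm (E j) (𝐞 i)) (trans (dot-𝐞ˡ i (E j)) (Ee≋0 j))

  -- The statement is parametrised by the operations of linear algebra: they can be instantiated
  -- with provably equal ones, without Agda comparing vectors of real numbers by unfolding them.
  module Operations {k}
    (_*ᵥ_ : Matrix k → Vector Carrier k → Vector Carrier k)
    (dot : Vector Carrier k → Vector Carrier k → Carrier)
    (_-ᵥ_ : Vector Carrier k → Vector Carrier k → Vector Carrier k) where

    Eigenvector : Matrix k → Carrier → Vector Carrier k → Set
    Eigenvector L λ′ y = ∀ i → sum (λ j → L i j * y j) ≈ λ′ * y i

    Eigenprojection : Matrix k → Carrier → Set
    Eigenprojection L λ′ = ∃[ E ]
      (∀ x → Eigenvector L λ′ (E *ᵥ x))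
      × (∀ x y → Eigenvector L λ′ y → dot (x -ᵥ (E *ᵥ x)) y ≈ 0#)
      × (∀ i y → Eigenvector L λ′ y → (∀ j → E j i ≈ 0#) → y i ≈ 0#)

  -- Over the reals the dichotomy for a vector is only available up to double negation.
  ZeroOrNormalisable : ∀ {k} → Vector Carrier k → Set
  ZeroOrNormalisable u = u ≋ 𝟎 ⊎ ∃[ c ] (c * dot u u ≈ 1#)

  module _ (dichotomy : ∀ {k} (u : Vector Carrier k) → ¬ ¬ ZeroOrNormalisable u) where

    -- Each generator costs one appeal to `dichotomy`, and a double negation passes through finitely
    -- many appeals.
    spanProjection : ∀ r {k} (b : Fin r → Vector Carrier k) → ¬ ¬ SpanProjection b
    spanProjection zero    b none = none (emptySpan b)
    spanProjection (suc r) b none = spanProjection r (b ∘ suc) λ S →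
      dichotomy (GramSchmidtStep.u b S) λ
        { (inj₁ u≋0)            → none (GramSchmidtStep.degenerate b S u≋0)
        ; (inj₂ (c , c*uu≈1))   → none (GramSchmidtStep.extend b S c c*uu≈1) }

    eigenprojection : ∀ {k m d s} → _*ᵥ_ {k} ≡ m → dot {k} ≡ d → _-ᵥ_ {k} ≡ s →
      ∀ L λ′ → ¬ ¬ Operations.Eigenprojection m d s L λ′
    eigenprojection {k} ≡.refl ≡.refl ≡.refl L λ′ none = spanProjection k rows λ S →
      none (E S , E-eigen S , E-orthogonal S , E-kernel S)
      where open EigenspaceComplement L λ′

-- Ordered-field arithmetic of ℚ, natural numbers in ℚ, and null sequences.

module Rationals where

  open import Data.Integer.Base as ℤ using (ℤ; +_; -[1+_])
  import Data.Integer.Properties as ℤ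
  open import Data.Rational.Unnormalised.Base as ℚᵘ using (mkℚᵘ)
  import Data.Rational.Unnormalised.Properties as ℚᵘ
  open import Algebra.Properties.Monoid.Mult ℚ.+-0-monoid as Mult using () renaming (_×_ to _×ℚ_)
  import Algebra.Properties.Semiring.Mult
  open import Data.Rational.Base
  open ≡

  ℚ-acr : AlmostCommutativeRing 0ℓ 0ℓ
  ℚ-acr = fromCommutativeRing ℚ.+-*-commutativeRing (λ x → dec⇒maybe (0ℚ ℚ.≟ x))

  ≤-shift : ∀ {p q} r → 0ℚ ≤ r → q ≡ p + r → p ≤ q
  ≤-shift {p} r 0≤r refl = subst (_≤ p + r) (ℚ.+-identityʳ p) (ℚ.+-monoʳ-≤ p 0≤r)

  <-shift : ∀ {p q} r → 0ℚ < r → q ≡ p + r → p < q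
  <-shift {p} r 0<r refl = subst (_< p + r) (ℚ.+-identityʳ p) (ℚ.+-monoʳ-< p 0<r)

  p≤q⇒0≤q-p : ∀ {p q} → p ≤ q → 0ℚ ≤ q - p
  p≤q⇒0≤q-p {p} {q} p≤q = subst (_≤ q - p) (ℚ.+-inverseʳ p) (ℚ.+-monoˡ-≤ (- p) p≤q)

  p<q⇒0<q-p : ∀ {p q} → p < q → 0ℚ < q - p
  p<q⇒0<q-p {p} {q} p<q = subst (_< q - p) (ℚ.+-inverseʳ p) (ℚ.+-monoˡ-< (- p) p<q)

  *-nonNeg : ∀ {p q} → 0ℚ ≤ p → 0ℚ ≤ q → 0ℚ ≤ p * q
  *-nonNeg {p} {q} 0≤p 0≤q = ℚ.nonNegative⁻¹ (p * q)
    {{ℚ.nonNeg*nonNeg⇒nonNeg p {{nonNegative 0≤p}} q {{nonNegative 0≤q}}}}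

  *-pos : ∀ {p q} → 0ℚ < p → 0ℚ < q → 0ℚ < p * q
  *-pos {p} {q} 0<p 0<q = ℚ.positive⁻¹ (p * q)
    {{ℚ.pos*pos⇒pos p {{positive 0<p}} q {{positive 0<q}}}}

  +-nonNeg : ∀ {p q} → 0ℚ ≤ p → 0ℚ ≤ q → 0ℚ ≤ p + q
  +-nonNeg 0≤p 0≤q = ℚ.+-mono-≤ 0≤p 0≤q

  0≤1 : 0ℚ ≤ 1ℚ
  0≤1 = ℚ.nonNegative⁻¹ 1ℚ

  0<1 : 0ℚ < 1ℚ
  0<1 = ℚ.positive⁻¹ 1ℚ

  0<½ : 0ℚ < ½
  0<½ = ℚ.positive⁻¹ ½

  ½*-pos : ∀ {ε} → 0ℚ < ε → 0ℚ < ½ * ε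
  ½*-pos = *-pos 0<½

  ½+½ : ∀ ε → ½ * ε + ½ * ε ≡ ε
  ½+½ = solve-∀ ℚ-acr

  *-mono-≤ : ∀ {p q r s} → 0ℚ ≤ p → p ≤ q → 0ℚ ≤ r → r ≤ s → p * r ≤ q * s
  *-mono-≤ {p} {q} {r} {s} 0≤p p≤q 0≤r r≤s = ℚ.≤-trans
    (ℚ.*-monoˡ-≤-nonNeg p {{nonNegative 0≤p}} r≤s)
    (ℚ.*-monoʳ-≤-nonNeg s {{nonNegative (ℚ.≤-trans 0≤r r≤s)}} p≤q)

  *-monoˡ : ∀ {p q} r → 0ℚ ≤ r → p ≤ q → r * p ≤ r * q
  *-monoˡ r 0≤r = ℚ.*-monoˡ-≤-nonNeg r {{nonNegative 0≤r}}

  ∣∣-≤ : ∀ {p q} → p ≤ q → - p ≤ q → ∣ p ∣ ≤ q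
  ∣∣-≤ {p} p≤q -p≤q with ℚ.∣p∣≡p∨∣p∣≡-p p
  ... | inj₁ eq = subst (_≤ _) (sym eq) p≤q
  ... | inj₂ eq = subst (_≤ _) (sym eq) -p≤q

  p≤∣p∣ : ∀ p → p ≤ ∣ p ∣
  p≤∣p∣ p with ℚ.≤-total 0ℚ p
  ... | inj₁ 0≤p = ℚ.≤-reflexive (sym (ℚ.0≤p⇒∣p∣≡p 0≤p))
  ... | inj₂ p≤0 = ℚ.≤-trans p≤0 (ℚ.0≤∣p∣ p)

  -p≤∣p∣ : ∀ p → - p ≤ ∣ p ∣
  -p≤∣p∣ p = subst (- p ≤_) (ℚ.∣-p∣≡∣p∣ p) (p≤∣p∣ (- p))

  ∣p-q∣≡∣q-p∣ : ∀ p q → ∣ p - q ∣ ≡ ∣ q - p ∣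
  ∣p-q∣≡∣q-p∣ p q = trans (cong ∣_∣ (flip p q)) (ℚ.∣-p∣≡∣p∣ (q - p))
    where
    flip : ∀ p q → p - q ≡ - (q - p)
    flip = solve-∀ ℚ-acr

  square-nonNeg : ∀ p → 0ℚ ≤ p * p
  square-nonNeg p with ℚ.≤-total 0ℚ p
  ... | inj₁ 0≤p = *-nonNeg 0≤p 0≤p
  ... | inj₂ p≤0 = subst (0ℚ ≤_) (neg-sq p) (*-nonNeg 0≤-p 0≤-p)
    where
    0≤-p : 0ℚ ≤ - p
    0≤-p = ℚ.neg-antimono-≤ p≤0
    neg-sq : ∀ p → - p * - p ≡ p * p
    neg-sq = solve-∀ ℚ-acr

  square≡0⇒≡0 : ∀ p → p * p ≡ 0ℚ → p ≡ 0ℚ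
  square≡0⇒≡0 p p²≡0 with p ℚ.≟ 0ℚ
  ... | yes p≡0 = p≡0
  ... | no  p≢0 = trans (sym (trans (cong (_* p) (ℚ.*-inverseˡ p {{≢-nonZero p≢0}})) (ℚ.*-identityˡ p)))
    (trans (ℚ.*-assoc ((1/ p) {{≢-nonZero p≢0}}) p p)
      (trans (cong ((1/ p) {{≢-nonZero p≢0}} *_) p²≡0) (ℚ.*-zeroʳ ((1/ p) {{≢-nonZero p≢0}}))))

  -- The reciprocal, with the junk value inv 0 = 0.
  inv : ℚ → ℚ
  inv p with p ℚ.≟ 0ℚ
  ... | yes _   = 0ℚ
  ... | no  p≢0 = (1/ p) {{≢-nonZero p≢0}}

  inv-inverseˡ : ∀ {p} → p ≢ 0ℚ → inv p * p ≡ 1ℚ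
  inv-inverseˡ {p} p≢0 with p ℚ.≟ 0ℚ
  ... | yes p≡0 = contradiction p≡0 p≢0
  ... | no  p≢0′ = ℚ.*-inverseˡ p {{≢-nonZero p≢0′}}

  inv-inverseʳ : ∀ {p} → p ≢ 0ℚ → p * inv p ≡ 1ℚ
  inv-inverseʳ {p} p≢0 = trans (ℚ.*-comm p (inv p)) (inv-inverseˡ p≢0)

  inv-zero : ∀ {p} → p ≡ 0ℚ → inv p ≡ 0ℚ
  inv-zero {p} p≡0 with p ℚ.≟ 0ℚ
  ... | yes _   = refl
  ... | no  p≢0 = contradiction p≡0 p≢0

  pos⇒≢0 : ∀ {p} → 0ℚ < p → p ≢ 0ℚ
  pos⇒≢0 0<p p≡0 = ℚ.<-irrefl (sym p≡0) 0<p

  nonNeg∧≢0⇒pos : ∀ {p} → 0ℚ ≤ p → p ≢ 0ℚ → 0ℚ < p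
  nonNeg∧≢0⇒pos 0≤p p≢0 = ℚ.≰⇒> λ p≤0 → p≢0 (ℚ.≤-antisym p≤0 0≤p)

  inv-pos : ∀ {p} → 0ℚ < p → 0ℚ < inv p
  inv-pos {p} 0<p with p ℚ.≟ 0ℚ
  ... | yes p≡0 = contradiction p≡0 (pos⇒≢0 0<p)
  ... | no  p≢0 = ℚ.positive⁻¹ _ {{ℚ.1/pos⇒pos p {{positive 0<p}}}}

  ι : ℕ → ℚ
  ι n = n ×ℚ 1ℚ

  ι-homo-+ : ∀ m n → ι (m ℕ.+ n) ≡ ι m + ι n
  ι-homo-+ m n = Mult.×-homo-+ 1ℚ m n

  ι-homo-* : ∀ m n → ι (m ℕ.* n) ≡ ι m * ι n
  ι-homo-* = ×1-homo-*
    where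
    open import Algebra.Bundles using (CommutativeRing)
    open Algebra.Properties.Semiring.Mult (CommutativeRing.semiring ℚ.+-*-commutativeRing)

  ι-nonNeg : ∀ n → 0ℚ ≤ ι n
  ι-nonNeg zero    = ℚ.≤-refl
  ι-nonNeg (suc n) = +-nonNeg 0≤1 (ι-nonNeg n)

  ι-suc-pos : ∀ n → 0ℚ < ι (suc n)
  ι-suc-pos n = ℚ.+-mono-<-≤ 0<1 (ι-nonNeg n)

  ι-mono : ∀ {m n} → m ℕ.≤ n → ι m ≤ ι n
  ι-mono {m} {n} m≤n = ≤-shift (ι (n ℕ.∸ m)) (ι-nonNeg (n ℕ.∸ m))
    (trans (cong ι (sym (ℕ.m+[n∸m]≡n m≤n))) (ι-homo-+ m (n ℕ.∸ m)))

  private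
    fromℚᵘ-homo-+ : ∀ p q → fromℚᵘ (p ℚᵘ.+ q) ≡ fromℚᵘ p + fromℚᵘ q
    fromℚᵘ-homo-+ p q = ℚ.toℚᵘ-injective (ℚᵘ.≃-trans (ℚ.toℚᵘ-fromℚᵘ (p ℚᵘ.+ q)) (ℚᵘ.≃-sym
      (ℚᵘ.≃-trans (ℚ.toℚᵘ-homo-+ (fromℚᵘ p) (fromℚᵘ q))
        (ℚᵘ.+-cong (ℚ.toℚᵘ-fromℚᵘ p) (ℚ.toℚᵘ-fromℚᵘ q)))))

    fromℚᵘ-homo-* : ∀ p q → fromℚᵘ (p ℚᵘ.* q) ≡ fromℚᵘ p * fromℚᵘ q
    fromℚᵘ-homo-* p q = ℚ.toℚᵘ-injective (ℚᵘ.≃-trans (ℚ.toℚᵘ-fromℚᵘ (p ℚᵘ.* q)) (ℚᵘ.≃-sym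
      (ℚᵘ.≃-trans (ℚ.toℚᵘ-homo-* (fromℚᵘ p) (fromℚᵘ q))
        (ℚᵘ.*-cong (ℚ.toℚᵘ-fromℚᵘ p) (ℚ.toℚᵘ-fromℚᵘ q)))))

  n/1≡ι : ∀ n → + n / 1 ≡ ι n
  n/1≡ι zero    = refl
  n/1≡ι (suc n) = begin
    fromℚᵘ (mkℚᵘ (+ suc n) 0)                ≡⟨ ℚ.fromℚᵘ-cong {mkℚᵘ (+ suc n) 0} {mkℚᵘ (+ 1) 0 ℚᵘ.+ mkℚᵘ (+ n) 0} (ℚᵘ.*≡* eq) ⟩
    fromℚᵘ (mkℚᵘ (+ 1) 0 ℚᵘ.+ mkℚᵘ (+ n) 0)  ≡⟨ fromℚᵘ-homo-+ (mkℚᵘ (+ 1) 0) (mkℚᵘ (+ n) 0) ⟩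
    1ℚ + + n / 1                             ≡⟨ cong (_+_ 1ℚ) (n/1≡ι n) ⟩
    1ℚ + ι n                                 ∎
    where
    open ≡-Reasoning
    eq : + suc n ℤ.* + 1 ≡ (+ 1 ℤ.* + 1 ℤ.+ + n ℤ.* + 1) ℤ.* + 1
    eq = cong (λ i → (+ 1 ℤ.+ i) ℤ.* + 1) (sym (ℤ.*-identityʳ (+ n)))

  1/n*n≡1 : ∀ n .{{_ : ℕ.NonZero n}} → (+ 1 / n) * ι n ≡ 1ℚ
  1/n*n≡1 (suc d) = begin
    (+ 1 / suc d) * ι (suc d)              ≡⟨ cong ((+ 1 / suc d) *_) (sym (n/1≡ι (suc d))) ⟩
    (+ 1 / suc d) * (+ suc d / 1)          ≡⟨ sym (fromℚᵘ-homo-* (mkℚᵘ (+ 1) d) (mkℚᵘ (+ suc d) 0)) ⟩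
    fromℚᵘ (mkℚᵘ (+ 1) d ℚᵘ.* mkℚᵘ (+ suc d) 0)  ≡⟨ ℚ.fromℚᵘ-cong {mkℚᵘ (+ 1) d ℚᵘ.* mkℚᵘ (+ suc d) 0} {mkℚᵘ (+ 1) 0} (ℚᵘ.*≡* eq) ⟩
    1ℚ ∎
    where
    open ≡-Reasoning
    eq : (+ 1 ℤ.* + suc d) ℤ.* + 1 ≡ + 1 ℤ.* + (suc d ℕ.* 1)
    eq = trans (ℤ.*-identityʳ (+ 1 ℤ.* + suc d)) (cong (λ m → + 1 ℤ.* + m) (sym (ℕ.*-identityʳ (suc d))))

  archimedean : ∀ p → ∃[ n ] p < ι n
  archimedean p@(mkℚ i d _) = suc ℤ.∣ i ∣ , subst (p <_) (n/1≡ι (suc ℤ.∣ i ∣)) (ℚ.toℚᵘ-cancel-<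
    (ℚᵘ.<-respʳ-≃ (ℚᵘ.≃-sym (ℚ.toℚᵘ-fromℚᵘ (mkℚᵘ (+ suc ℤ.∣ i ∣) 0))) (ℚᵘ.*<* bound)))
    where
    open ℤ.≤-Reasoning
    i≤∣i∣ : ∀ i → i ℤ.≤ + ℤ.∣ i ∣
    i≤∣i∣ (+ n)    = ℤ.≤-refl
    i≤∣i∣ -[1+ n ] = ℤ.-≤+
    bound : i ℤ.* + 1 ℤ.< + suc ℤ.∣ i ∣ ℤ.* + suc d
    bound = begin-strict
      i ℤ.* + 1                   ≡⟨ ℤ.*-identityʳ i ⟩
      i                           ≤⟨ i≤∣i∣ i ⟩
      + ℤ.∣ i ∣                   <⟨ ℤ.+<+ (ℕ.n<1+n ℤ.∣ i ∣) ⟩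
      + suc ℤ.∣ i ∣               ≤⟨ ℤ.+≤+ (ℕ.m≤m*n (suc ℤ.∣ i ∣) (suc d)) ⟩
      + (suc ℤ.∣ i ∣ ℕ.* suc d)   ≡⟨ ℤ.pos-* (suc ℤ.∣ i ∣) (suc d) ⟩
      + suc ℤ.∣ i ∣ ℤ.* + suc d   ∎

  Eventually : (ℕ → Set) → Set
  Eventually P = ∃[ N ] (∀ n → N ℕ.≤ n → P n)

  Eventually-× : ∀ {P Q : ℕ → Set} → Eventually P → Eventually Q → Eventually (λ n → P n × Q n)
  Eventually-× (M , p) (N , q) = M ℕ.⊔ N , λ n le →
    p n (ℕ.m⊔n≤o⇒m≤o M N le) , q n (ℕ.m⊔n≤o⇒n≤o M N le)

  Eventually-map : ∀ {P Q : ℕ → Set} → (∀ n → P n → Q n) → Eventually P → Eventually Q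
  Eventually-map f (N , p) = N , λ n le → f n (p n le)

  Null : (ℕ → ℚ) → Set
  Null s = ∀ ε → 0ℚ < ε → Eventually (λ n → ∣ s n ∣ < ε)

  -- Uniform in x, so that one lemma serves every sequence that is O(1/n): the widths of a bisection
  -- and the terms of the exponential series.
  harmonic-null : ∀ B ε → 0ℚ < ε → Eventually (λ n → ∀ x → ι n * x ≤ B → x < ε)
  harmonic-null B ε 0<ε = let N , B<N*ε = arch in N , λ n N≤n x nx≤B →
    ℚ.≰⇒> λ ε≤x → ℚ.<-irrefl refl (ℚ.<-≤-trans B<N*ε (ℚ.≤-trans
      (ℚ.*-monoʳ-≤-nonNeg ε {{nonNegative (ℚ.<⇒≤ 0<ε)}} (ι-mono N≤n))
      (ℚ.≤-trans (*-monoˡ (ι n) (ι-nonNeg n) ε≤x) nx≤B)))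
    where
    arch : ∃[ N ] B < ι N * ε
    arch with archimedean (B * inv ε)
    ... | N , lt = N , subst (_< ι N * ε) cancel (ℚ.*-monoˡ-<-pos ε {{positive 0<ε}} lt)
      where
      cancel : B * inv ε * ε ≡ B
      cancel = trans (ℚ.*-assoc B (inv ε) ε)
        (trans (cong (B *_) (inv-inverseˡ (pos⇒≢0 0<ε))) (ℚ.*-identityʳ B))

-- The commutative ring of Cauchy reals, positivity and reciprocals.

module Reals where

  open import Data.Rational.Base
  open ≡
  open Defs using (_≈_)
  open Rationals

  Bounded : (ℕ → ℚ) → Set
  Bounded s = ∃[ B ] 0ℚ < B × Eventually (λ n → ∣ s n ∣ ≤ B)

  null-cong : ∀ {s t} → (∀ n → s n ≡ t n) → Null s → Null t
  null-cong s≡t h ε 0<ε = Eventually-map (λ n → subst (λ q → ∣ q ∣ < ε) (s≡t n)) (h ε 0<ε)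

  null-dominated : ∀ {s t} → Eventually (λ n → ∣ s n ∣ ≤ ∣ t n ∣) → Null t → Null s
  null-dominated dom h ε 0<ε =
    Eventually-map (λ n (le , lt) → ℚ.≤-<-trans le lt) (Eventually-× dom (h ε 0<ε))

  null-+ : ∀ {s t} → Null s → Null t → Null (λ n → s n + t n)
  null-+ {s} {t} hs ht ε 0<ε = Eventually-map
    (λ n (p , q) → ℚ.≤-<-trans (ℚ.∣p+q∣≤∣p∣+∣q∣ (s n) (t n))
      (subst (∣ s n ∣ + ∣ t n ∣ <_) (½+½ ε) (ℚ.+-mono-< p q)))
    (Eventually-× (hs (½ * ε) (½*-pos 0<ε)) (ht (½ * ε) (½*-pos 0<ε)))

  null-neg : ∀ {s} → Null s → Null (λ n → - s n)
  null-neg {s} h ε 0<ε = Eventually-map (λ n → subst (_< ε) (sym (ℚ.∣-p∣≡∣p∣ (s n)))) (h ε 0<ε)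

  null-0 : Null (λ _ → 0ℚ)
  null-0 ε 0<ε = 0 , λ _ _ → 0<ε

  bounded-*-null : ∀ {b s} → Bounded b → Null s → Null (λ n → b n * s n)
  bounded-*-null {b} {s} (B , 0<B , bound) h ε 0<ε = Eventually-map
    (λ n (b≤B , s<δ) → subst (_< ε) (sym (ℚ.∣p*q∣≡∣p∣*∣q∣ (b n) (s n)))
      (ℚ.≤-<-trans (ℚ.*-monoʳ-≤-nonNeg ∣ s n ∣ {{ℚ.∣-∣-nonNeg (s n)}} b≤B)
        (subst (B * ∣ s n ∣ <_) B*δ≡ε (ℚ.*-monoʳ-<-pos B {{positive 0<B}} s<δ))))
    (Eventually-× bound (h δ (*-pos (inv-pos 0<B) 0<ε)))
    where
    δ = inv B * ε
    B*δ≡ε : B * δ ≡ ε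
    B*δ≡ε = trans (sym (ℚ.*-assoc B (inv B) ε))
      (trans (cong (_* ε) (inv-inverseʳ (pos⇒≢0 0<B))) (ℚ.*-identityˡ ε))

  const-bounded : ∀ q → Bounded (λ _ → q)
  const-bounded q = ∣ q ∣ + 1ℚ , ℚ.+-mono-≤-< (ℚ.0≤∣p∣ q) 0<1 , 0 , λ _ _ → ≤-shift 1ℚ 0≤1 refl

  null-* : ∀ q {s} → Null s → Null (λ n → q * s n)
  null-* q = bounded-*-null (const-bounded q)

  seq-bounded : ∀ x → Bounded (seq x)
  seq-bounded x with isCauchy x 1ℚ 0<1
  ... | N , tail = ∣ seq x N ∣ + 1ℚ , ℚ.+-mono-≤-< (ℚ.0≤∣p∣ (seq x N)) 0<1 , N , λ n N≤n →
    subst (λ t → ∣ t ∣ ≤ ∣ seq x N ∣ + 1ℚ) (mid (seq x N) (seq x n))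
      (ℚ.≤-trans (ℚ.∣p+q∣≤∣p∣+∣q∣ (seq x N) (seq x n - seq x N))
        (ℚ.+-monoʳ-≤ ∣ seq x N ∣ (ℚ.<⇒≤ (tail n N N≤n ℕ.≤-refl))))
    where
    mid : ∀ p q → p + (q - p) ≡ q
    mid = solve-∀ ℚ-acr

  null-square : ∀ {s} → Null (λ n → s n * s n) → Null s
  null-square {s} h ε 0<ε = Eventually-map
    (λ n lt → ℚ.≰⇒> λ ε≤∣s∣ → ℚ.<-irrefl refl (ℚ.<-≤-trans lt
      (subst (ε * ε ≤_) (sym (ℚ.∣p*q∣≡∣p∣*∣q∣ (s n) (s n)))
        (*-mono-≤ (ℚ.<⇒≤ 0<ε) ε≤∣s∣ (ℚ.<⇒≤ 0<ε) ε≤∣s∣))))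
    (h (ε * ε) (*-pos 0<ε 0<ε))

  ≡⇒≈ : ∀ {x y} → (∀ n → seq x n ≡ seq y n) → x ≈ y
  ≡⇒≈ {x} {y} eq = mk≈ (null-cong
    (λ n → trans (sym (ℚ.+-inverseʳ (seq y n))) (cong (_- seq y n) (sym (eq n)))) null-0)

  null⇒≈0 : ∀ {x} → Null (seq x) → x ≈ 0ℝ
  null⇒≈0 {x} h = mk≈ (null-cong (λ n → sym (ℚ.+-identityʳ (seq x n))) h)

  ≈0⇒null : ∀ {x} → x ≈ 0ℝ → Null (seq x)
  ≈0⇒null {x} h = null-cong (λ n → ℚ.+-identityʳ (seq x n)) (close h)

  ℝ-isCommutativeRing : IsCommutativeRing _≈_ ℝ._+_ ℝ._*_ ℝ.-_ 0ℝ 1ℝ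
  ℝ-isCommutativeRing = record
    { isRing = record
      { +-isAbelianGroup = record
        { isGroup = record
          { isMonoid = record
            { isSemigroup = record
              { isMagma = record
                { isEquivalence = record
                  { refl = λ {x} → ≡⇒≈ {x} {x} (λ _ → refl)
                  ; sym = λ {x} {y} (mk≈ h) → mk≈ λ ε 0<ε →
                      Eventually-map (λ n → subst (_< ε) (∣p-q∣≡∣q-p∣ (seq x n) (seq y n))) (h ε 0<ε)
                  ; trans = λ {x} {y} {z} (mk≈ h) (mk≈ k) →
                      mk≈ (null-cong (λ n → telescope (seq x n) (seq y n) (seq z n)) (null-+ h k))
                  }
                ; ∙-cong = λ {x} {x′} {y} {y′} (mk≈ h) (mk≈ k) →
                    mk≈ (null-cong (λ n → sums (seq x n) (seq x′ n) (seq y n) (seq y′ n)) (null-+ h k))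
                }
              ; assoc = λ x y z → ≡⇒≈ λ n → ℚ.+-assoc (seq x n) (seq y n) (seq z n)
              }
            ; identity = (λ x → ≡⇒≈ λ n → ℚ.+-identityˡ (seq x n))
                       , (λ x → ≡⇒≈ λ n → ℚ.+-identityʳ (seq x n))
            }
          ; inverse = (λ x → ≡⇒≈ λ n → ℚ.+-inverseˡ (seq x n))
                    , (λ x → ≡⇒≈ λ n → ℚ.+-inverseʳ (seq x n))
          ; ⁻¹-cong = λ {x} {y} (mk≈ h) → mk≈ (null-cong
              (λ n → negs (seq x n) (seq y n)) (null-neg h))
          }
        ; comm = λ x y → ≡⇒≈ λ n → ℚ.+-comm (seq x n) (seq y n)
        }
      ; *-cong = λ {x} {x′} {y} {y′} (mk≈ h) (mk≈ k) → mk≈ (null-cong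
          (λ n → products (seq x n) (seq x′ n) (seq y n) (seq y′ n))
          (null-+ (bounded-*-null (seq-bounded x) k) (bounded-*-null (seq-bounded y′) h)))
      ; *-assoc = λ x y z → ≡⇒≈ λ n → ℚ.*-assoc (seq x n) (seq y n) (seq z n)
      ; *-identity = (λ x → ≡⇒≈ λ n → ℚ.*-identityˡ (seq x n))
                   , (λ x → ≡⇒≈ λ n → ℚ.*-identityʳ (seq x n))
      ; distrib = (λ x y z → ≡⇒≈ λ n → ℚ.*-distribˡ-+ (seq x n) (seq y n) (seq z n))
                , (λ x y z → ≡⇒≈ λ n → ℚ.*-distribʳ-+ (seq x n) (seq y n) (seq z n))
      }
    ; *-comm = λ x y → ≡⇒≈ λ n → ℚ.*-comm (seq x n) (seq y n)
    }
    where
    telescope : ∀ x y z → (x - y) + (y - z) ≡ x - z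
    telescope = solve-∀ ℚ-acr
    sums : ∀ x x′ y y′ → (x - x′) + (y - y′) ≡ (x + y) - (x′ + y′)
    sums = solve-∀ ℚ-acr
    negs : ∀ x y → - (x - y) ≡ - x - (- y)
    negs = solve-∀ ℚ-acr
    products : ∀ x x′ y y′ → x * (y - y′) + y′ * (x - x′) ≡ x * y - x′ * y′
    products = solve-∀ ℚ-acr

  positive-eventually : ∀ {x} → 0ℝ ℝ.< x → ∃[ δ ] 0ℚ < δ × Eventually (λ n → δ ≤ seq x n)
  positive-eventually {x} (mk< δ 0<δ sep) =
    δ , 0<δ , Eventually-map (λ n → subst (_≤ seq x n) (ℚ.+-identityˡ δ)) sep

  eventually-positive : ∀ {x} δ → 0ℚ < δ → Eventually (λ n → δ ≤ seq x n) → 0ℝ ℝ.< x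
  eventually-positive {x} δ 0<δ ev =
    mk< δ 0<δ (Eventually-map (λ n → subst (_≤ seq x n) (sym (ℚ.+-identityˡ δ))) ev)

  <0-respʳ : ∀ {x y} → x ≈ y → 0ℝ ℝ.< x → 0ℝ ℝ.< y
  <0-respʳ {x} {y} (mk≈ h) 0<x with positive-eventually {x} 0<x
  ... | δ , 0<δ , ev = eventually-positive {y} (½ * δ) (½*-pos 0<δ)
    (Eventually-map step (Eventually-× ev (h (½ * δ) (½*-pos 0<δ))))
    where
    split : ∀ x y δ → y ≡ ½ * δ + ((½ * δ - (x - y)) + (x - δ))
    split = solve-∀ ℚ-acr
    step : ∀ n → δ ≤ seq x n × ∣ seq x n - seq y n ∣ < ½ * δ → ½ * δ ≤ seq y n
    step n (δ≤x , lt) = ≤-shift ((½ * δ - (seq x n - seq y n)) + (seq x n - δ))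
      (+-nonNeg (p≤q⇒0≤q-p (ℚ.≤-trans (p≤∣p∣ (seq x n - seq y n)) (ℚ.<⇒≤ lt))) (p≤q⇒0≤q-p δ≤x))
      (split (seq x n) (seq y n) δ)

  -- After a stage N from which the terms vary by less than ε/4, the rational comparison of the N-th
  -- term with ε/2 decides: below it, all later terms are less than ε; above it, they stay at least
  -- ε/4, and x would be positive.
  nonNeg∧≯0⇒≈0 : ∀ {x} → (∀ n → 0ℚ ≤ seq x n) → ¬ (0ℝ ℝ.< x) → x ≈ 0ℝ
  nonNeg∧≯0⇒≈0 {x} 0≤x x≯0 = null⇒≈0 {x} λ ε 0<ε → go ε 0<ε (isCauchy x (½ * (½ * ε)) (½*-pos (½*-pos 0<ε)))
    where
    module _ (ε : ℚ) (0<ε : 0ℚ < ε) where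
      η = ½ * (½ * ε)
      low : ∀ s t e → s ≡ ½ * (½ * e) + ((½ * (½ * e) - (t - s)) + (t - ½ * e))
      low = solve-∀ ℚ-acr
      high : ∀ s t e → e ≡ s + ((½ * (½ * e) - (s - t)) + (½ * e - t) + ½ * (½ * e))
      high = solve-∀ ℚ-acr
      go : ∃[ N ] (∀ m n → N ℕ.≤ m → N ℕ.≤ n → ∣ seq x m - seq x n ∣ < η) →
           Eventually (λ n → ∣ seq x n ∣ < ε)
      go (N , tail) with ℚ.≤-total (seq x N) (½ * ε)
      ... | inj₁ le = N , λ n N≤n → subst (_< ε) (sym (ℚ.0≤p⇒∣p∣≡p (0≤x n)))
        (<-shift _ (ℚ.+-mono-≤-< (+-nonNeg
            (p≤q⇒0≤q-p (ℚ.≤-trans (p≤∣p∣ _) (ℚ.<⇒≤ (tail n N N≤n ℕ.≤-refl))))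
            (p≤q⇒0≤q-p le)) (½*-pos (½*-pos 0<ε)))
          (high (seq x n) (seq x N) ε))
      ... | inj₂ ge = contradiction (eventually-positive {x} η (½*-pos (½*-pos 0<ε)) (N , λ n N≤n →
        ≤-shift _ (+-nonNeg
            (p≤q⇒0≤q-p (ℚ.≤-trans (p≤∣p∣ _) (ℚ.<⇒≤ (tail N n ℕ.≤-refl N≤n))))
            (p≤q⇒0≤q-p ge))
          (low (seq x n) (seq x N) ε))) x≯0

  -- Eventually δ ≤ xₙ, and then |1/xₘ - 1/xₙ| ≤ δ⁻² |xₙ - xₘ|. Before that stage `inv` may return
  -- its junk value, which does not affect the limit.
  reciprocal : ∀ {x} → 0ℝ ℝ.< x → ∃[ c ] (c ℝ.* x ≈ 1ℝ)
  reciprocal {x} 0<x with positive-eventually {x} 0<x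
  ... | δ , 0<δ , N , δ≤x = mkℝ (λ n → inv (seq x n)) cauchy , mk≈ (λ ε 0<ε → N , λ n N≤n →
      subst (λ t → ∣ t ∣ < ε) (sym (trans (cong (_- 1ℚ) (inv-inverseˡ (pos⇒≢0 (x>0 n N≤n)))) (ℚ.+-inverseʳ 1ℚ))) 0<ε)
    where
    D = inv δ * inv δ
    0<D : 0ℚ < D
    0<D = *-pos (inv-pos 0<δ) (inv-pos 0<δ)
    x>0 : ∀ n → N ℕ.≤ n → 0ℚ < seq x n
    x>0 n N≤n = ℚ.<-≤-trans 0<δ (δ≤x n N≤n)
    inv≤ : ∀ n → N ℕ.≤ n → inv (seq x n) ≤ inv δ
    inv≤ n N≤n = ≤-shift _
      (*-nonNeg (*-nonNeg (ℚ.<⇒≤ (inv-pos (x>0 n N≤n))) (ℚ.<⇒≤ (inv-pos 0<δ))) (p≤q⇒0≤q-p (δ≤x n N≤n)))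
      (sym (identity (inv (seq x n)) (seq x n) (inv δ) δ (inv-inverseˡ (pos⇒≢0 (x>0 n N≤n))) (inv-inverseˡ (pos⇒≢0 0<δ))))
      where
      rearrange : ∀ i x j d → i + (i * j) * (x - d) ≡ i + j * (i * x) - i * (j * d)
      rearrange = solve-∀ ℚ-acr
      units : ∀ i j → i + j * 1ℚ - i * 1ℚ ≡ j
      units = solve-∀ ℚ-acr
      identity : ∀ i x j d → i * x ≡ 1ℚ → j * d ≡ 1ℚ → i + (i * j) * (x - d) ≡ j
      identity i x j d p q = trans (rearrange i x j d) (trans (cong₂ (λ a b → i + j * a - i * b) p q) (units i j))
    difference : ∀ i x j y → i * x ≡ 1ℚ → j * y ≡ 1ℚ → i - j ≡ (i * j) * (y - x)
    difference i x j y p q = trans (sym (units i j)) (trans (cong₂ (λ a b → i * b - j * a) (sym p) (sym q)) (rearrange i x j y))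
      where
      rearrange : ∀ i x j y → i * (j * y) - j * (i * x) ≡ (i * j) * (y - x)
      rearrange = solve-∀ ℚ-acr
      units : ∀ i j → i * 1ℚ - j * 1ℚ ≡ i - j
      units = solve-∀ ℚ-acr
    cauchy : ℝ.IsCauchy (λ n → inv (seq x n))
    cauchy ε 0<ε with isCauchy x (inv D * ε) (*-pos (inv-pos 0<D) 0<ε)
    ... | M , tail = N ℕ.⊔ M , λ m n hm hn →
      let N≤m = ℕ.m⊔n≤o⇒m≤o N M hm
          N≤n = ℕ.m⊔n≤o⇒m≤o N M hn
          i = inv (seq x m)
          j = inv (seq x n)
          d = seq x n - seq x m
          0≤i = ℚ.<⇒≤ (inv-pos (x>0 m N≤m))
          0≤j = ℚ.<⇒≤ (inv-pos (x>0 n N≤n))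
      in begin-strict
      ∣ i - j ∣           ≡⟨ cong ∣_∣ (difference i (seq x m) j (seq x n) (inv-inverseˡ (pos⇒≢0 (x>0 m N≤m))) (inv-inverseˡ (pos⇒≢0 (x>0 n N≤n)))) ⟩
      ∣ i * j * d ∣       ≡⟨ ℚ.∣p*q∣≡∣p∣*∣q∣ (i * j) d ⟩
      ∣ i * j ∣ * ∣ d ∣   ≡⟨ cong (_* ∣ d ∣) (ℚ.0≤p⇒∣p∣≡p (*-nonNeg 0≤i 0≤j)) ⟩
      i * j * ∣ d ∣       ≤⟨ ℚ.*-monoʳ-≤-nonNeg ∣ d ∣ {{ℚ.∣-∣-nonNeg d}} (*-mono-≤ 0≤i (inv≤ m N≤m) 0≤j (inv≤ n N≤n)) ⟩
      D * ∣ d ∣           <⟨ ℚ.*-monoʳ-<-pos D {{positive 0<D}} (tail n m (ℕ.m⊔n≤o⇒n≤o N M hn) (ℕ.m⊔n≤o⇒n≤o N M hm)) ⟩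
      D * (inv D * ε)     ≡⟨ sym (ℚ.*-assoc D (inv D) ε) ⟩
      D * inv D * ε       ≡⟨ cong (_* ε) (inv-inverseʳ (pos⇒≢0 0<D)) ⟩
      1ℚ * ε              ≡⟨ ℚ.*-identityˡ ε ⟩
      ε ∎
      where open ℚ.≤-Reasoning

-- Rational vectors: finite sums, Bessel's inequality, length of orthogonal systems.

module RationalVectors where

  open import Data.Rational.Base
  open ≡
  open Rationals

  module LAℚ = LinearAlgebraProperties +-*-rawRing ℚ.+-*-isCommutativeRing
  open LAℚ

  sumTo : (ℕ → ℚ) → ℕ → ℚ
  sumTo f zero    = 0ℚ
  sumTo f (suc n) = sumTo f n + f n

  sumTo-cong : ∀ {f g} n → (∀ i → i ℕ.< n → f i ≡ g i) → sumTo f n ≡ sumTo g n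
  sumTo-cong zero    f≡g = refl
  sumTo-cong (suc n) f≡g =
    cong₂ _+_ (sumTo-cong n (λ i i<n → f≡g i (ℕ.m<n⇒m<1+n i<n))) (f≡g n ℕ.≤-refl)

  sumTo-sum : ∀ {k} (f : ℕ → Vector ℚ k) n → sum (λ l → sumTo (λ i → f i l) n) ≡ sumTo (λ i → sum (f i)) n
  sumTo-sum {k} f zero    = sum-replicate-zero k
  sumTo-sum     f (suc n) = trans (∑-distrib-+ (λ l → sumTo (λ i → f i l) n) (f n))
    (cong (_+ sum (f n)) (sumTo-sum f n))

  sum-mono : ∀ {k} (f g : Vector ℚ k) → (∀ i → f i ≤ g i) → sum f ≤ sum g
  sum-mono {zero}  f g f≤g = ℚ.≤-refl
  sum-mono {suc k} f g f≤g = ℚ.+-mono-≤ (f≤g zero) (sum-mono (f ∘ suc) (g ∘ suc) (f≤g ∘ suc))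

  sum-const : ∀ k q → sum {k} (λ _ → q) ≡ ι k * q
  sum-const zero    q = sym (ℚ.*-zeroˡ q)
  sum-const (suc k) q = trans (cong (q +_) (sum-const k q)) (expand q (ι k))
    where
    expand : ∀ q m → q + m * q ≡ (1ℚ + m) * q
    expand = solve-∀ ℚ-acr

  sum-nonNeg : ∀ {k} (f : Vector ℚ k) → (∀ i → 0ℚ ≤ f i) → 0ℚ ≤ sum f
  sum-nonNeg {zero}  f 0≤f = ℚ.≤-refl
  sum-nonNeg {suc k} f 0≤f = +-nonNeg (0≤f zero) (sum-nonNeg (f ∘ suc) (0≤f ∘ suc))

  summand≤sum : ∀ {k} (f : Vector ℚ k) → (∀ i → 0ℚ ≤ f i) → ∀ i → f i ≤ sum f
  summand≤sum f 0≤f zero    = ≤-shift _ (sum-nonNeg (f ∘ suc) (0≤f ∘ suc)) refl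
  summand≤sum f 0≤f (suc i) = ℚ.≤-trans (summand≤sum (f ∘ suc) (0≤f ∘ suc) i)
    (≤-shift (f zero) (0≤f zero) (ℚ.+-comm (f zero) (sum (f ∘ suc))))

  dot-self-nonNegℚ : ∀ {k} (x : Vector ℚ k) → 0ℚ ≤ dot x x
  dot-self-nonNegℚ x = sum-nonNeg (λ i → x i * x i) (λ i → square-nonNeg (x i))

  dot-self≡0⇒≋0 : ∀ {k} (x : Vector ℚ k) → dot x x ≡ 0ℚ → x ≋ 𝟎
  dot-self≡0⇒≋0 x eq i = square≡0⇒≡0 (x i) (ℚ.≤-antisym
    (subst (x i * x i ≤_) eq (summand≤sum (λ i → x i * x i) (λ i → square-nonNeg (x i)) i))
    (square-nonNeg (x i)))

  ι-cancel-≤ : ∀ {m n} → ι m ≤ ι n → m ℕ.≤ n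
  ι-cancel-≤ {m} {n} ιm≤ιn = ℕ.≮⇒≥ λ n<m → ℚ.<-irrefl refl (ℚ.<-≤-trans
    (<-shift 1ℚ 0<1 (ℚ.+-comm 1ℚ (ι n))) (ℚ.≤-trans (ι-mono n<m) ιm≤ιn))

  𝐞-self : ∀ {k} (i : Fin k) → 𝐞 i i ≡ 1ℚ
  𝐞-self zero    = refl
  𝐞-self (suc i) = 𝐞-self i

  module _ {k} (u : ℕ → Vector ℚ k) (r : ℕ)
    (orthogonal : ∀ i j → i ℕ.< j → j ℕ.< r → dot (u i) (u j) ≡ 0ℚ)
    (nonZero : ∀ i → i ℕ.< r → dot (u i) (u i) ≢ 0ℚ) where

    private
      h : ℕ → ℚ
      h i = dot (u i) (u i)

      module _ (x : Vector ℚ k) where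
        residual : ℕ → Vector ℚ k
        residual zero    = x
        residual (suc j) = residual j -ᵥ (dot (u j) (residual j) * inv (h j)) · u j

        -- The vectors already subtracted are orthogonal to `u i`, so the coefficient taken from the
        -- residual is the one of `x` itself.
        dot-residual : ∀ j i → j ℕ.≤ i → i ℕ.< r → dot (u i) (residual j) ≡ dot (u i) x
        dot-residual zero    i _   _   = refl
        dot-residual (suc j) i j<i i<r = begin
          dot (u i) (residual j -ᵥ c · u j)                ≡⟨ dot--ʳ (u i) (residual j) (c · u j) ⟩
          dot (u i) (residual j) - dot (u i) (c · u j)     ≡⟨ cong₂ _-_ (dot-residual j i (ℕ.<⇒≤ j<i) i<r)
                                                               (trans (dot-·ʳ (u i) c (u j))
                                                                 (cong (c *_) (trans (dot-comm (u i) (u j)) (orthogonal j i j<i i<r)))) ⟩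
          dot (u i) x - c * 0ℚ                             ≡⟨ drop (dot (u i) x) c ⟩
          dot (u i) x                                      ∎
          where
          open ≡-Reasoning
          c = dot (u j) (residual j) * inv (h j)
          drop : ∀ p c → p - c * 0ℚ ≡ p
          drop = solve-∀ ℚ-acr

        energy : ℕ → ℚ
        energy i = dot (u i) x * dot (u i) x * inv (h i)

        -- Pythagoras, one subtraction at a time: `residual j` is `residual (suc j)` plus an
        -- orthogonal multiple of `u j`, whose squared length is `energy j`.
        residual-norm : ∀ j → j ℕ.≤ r → dot x x ≡ dot (residual j) (residual j) + sumTo energy j
        residual-norm zero    _   = sym (ℚ.+-identityʳ (dot x x))
        residual-norm (suc j) j<r = trans (residual-norm j (ℕ.<⇒≤ j<r)) (trans (cong (_+ sumTo energy j) expand) (shuffle (dot (residual (suc j)) (residual (suc j))) (sumTo energy j) (energy j)))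
          where
          open ≡-Reasoning
          ρ = residual j
          s = dot (u j) ρ
          c = s * inv (h j)
          ρ·u : dot ρ (u j) ≡ s
          ρ·u = dot-comm ρ (u j)
          shuffle : ∀ a b d → (a + d) + b ≡ a + (b + d)
          shuffle = solve-∀ ℚ-acr
          collect : ∀ d s i h → (d - s * i * s) - s * i * (s - s * i * h) + s * s * i ≡ d + s * i * s * (i * h - 1ℚ)
          collect = solve-∀ ℚ-acr
          unit : ∀ d e → d + e * (1ℚ - 1ℚ) ≡ d
          unit = solve-∀ ℚ-acr
          new-norm : dot (ρ -ᵥ c · u j) (ρ -ᵥ c · u j) ≡ (dot ρ ρ - c * s) - c * (s - c * h j)
          new-norm = begin
            dot (ρ -ᵥ c · u j) (ρ -ᵥ c · u j)
              ≡⟨ dot--ˡ ρ (c · u j) (ρ -ᵥ c · u j) ⟩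
            dot ρ (ρ -ᵥ c · u j) - dot (c · u j) (ρ -ᵥ c · u j)
              ≡⟨ cong₂ _-_ (trans (dot--ʳ ρ ρ (c · u j)) (cong (λ t → dot ρ ρ - t) (trans (dot-·ʳ ρ c (u j)) (cong (c *_) ρ·u))))
                   (trans (dot-·ˡ c (u j) (ρ -ᵥ c · u j)) (cong (c *_)
                     (trans (dot--ʳ (u j) ρ (c · u j)) (cong (λ t → s - t) (dot-·ʳ (u j) c (u j)))))) ⟩
            (dot ρ ρ - c * s) - c * (s - c * h j) ∎
          expand : dot ρ ρ ≡ dot (residual (suc j)) (residual (suc j)) + energy j
          expand = sym (begin
            dot (residual (suc j)) (residual (suc j)) + energy j
              ≡⟨ cong₂ _+_ new-norm (cong (λ t → t * t * inv (h j)) (sym (dot-residual j j ℕ.≤-refl j<r))) ⟩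
            (dot ρ ρ - c * s) - c * (s - c * h j) + s * s * inv (h j)
              ≡⟨ collect (dot ρ ρ) s (inv (h j)) (h j) ⟩
            dot ρ ρ + s * inv (h j) * s * (inv (h j) * h j - 1ℚ)
              ≡⟨ cong (λ t → dot ρ ρ + s * inv (h j) * s * (t - 1ℚ)) (inv-inverseˡ (nonZero j j<r)) ⟩
            dot ρ ρ + s * inv (h j) * s * (1ℚ - 1ℚ)
              ≡⟨ unit (dot ρ ρ) (s * inv (h j) * s) ⟩
            dot ρ ρ ∎)

        bessel : sumTo energy r ≤ dot x x
        bessel = ≤-shift _ (dot-self-nonNegℚ (residual r))
          (trans (residual-norm r ℕ.≤-refl) (ℚ.+-comm _ (sumTo energy r)))

    -- Bessel's inequality for the standard basis, summed over it.
    orthogonal-system-length : r ℕ.≤ k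
    orthogonal-system-length = ι-cancel-≤ (subst₂ _≤_ total-left total-right
      (sum-mono (λ l → sumTo (energy (𝐞 l)) r) (λ l → dot (𝐞 l) (𝐞 l)) (λ l → bessel (𝐞 l))))
      where
      open ≡-Reasoning
      entry : ∀ i l → dot (u i) (𝐞 l) ≡ u i l
      entry i l = trans (dot-comm (u i) (𝐞 l)) (dot-𝐞ˡ l (u i))
      ones : ∀ r → sumTo (λ _ → 1ℚ) r ≡ ι r
      ones zero    = refl
      ones (suc r) = trans (cong (_+ 1ℚ) (ones r)) (ℚ.+-comm (ι r) 1ℚ)
      total-left : sum (λ l → sumTo (energy (𝐞 l)) r) ≡ ι r
      total-left = begin
        sum (λ l → sumTo (energy (𝐞 l)) r)        ≡⟨ sumTo-sum (λ i l → energy (𝐞 l) i) r ⟩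
        sumTo (λ i → sum (λ l → energy (𝐞 l) i)) r ≡⟨ sumTo-cong r (λ i i<r →
            trans (sum-cong-≋ (λ l → cong (λ t → t * t * inv (h i)) (entry i l)))
              (trans (sym (*-distribʳ-sum (inv (h i)) (λ l → u i l * u i l)))
                (inv-inverseʳ (nonZero i i<r)))) ⟩
        sumTo (λ _ → 1ℚ) r                         ≡⟨ ones r ⟩
        ι r                                        ∎
      total-right : sum {k} (λ l → dot (𝐞 l) (𝐞 l)) ≡ ι k
      total-right = trans (sum-cong-≋ {k} (λ l → trans (dot-𝐞ˡ l (𝐞 l)) (𝐞-self l)))
        (trans (sum-const k 1ℚ) (ℚ.*-identityʳ (ι k)))

-- Eigenprojections of a rational matrix for a real eigenvalue.

module RealEigenprojections where

  open import Data.Rational.Base as ℚ using (0ℚ)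
  open Defs using (_≈_)
  open Rationals
  open Reals
  open RationalVectors

  open LinearAlgebraProperties ℝ-rawRing ℝ-isCommutativeRing
  module S = RawSemiringDefs (RawRing.rawSemiring ℝ-rawRing)

  sum-seq : ∀ {k} (f : Vector ℝ k) p → seq (S.sum f) p ≡ LAℚ.sum (λ i → seq (f i) p)
  sum-seq {zero}  f p = ≡.refl
  sum-seq {suc k} f p = ≡.cong (seq (f zero) p ℚ.+_) (sum-seq (f ∘ suc) p)

  dot-self-nonNeg : ∀ {k} (x : Vector ℝ k) p → 0ℚ ℚ.≤ seq (dot x x) p
  dot-self-nonNeg x p = ≡.subst (0ℚ ℚ.≤_) (≡.sym (sum-seq (λ i → x i ℝ.* x i) p))
    (sum-nonNeg (λ i → seq (x i) p ℚ.* seq (x i) p) (λ i → square-nonNeg (seq (x i) p)))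

  dot-self≈0⇒≋0 : ∀ {k} (x : Vector ℝ k) → dot x x ≈ 0ℝ → x ≋ 𝟎
  dot-self≈0⇒≋0 x h i = null⇒≈0 {x i} (null-square (null-dominated
    (0 , λ p _ → ≡.subst₂ ℚ._≤_
      (≡.sym (ℚ.0≤p⇒∣p∣≡p (square-nonNeg (seq (x i) p))))
      (≡.sym (ℚ.0≤p⇒∣p∣≡p (dot-self-nonNeg x p)))
      (≡.subst (seq (x i) p ℚ.* seq (x i) p ℚ.≤_) (≡.sym (sum-seq (λ i → x i ℝ.* x i) p))
        (summand≤sum (λ i → seq (x i) p ℚ.* seq (x i) p) (λ i → square-nonNeg (seq (x i) p)) i)))
    (≈0⇒null {dot x x} h)))

  -- The undecidable question is whether ⟨u , u⟩ is positive. If it is, it has a reciprocal; if not,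
  -- being nonnegative at every stage, it is zero, and so is u.
  dichotomy : ∀ {k} (u : Vector ℝ k) → ¬ ¬ ZeroOrNormalisable u
  dichotomy u neither = neither (inj₁ (dot-self≈0⇒≋0 u
    (nonNeg∧≯0⇒≈0 {dot u u} (dot-self-nonNeg u) (λ 0<uu → neither (inj₂ (reciprocal {dot u u} 0<uu))))))

  sum≈⇒null : ∀ {k} {f : Vector ℝ k} {y} → S.sum f ≈ y → Null (λ n → LAℚ.sum (λ j → seq (f j) n) ℚ.- seq y n)
  sum≈⇒null {k} {f} {y} h = null-cong {λ n → seq (S.sum f) n ℚ.- seq y n} {λ n → LAℚ.sum (λ j → seq (f j) n) ℚ.- seq y n}
    (λ n → ≡.cong (ℚ._- seq y n) (sum-seq f n)) (close h)

  null⇒sum≈ : ∀ {k} {f : Vector ℝ k} {y} → Null (λ n → LAℚ.sum (λ j → seq (f j) n) ℚ.- seq y n) → S.sum f ≈ y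
  null⇒sum≈ {k} {f} {y} h = mk≈ (null-cong {λ n → LAℚ.sum (λ j → seq (f j) n) ℚ.- seq y n} {λ n → seq (S.sum f) n ℚ.- seq y n}
    (λ n → ≡.cong (ℚ._- seq y n) (≡.sym (sum-seq f n))) h)

  -- The equation L y = λ y between real vectors, rewritten for the approximants: at stage n both
  -- sides are rational, and their difference tends to zero.
  ApproximateEigenvector : ∀ {k} → LAℚ.Matrix k → ℝ → Vector ℝ k → Set
  ApproximateEigenvector L λ′ y = ∀ i → Null (λ n → (L LAℚ.*ᵥ (λ j → seq (y j) n)) i ℚ.- seq λ′ n ℚ.* seq (y i) n)

  ApproximateProjection : ∀ {k} → LAℚ.Matrix k → ℝ → Matrix k → Set
  ApproximateProjection L λ′ E =
    (∀ x → ApproximateEigenvector L λ′ (E Mℝ.*ᵥ x))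
    × (∀ x y → ApproximateEigenvector L λ′ y → Mℝ.dot (x Mℝ.-ᵥ E Mℝ.*ᵥ x) y ≈ 0ℝ)
    × (∀ i y → ApproximateEigenvector L λ′ y → (∀ j → Null (seq (E j i))) → Null (seq (y i)))

  real-eigenprojection : ∀ {k} (L : LAℚ.Matrix k) λ′ → ¬ ¬ (∃[ E ] ApproximateProjection L λ′ E)
  real-eigenprojection {k} L λ′ none =
    eigenprojection dichotomy {k} {Mℝ._*ᵥ_} {Mℝ.dot} {Mℝ._-ᵥ_} ≡.refl ≡.refl ≡.refl (λ i j → fromℚ (L i j)) λ′
      λ (E , eigen , orthogonal , kernel) → none (E ,
        (λ x i → sum≈⇒null {k} {λ j → fromℚ (L i j) ℝ.* (E Mℝ.*ᵥ x) j} {λ′ ℝ.* (E Mℝ.*ᵥ x) i} (eigen x i)) ,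
        (λ x y approx → orthogonal x y (λ i → exact y approx i)) ,
        (λ i y approx null → ≈0⇒null {y i} (kernel i y (λ i → exact y approx i) (λ j → null⇒≈0 {E j i} (null j)))))
    where
    exact : ∀ y → ApproximateEigenvector L λ′ y → ∀ i → S.sum (λ j → fromℚ (L i j) ℝ.* y j) ≈ λ′ ℝ.* y i
    exact y approx i = null⇒sum≈ {k} {λ j → fromℚ (L i j) ℝ.* y j} {λ′ ℝ.* y i} (approx i)

-- The Lanczos recurrence and the Christoffel-Darboux identity over ℚ.

module LanczosRecurrence where

  open import Data.Rational.Base
  open ≡
  open Rationals
  open RationalVectors
  open LAℚ

  -- The Lanczos recurrence started at w, shifted so that v 0 = 0 and v 1 = w; then
  -- h 0 = 0, and all coefficients with inv (h 0) vanish.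
  module Lanczos {k} (L : Matrix k) (L-symmetric : Symmetric L) (w : Vector ℚ k) where

    rayleigh : Vector ℚ k → ℚ
    rayleigh x = dot (L *ᵥ x) x * inv (dot x x)

    ratio : Vector ℚ k → Vector ℚ k → ℚ
    ratio x y = dot x x * inv (dot y y)

    v : ℕ → Vector ℚ k
    v 0 = 𝟎
    v 1 = w
    v (suc (suc j)) =
      (L *ᵥ v (suc j) -ᵥ rayleigh (v (suc j)) · v (suc j)) -ᵥ ratio (v (suc j)) (v j) · v j

    h α β : ℕ → ℚ
    h j = dot (v j) (v j)
    α j = rayleigh (v (suc j))
    β j = ratio (v (suc j)) (v j)

    -- The recurrence of `v` with the number x in place of L. Because of the shifted index,
    -- `p (suc j)` is monic of degree j.
    p : ℕ → ℚ → ℚ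
    p 0 x = 0ℚ
    p 1 x = 1ℚ
    p (suc (suc j)) x = (x - α j) * p (suc j) x - β j * p j x

    h₀≡0 : h 0 ≡ 0ℚ
    h₀≡0 = dot-0ʳ {k} 𝟎

    inv-h₀≡0 : inv (h 0) ≡ 0ℚ
    inv-h₀≡0 = inv-zero h₀≡0

    L-v : ∀ j → L *ᵥ v (suc j) ≋ (v (suc (suc j)) +ᵥ α j · v (suc j)) +ᵥ β j · v j
    L-v j i = restore ((L *ᵥ v (suc j)) i) (α j * v (suc j) i) (β j * v j i)
      where
      restore : ∀ l a b → l ≡ l - a - b + a + b
      restore = solve-∀ ℚ-acr

    dot-L-v : ∀ j y → dot (L *ᵥ v (suc j)) y ≡ dot (v (suc (suc j))) y + α j * dot (v (suc j)) y + β j * dot (v j) y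
    dot-L-v j y = begin
      dot (L *ᵥ v (suc j)) y
        ≡⟨ dot-congˡ y (L-v j) ⟩
      dot ((v (suc (suc j)) +ᵥ α j · v (suc j)) +ᵥ β j · v j) y
        ≡⟨ dot-+ˡ (v (suc (suc j)) +ᵥ α j · v (suc j)) (β j · v j) y ⟩
      dot (v (suc (suc j)) +ᵥ α j · v (suc j)) y + dot (β j · v j) y
        ≡⟨ cong₂ _+_ (trans (dot-+ˡ (v (suc (suc j))) (α j · v (suc j)) y)
             (cong (dot (v (suc (suc j))) y +_) (dot-·ˡ (α j) (v (suc j)) y))) (dot-·ˡ (β j) (v j) y) ⟩
      dot (v (suc (suc j))) y + α j * dot (v (suc j)) y + β j * dot (v j) y ∎
      where open ≡-Reasoning

    dot-v : ∀ x j → dot x (v (suc (suc j))) ≡ dot (L *ᵥ x) (v (suc j)) - α j * dot x (v (suc j)) - β j * dot x (v j)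
    dot-v x j = begin
      dot x ((L *ᵥ v (suc j) -ᵥ α j · v (suc j)) -ᵥ β j · v j)
        ≡⟨ dot--ʳ x (L *ᵥ v (suc j) -ᵥ α j · v (suc j)) (β j · v j) ⟩
      dot x (L *ᵥ v (suc j) -ᵥ α j · v (suc j)) - dot x (β j · v j)
        ≡⟨ cong₂ _-_ (trans (dot--ʳ x (L *ᵥ v (suc j)) (α j · v (suc j)))
             (cong₂ _-_ (sym (*ᵥ-adjoint L L-symmetric x (v (suc j)))) (dot-·ʳ x (α j) (v (suc j)))))
             (dot-·ʳ x (β j) (v j)) ⟩
      dot (L *ᵥ x) (v (suc j)) - α j * dot x (v (suc j)) - β j * dot x (v j) ∎
      where open ≡-Reasoning

    NonDegenerate : ℕ → Set
    NonDegenerate m = ∀ j → j ℕ.< m → h (suc j) ≢ 0ℚ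

    Orthogonal : ℕ → Set
    Orthogonal m = ∀ i j → i ℕ.< j → j ℕ.≤ m → dot (v i) (v j) ≡ 0ℚ

    -- Since L is symmetric, pairing v i with L v (m+1) is pairing L v i with v (m+1), and L v i is
    -- a combination of v (i-1), v i and v (i+1). Hence the new vector is automatically orthogonal
    -- to v i for i < m (`far`); the coefficient `α m` handles i = m + 1 (`top`), and `β m` handles
    -- i = m (`next`).
    orthogonal : ∀ m → NonDegenerate m → Orthogonal (suc m)
    orthogonal zero    _  zero    (suc zero) _ _ = dot-0ˡ w
    orthogonal zero    _  (suc _) (suc zero) (s≤s ()) _
    orthogonal zero    _  _ (suc (suc _)) _ (s≤s ())
    orthogonal (suc m) nz i j i<j j≤2+m with ℕ.m≤n⇒m<n∨m≡n j≤2+m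
    ... | inj₁ j<2+m = orthogonal m (λ j j<m → nz j (ℕ.m<n⇒m<1+n j<m)) i j i<j (ℕ.≤-pred j<2+m)
    ... | inj₂ refl = trans (dot-v (v i) m) (cases (ℕ.m≤n⇒m<n∨m≡n (ℕ.≤-pred i<j)))
      where
      IH : Orthogonal (suc m)
      IH = orthogonal m (λ j j<m → nz j (ℕ.m<n⇒m<1+n j<m))
      IH′ : ∀ i j → i ℕ.< j → j ℕ.≤ suc m → dot (v j) (v i) ≡ 0ℚ
      IH′ i j i<j j≤m = trans (dot-comm (v j) (v i)) (IH i j i<j j≤m)

      top : dot (L *ᵥ v (suc m)) (v (suc m)) - α m * h (suc m) - β m * dot (v (suc m)) (v m) ≡ 0ℚ
      top = begin
        r - r * inv (h (suc m)) * h (suc m) - β m * dot (v (suc m)) (v m)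
          ≡⟨ cong₂ (λ s t → r - s - β m * t)
               (trans (ℚ.*-assoc r (inv (h (suc m))) (h (suc m))) (cong (r *_) (inv-inverseˡ (nz m ℕ.≤-refl))))
               (IH′ m (suc m) ℕ.≤-refl ℕ.≤-refl) ⟩
        r - r * 1ℚ - β m * 0ℚ ≡⟨ vanish r (β m) ⟩
        0ℚ ∎
        where
        open ≡-Reasoning
        r = dot (L *ᵥ v (suc m)) (v (suc m))
        vanish : ∀ r b → r - r * 1ℚ - b * 0ℚ ≡ 0ℚ
        vanish = solve-∀ ℚ-acr

      -- ⟨L vₘ , vₘ₊₁⟩ = ⟨vₘ₊₁ , vₘ₊₁⟩, which the choice of β m compensates.
      next : ∀ m → NonDegenerate (suc m) → Orthogonal (suc m) →
        dot (L *ᵥ v m) (v (suc m)) - α m * dot (v m) (v (suc m)) - β m * h m ≡ 0ℚ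
      next zero nz IH = begin
        dot (L *ᵥ 𝟎) w - α 0 * dot {k} 𝟎 w - β 0 * h 0
          ≡⟨ cong₂ _-_ (cong₂ (λ s t → s - α 0 * t)
               (trans (*ᵥ-adjoint L L-symmetric 𝟎 w) (dot-0ˡ (L *ᵥ w))) (dot-0ˡ w)) (cong (β 0 *_) h₀≡0) ⟩
        0ℚ - α 0 * 0ℚ - β 0 * 0ℚ ≡⟨ vanish (α 0) (β 0) ⟩
        0ℚ ∎
        where
        open ≡-Reasoning
        vanish : ∀ a b → 0ℚ - a * 0ℚ - b * 0ℚ ≡ 0ℚ
        vanish = solve-∀ ℚ-acr
      next (suc m) nz IH = begin
        dot (L *ᵥ v (suc m)) v₂ - α (suc m) * dot (v (suc m)) v₂ - H * inv (h (suc m)) * h (suc m)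
          ≡⟨ cong₂ _-_ (cong₂ (λ s t → s - α (suc m) * t)
               (trans (dot-L-v m v₂) (cong₂ (λ s t → H + α m * s + β m * t)
                 (IH (suc m) (suc (suc m)) ℕ.≤-refl ℕ.≤-refl)
                 (IH m (suc (suc m)) (ℕ.m<n⇒m<1+n ℕ.≤-refl) ℕ.≤-refl)))
               (IH (suc m) (suc (suc m)) ℕ.≤-refl ℕ.≤-refl))
               (trans (ℚ.*-assoc H (inv (h (suc m))) (h (suc m))) (cong (H *_) (inv-inverseˡ (nz m (ℕ.m<n⇒m<1+n ℕ.≤-refl))))) ⟩
        H + α m * 0ℚ + β m * 0ℚ - α (suc m) * 0ℚ - H * 1ℚ ≡⟨ vanish H (α m) (β m) (α (suc m)) ⟩
        0ℚ ∎
        where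
        open ≡-Reasoning
        v₂ = v (suc (suc m))
        H = h (suc (suc m))
        vanish : ∀ H a b c → H + a * 0ℚ + b * 0ℚ - c * 0ℚ - H * 1ℚ ≡ 0ℚ
        vanish = solve-∀ ℚ-acr

      far-L : ∀ i → i ℕ.< m → dot (L *ᵥ v i) (v (suc m)) ≡ 0ℚ
      far-L zero    _   = trans (*ᵥ-adjoint L L-symmetric 𝟎 (v (suc m))) (dot-0ˡ (L *ᵥ v (suc m)))
      far-L (suc i) i<m = trans (dot-L-v i (v (suc m))) (trans
        (cong₂ _+_ (cong₂ (λ s t → s + α i * t)
          (IH (suc (suc i)) (suc m) (s≤s i<m) ℕ.≤-refl)
          (IH (suc i) (suc m) (ℕ.m<n⇒m<1+n i<m) ℕ.≤-refl))
          (cong (β i *_) (IH i (suc m) (ℕ.m<n⇒m<1+n (ℕ.<⇒≤ i<m)) ℕ.≤-refl)))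
        (vanish (α i) (β i)))
        where
        vanish : ∀ a b → 0ℚ + a * 0ℚ + b * 0ℚ ≡ 0ℚ
        vanish = solve-∀ ℚ-acr

      far : ∀ i → i ℕ.< m → dot (L *ᵥ v i) (v (suc m)) - α m * dot (v i) (v (suc m)) - β m * dot (v i) (v m) ≡ 0ℚ
      far i i<m = trans (cong₂ _-_ (cong₂ (λ s t → s - α m * t) (far-L i i<m)
        (IH i (suc m) (ℕ.m<n⇒m<1+n i<m) ℕ.≤-refl)) (cong (β m *_) (IH i m i<m (ℕ.n≤1+n m))))
        (vanish (α m) (β m))
        where
        vanish : ∀ a b → 0ℚ - a * 0ℚ - b * 0ℚ ≡ 0ℚ
        vanish = solve-∀ ℚ-acr

      cases : i ℕ.< suc m ⊎ i ≡ suc m →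
        dot (L *ᵥ v i) (v (suc m)) - α m * dot (v i) (v (suc m)) - β m * dot (v i) (v m) ≡ 0ℚ
      cases (inj₂ refl) = top
      cases (inj₁ i<1+m) with ℕ.m≤n⇒m<n∨m≡n (ℕ.≤-pred i<1+m)
      ... | inj₁ i<m  = far i i<m
      ... | inj₂ refl = next i nz IH

    -- An orthogonal sequence of nonzero vectors in ℚᵏ has length at most k.
    breakdown : w ≋ 𝟎 ⊎ ∃[ d ] NonDegenerate (suc d) × v (suc (suc d)) ≋ 𝟎
    breakdown with search (suc k)
      where
      search : ∀ m → NonDegenerate m ⊎ ∃[ d ] NonDegenerate d × h (suc d) ≡ 0ℚ
      search zero = inj₁ λ _ ()
      search (suc m) with search m
      ... | inj₂ found = inj₂ found
      ... | inj₁ nz with h (suc m) ℚ.≟ 0ℚ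
      ...   | yes h≡0 = inj₂ (m , nz , h≡0)
      ...   | no  h≢0 = inj₁ λ j j<1+m → case-≤ j (ℕ.m≤n⇒m<n∨m≡n (ℕ.≤-pred j<1+m))
        where
        case-≤ : ∀ j → j ℕ.< m ⊎ j ≡ m → h (suc j) ≢ 0ℚ
        case-≤ j (inj₁ j<m)  = nz j j<m
        case-≤ j (inj₂ refl) = h≢0
    ... | inj₂ (zero  , _  , h≡0) = inj₁ (dot-self≡0⇒≋0 w h≡0)
    ... | inj₂ (suc d , nz , h≡0) = inj₂ (d , nz , dot-self≡0⇒≋0 (v (suc (suc d))) h≡0)
    ... | inj₁ nz = contradiction (orthogonal-system-length (v ∘ suc) (suc k)
        (λ i j i<j j<r → orthogonal (suc k) nz (suc i) (suc j) (s≤s i<j) (ℕ.m<n⇒m<1+n j<r)) nz)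
      (ℕ.<⇒≱ ℕ.≤-refl)

    -- The sum of pⱼ(x)/hⱼ · vⱼ over 1 ≤ j ≤ m. These coefficients are forced: an eigenvector y for
    -- x with ⟨y , w⟩ = 1 has ⟨y , vⱼ⟩ = ⟨y , pⱼ(L) w⟩ = pⱼ(x).
    y : ℕ → ℚ → Vector ℚ k
    y zero    x = 𝟎
    y (suc m) x = y m x +ᵥ (p (suc m) x * inv (h (suc m))) · v (suc m)

    -- The Christoffel–Darboux identity.
    L-y : ∀ m x → NonDegenerate m → ∀ i →
      (L *ᵥ y m x) i ≡ x * y m x i + inv (h m) * (p m x * v (suc m) i - p (suc m) x * v m i)
    L-y zero x _ i = trans (dot-0ʳ (L i)) (sym (trans (cong (λ t → x * 0ℚ + t * (0ℚ * w i - 1ℚ * 0ℚ)) inv-h₀≡0) (vanish x (w i))))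
      where
      vanish : ∀ x w → x * 0ℚ + 0ℚ * (0ℚ * w - 1ℚ * 0ℚ) ≡ 0ℚ
      vanish = solve-∀ ℚ-acr
    L-y (suc m) x nz i = begin
      (L *ᵥ (y m x +ᵥ c · v (suc m))) i
        ≡⟨ trans (*ᵥ-+ L (y m x) (c · v (suc m)) i) (cong ((L *ᵥ y m x) i +_) (*ᵥ-· L c (v (suc m)) i)) ⟩
      (L *ᵥ y m x) i + c * (L *ᵥ v (suc m)) i
        ≡⟨ cong₂ (λ s t → s + c * t) (L-y m x (λ j j<m → nz j (ℕ.m<n⇒m<1+n j<m)) i) (L-v m i) ⟩
      x * y m x i + I₀ * (P₀ * v₁ - P₁ * v₀) + P₁ * I₁ * (v₂ + α m * v₁ + H * I₀ * v₀)
        ≡⟨ regroup x (y m x i) I₀ P₀ v₁ P₁ v₀ I₁ v₂ (α m) H ⟩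
      R + (I₁ * H - 1ℚ) * (P₁ * I₀ * v₀ - I₀ * P₀ * v₁)
        ≡⟨ cong (λ t → R + (t - 1ℚ) * (P₁ * I₀ * v₀ - I₀ * P₀ * v₁)) (inv-inverseˡ (nz m ℕ.≤-refl)) ⟩
      R + (1ℚ - 1ℚ) * (P₁ * I₀ * v₀ - I₀ * P₀ * v₁)
        ≡⟨ unit R (P₁ * I₀ * v₀ - I₀ * P₀ * v₁) ⟩
      R ∎
      where
      open ≡-Reasoning
      P₀ = p m x
      P₁ = p (suc m) x
      I₀ = inv (h m)
      I₁ = inv (h (suc m))
      H  = h (suc m)
      v₀ = v m i
      v₁ = v (suc m) i
      v₂ = v (suc (suc m)) i
      c  = P₁ * I₁
      R  = x * y (suc m) x i + I₁ * (P₁ * v₂ - p (suc (suc m)) x * v₁)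
      regroup : ∀ x y I₀ P₀ v₁ P₁ v₀ I₁ v₂ a H →
        x * y + I₀ * (P₀ * v₁ - P₁ * v₀) + P₁ * I₁ * (v₂ + a * v₁ + H * I₀ * v₀)
        ≡ (x * (y + P₁ * I₁ * v₁) + I₁ * (P₁ * v₂ - ((x - a) * P₁ - H * I₀ * P₀) * v₁))
          + (I₁ * H - 1ℚ) * (P₁ * I₀ * v₀ - I₀ * P₀ * v₁)
      regroup = solve-∀ ℚ-acr
      unit : ∀ r e → r + (1ℚ - 1ℚ) * e ≡ r
      unit = solve-∀ ℚ-acr

    -- Since w = v 1 is orthogonal to all later v j, only the first summand contributes. The value
    -- does not depend on x, so it survives the passage to the limit and keeps the eigenvector away
    -- from zero.
    y·w : ∀ m x → NonDegenerate (suc m) → dot (y (suc m) x) w ≡ 1ℚ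
    y·w zero x nz = begin
      dot (y 1 x) w                          ≡⟨ dot-+ˡ 𝟎 ((1ℚ * inv (h 1)) · w) w ⟩
      dot {k} 𝟎 w + dot ((1ℚ * inv (h 1)) · w) w ≡⟨ cong₂ _+_ (dot-0ˡ w) (dot-·ˡ (1ℚ * inv (h 1)) w w) ⟩
      0ℚ + 1ℚ * inv (h 1) * h 1              ≡⟨ units (inv (h 1)) (h 1) ⟩
      inv (h 1) * h 1                        ≡⟨ inv-inverseˡ (nz 0 ℕ.≤-refl) ⟩
      1ℚ                                     ∎
      where
      open ≡-Reasoning
      units : ∀ i h → 0ℚ + 1ℚ * i * h ≡ i * h
      units = solve-∀ ℚ-acr
    y·w (suc m) x nz = begin
      dot (y (suc m) x +ᵥ c · v (suc (suc m))) w           ≡⟨ dot-+ˡ (y (suc m) x) (c · v (suc (suc m))) w ⟩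
      dot (y (suc m) x) w + dot (c · v (suc (suc m))) w    ≡⟨ cong₂ _+_ (y·w m x nz′)
          (trans (dot-·ˡ c (v (suc (suc m))) w) (cong (c *_) (trans (dot-comm (v (suc (suc m))) w)
            (orthogonal (suc m) nz′ 1 (suc (suc m)) (s≤s (s≤s z≤n)) ℕ.≤-refl)))) ⟩
      1ℚ + c * 0ℚ                                          ≡⟨ unit c ⟩
      1ℚ                                                   ∎
      where
      open ≡-Reasoning
      c = p (suc (suc m)) x * inv (h (suc (suc m)))
      nz′ : NonDegenerate (suc m)
      nz′ j j<m = nz j (ℕ.m<n⇒m<1+n j<m)
      unit : ∀ c → 1ℚ + c * 0ℚ ≡ 1ℚ
      unit = solve-∀ ℚ-acr

-- A real eigenpair by bisection and a Sturm-type argument.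

module Eigenpairs where

  open import Data.Rational.Base
  open ≡
  open Defs using (_≈_)
  open Rationals
  open Reals
  open RationalVectors
  open LanczosRecurrence
  open LAℚ

  module Bisection {Q : ℚ → Set} (Q? : Decidable Q) where

    -- A boundary point of a decidable set of rationals is enclosed. No regularity of Q enters the
    -- construction; the invariants say that the left ends always lie outside Q and the right ends
    -- always inside.
    record Interval : Set where
      field
        lo hi : ℚ
        lo≤hi : lo ≤ hi
        ¬Q-lo : ¬ Q lo
        Q-hi  : Q hi
      mid : ℚ
      mid = ½ * (lo + hi)
      lo≤mid : lo ≤ mid
      lo≤mid = ≤-shift (½ * (hi - lo)) (*-nonNeg (ℚ.<⇒≤ 0<½) (p≤q⇒0≤q-p lo≤hi)) (eq lo hi)
        where
        eq : ∀ a b → ½ * (a + b) ≡ a + ½ * (b - a)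
        eq = solve-∀ ℚ-acr
      mid≤hi : mid ≤ hi
      mid≤hi = ≤-shift (½ * (hi - lo)) (*-nonNeg (ℚ.<⇒≤ 0<½) (p≤q⇒0≤q-p lo≤hi)) (eq lo hi)
        where
        eq : ∀ a b → b ≡ ½ * (a + b) + ½ * (b - a)
        eq = solve-∀ ℚ-acr

    open Interval

    halve : (I : Interval) → Dec (Q (mid I)) → Interval
    halve I (yes q) = record { lo = lo I ; hi = mid I ; lo≤hi = lo≤mid I ; ¬Q-lo = ¬Q-lo I ; Q-hi = q }
    halve I (no ¬q) = record { lo = mid I ; hi = hi I ; lo≤hi = mid≤hi I ; ¬Q-lo = ¬q ; Q-hi = Q-hi I }

    halve-width : ∀ I d → hi (halve I d) - lo (halve I d) ≡ ½ * (hi I - lo I)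
    halve-width I (yes _) = eq (lo I) (hi I)
      where
      eq : ∀ a b → ½ * (a + b) - a ≡ ½ * (b - a)
      eq = solve-∀ ℚ-acr
    halve-width I (no _) = eq (lo I) (hi I)
      where
      eq : ∀ a b → b - ½ * (a + b) ≡ ½ * (b - a)
      eq = solve-∀ ℚ-acr

    halve-lo : ∀ I d → lo I ≤ lo (halve I d)
    halve-lo I (yes _) = ℚ.≤-refl
    halve-lo I (no _)  = lo≤mid I

    halve-hi : ∀ I d → hi (halve I d) ≤ hi I
    halve-hi I (yes _) = mid≤hi I
    halve-hi I (no _)  = ℚ.≤-refl

    module _ (I₀ : Interval) where

      interval : ℕ → Interval
      interval zero    = I₀
      interval (suc n) = halve (interval n) (Q? (mid (interval n)))

      lower upper : ℕ → ℚ
      lower n = lo (interval n)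
      upper n = hi (interval n)

      nested : ∀ m j → lower m ≤ lower (j ℕ.+ m) × upper (j ℕ.+ m) ≤ upper m
      nested m zero    = ℚ.≤-refl , ℚ.≤-refl
      nested m (suc j) =
        ℚ.≤-trans (proj₁ (nested m j)) (halve-lo (interval (j ℕ.+ m)) (Q? (mid (interval (j ℕ.+ m))))) ,
        ℚ.≤-trans (halve-hi (interval (j ℕ.+ m)) (Q? (mid (interval (j ℕ.+ m))))) (proj₂ (nested m j))

      enclosed : ∀ {m n} → m ℕ.≤ n → lower m ≤ lower n × lower n ≤ upper m
      enclosed {m} {n} m≤n with nested m (n ℕ.∸ m)
      ... | l , u rewrite ℕ.m∸n+n≡m m≤n = l , ℚ.≤-trans (lo≤hi (interval n)) u

      halfPower : ℕ → ℚ
      halfPower zero    = 1ℚ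
      halfPower (suc n) = ½ * halfPower n

      -- The bound n 2⁻ⁿ ≤ 1 is what `harmonic-null` asks for. Both bounds are proved together
      -- because (n + 1) 2⁻ⁿ⁻¹ is the mean of n 2⁻ⁿ and 2⁻ⁿ.
      halfPower-bounds : ∀ n → halfPower n ≤ 1ℚ × ι n * halfPower n ≤ 1ℚ
      halfPower-bounds zero    = ℚ.≤-refl , ℚ.≤-trans (ℚ.≤-reflexive (ℚ.*-zeroˡ 1ℚ)) 0≤1
      halfPower-bounds (suc n) with halfPower-bounds n
      ... | p≤1 , np≤1 =
        ≤-shift _ (+-nonNeg (ℚ.<⇒≤ 0<½) (*-nonNeg (ℚ.<⇒≤ 0<½) (p≤q⇒0≤q-p p≤1))) (eq₁ (halfPower n)) ,
        ≤-shift _ (*-nonNeg (ℚ.<⇒≤ 0<½) (+-nonNeg (p≤q⇒0≤q-p p≤1) (p≤q⇒0≤q-p np≤1))) (eq₂ (ι n) (halfPower n))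
        where
        eq₁ : ∀ p → 1ℚ ≡ ½ * p + (½ + ½ * (1ℚ - p))
        eq₁ = solve-∀ ℚ-acr
        eq₂ : ∀ n p → 1ℚ ≡ (1ℚ + n) * (½ * p) + ½ * ((1ℚ - p) + (1ℚ - n * p))
        eq₂ = solve-∀ ℚ-acr

      width : ∀ n → upper n - lower n ≡ (hi I₀ - lo I₀) * halfPower n
      width zero    = sym (ℚ.*-identityʳ (hi I₀ - lo I₀))
      width (suc n) = trans (halve-width (interval n) (Q? (mid (interval n))))
        (trans (cong (½ *_) (width n)) (eq (hi I₀ - lo I₀) (halfPower n)))
        where
        eq : ∀ w p → ½ * (w * p) ≡ w * (½ * p)
        eq = solve-∀ ℚ-acr

      width-nonNeg : ∀ n → 0ℚ ≤ upper n - lower n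
      width-nonNeg n = p≤q⇒0≤q-p (lo≤hi (interval n))

      width-small : ∀ ε → 0ℚ < ε → Eventually (λ n → upper n - lower n < ε)
      width-small ε 0<ε = Eventually-map (λ n h → h (upper n - lower n) (bound n))
        (harmonic-null (hi I₀ - lo I₀) ε 0<ε)
        where
        eq : ∀ n w p → n * (w * p) ≡ w * (n * p)
        eq = solve-∀ ℚ-acr
        bound : ∀ n → ι n * (upper n - lower n) ≤ hi I₀ - lo I₀
        bound n = subst₂ _≤_
          (sym (trans (cong (ι n *_) (width n)) (eq (ι n) (hi I₀ - lo I₀) (halfPower n))))
          (ℚ.*-identityʳ (hi I₀ - lo I₀))
          (*-monoˡ (hi I₀ - lo I₀) (width-nonNeg 0) (proj₂ (halfPower-bounds n)))

      upper-lower-null : Null (λ n → upper n - lower n)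
      upper-lower-null ε 0<ε = Eventually-map
        (λ n → subst (_< ε) (sym (ℚ.0≤p⇒∣p∣≡p (width-nonNeg n)))) (width-small ε 0<ε)

      lower-cauchy : IsCauchy lower
      lower-cauchy ε 0<ε = let N , small = width-small ε 0<ε in N , λ m n N≤m N≤n →
        ℚ.≤-<-trans {∣ lower m - lower n ∣} {upper N - lower N} {ε}
          (∣∣-≤ {lower m - lower n} {upper N - lower N}
            (within N m n N≤m N≤n)
            (subst (_≤ upper N - lower N) (sym (flip (lower m) (lower n))) (within N n m N≤n N≤m)))
          (small N ℕ.≤-refl)
        where
        flip : ∀ a b → - (a - b) ≡ b - a
        flip = solve-∀ ℚ-acr
        within : ∀ N m n → N ℕ.≤ m → N ℕ.≤ n → lower m - lower n ≤ upper N - lower N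
        within N m n N≤m N≤n = ℚ.+-mono-≤ {lower m} {upper N} { - lower n } { - lower N }
          (proj₂ (enclosed {N} {m} N≤m))
          (ℚ.neg-antimono-≤ {lower N} {lower n} (proj₁ (enclosed {N} {n} N≤n)))

      limit : ℝ
      limit = mkℝ lower lower-cauchy

      upper-cauchy : IsCauchy upper
      upper-cauchy ε 0<ε = Eventually₂ (isCauchy limit (½ * ε) (½*-pos 0<ε))
        (upper-lower-null (½ * (½ * ε)) (½*-pos (½*-pos 0<ε)))
        where
        split : ∀ u u′ l l′ → (l - l′) + ((u - l) + - (u′ - l′)) ≡ u - u′
        split = solve-∀ ℚ-acr
        Eventually₂ : ∃[ N ] (∀ m n → N ℕ.≤ m → N ℕ.≤ n → ∣ lower m - lower n ∣ < ½ * ε) →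
          Eventually (λ n → ∣ upper n - lower n ∣ < ½ * (½ * ε)) →
          ∃[ N ] (∀ m n → N ℕ.≤ m → N ℕ.≤ n → ∣ upper m - upper n ∣ < ε)
        Eventually₂ (M , f) (N , g) = M ℕ.⊔ N , λ m n hm hn →
          let M≤m = ℕ.m⊔n≤o⇒m≤o M N hm
              M≤n = ℕ.m⊔n≤o⇒m≤o M N hn
              N≤m = ℕ.m⊔n≤o⇒n≤o M N hm
              N≤n = ℕ.m⊔n≤o⇒n≤o M N hn
              a = lower m - lower n
              b = upper m - lower m
              c = upper n - lower n
          in begin-strict
          ∣ upper m - upper n ∣            ≡⟨ cong ∣_∣ (sym (split (upper m) (upper n) (lower m) (lower n))) ⟩
          ∣ a + (b - c) ∣                  ≤⟨ ℚ.∣p+q∣≤∣p∣+∣q∣ a (b - c) ⟩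
          ∣ a ∣ + ∣ b - c ∣                ≤⟨ ℚ.+-monoʳ-≤ ∣ a ∣ (ℚ.∣p-q∣≤∣p∣+∣q∣ b c) ⟩
          ∣ a ∣ + (∣ b ∣ + ∣ c ∣)          <⟨ ℚ.+-mono-< (f m n M≤m M≤n) (ℚ.+-mono-< (g m N≤m) (g n N≤n)) ⟩
          ½ * ε + (½ * (½ * ε) + ½ * (½ * ε)) ≡⟨ cong (½ * ε +_) (½+½ (½ * ε)) ⟩
          ½ * ε + ½ * ε                    ≡⟨ ½+½ ε ⟩
          ε                                ∎
          where open ℚ.≤-Reasoning

      -- A second representative of the same real number: Q holds at every stage of `limit⁺` and
      -- fails at every stage of `limit`, so each carries one-sided information.
      limit⁺ : ℝ
      limit⁺ = mkℝ upper upper-cauchy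

      limit⁺≈limit : limit⁺ ≈ limit
      limit⁺≈limit = mk≈ upper-lower-null

  module Eigenpair {k} (L : Matrix k) (L-symmetric : Symmetric L) (w : Vector ℚ k) where
    open Lanczos L L-symmetric w

    pℝ : ℕ → ℝ → ℝ
    pℝ 0 x = 0ℝ
    pℝ 1 x = 1ℝ
    pℝ (suc (suc j)) x = (x ℝ.- fromℚ (α j)) ℝ.* pℝ (suc j) x ℝ.- fromℚ (β j) ℝ.* pℝ j x

    pℝ-seq : ∀ j x n → seq (pℝ j x) n ≡ p j (seq x n)
    pℝ-seq 0 x n = refl
    pℝ-seq 1 x n = refl
    pℝ-seq (suc (suc j)) x n =
      cong₂ (λ s t → (seq x n - α j) * s - β j * t) (pℝ-seq (suc j) x n) (pℝ-seq j x n)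

    pℝ-bounded : ∀ j x → Bounded (λ n → p j (seq x n))
    pℝ-bounded j x = let B , 0<B , ev = seq-bounded (pℝ j x) in
      B , 0<B , Eventually-map {λ n → ∣ seq (pℝ j x) n ∣ ≤ B} {λ n → ∣ p j (seq x n) ∣ ≤ B}
        (λ n → subst (λ t → ∣ t ∣ ≤ B) (pℝ-seq j x n)) ev

    p-continuous : ∀ j x x′ → x ≈ x′ → Null (λ n → p j (seq x n) - p j (seq x′ n))
    p-continuous 0 x x′ eq = null-cong (λ n → sym (ℚ.+-inverseʳ 0ℚ)) null-0
    p-continuous 1 x x′ eq = null-cong (λ n → sym (ℚ.+-inverseʳ 1ℚ)) null-0
    p-continuous (suc (suc j)) x x′ eq = null-cong {λ n → (f n + g n) + e n}
      (λ n → split (seq x n) (seq x′ n) (α j) (β j) (p (suc j) (seq x n)) (p (suc j) (seq x′ n)) (p j (seq x n)) (p j (seq x′ n)))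
      (null-+ {λ n → f n + g n} {e} (null-+ {f} {g}
        (bounded-*-null {λ n → seq x n - α j} {λ n → p (suc j) (seq x n) - p (suc j) (seq x′ n)}
          (seq-bounded (x ℝ.- fromℚ (α j))) (p-continuous (suc j) x x′ eq))
        (bounded-*-null {λ n → p (suc j) (seq x′ n)} {λ n → seq x n - seq x′ n} (pℝ-bounded (suc j) x′) (close eq)))
        (null-* (- β j) {λ n → p j (seq x n) - p j (seq x′ n)} (p-continuous j x x′ eq)))
      where
      f g e : ℕ → ℚ
      f n = (seq x n - α j) * (p (suc j) (seq x n) - p (suc j) (seq x′ n))
      g n = p (suc j) (seq x′ n) * (seq x n - seq x′ n)
      e n = (- β j) * (p j (seq x n) - p j (seq x′ n))
      split : ∀ x x′ a b p₁ p₁′ p₀ p₀′ →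
        ((x - a) * (p₁ - p₁′) + p₁′ * (x - x′)) + (- b) * (p₀ - p₀′)
        ≡ ((x - a) * p₁ - b * p₀) - ((x′ - a) * p₁′ - b * p₀′)
      split = solve-∀ ℚ-acr

    pℝ-cong : ∀ j {x x′} → x ≈ x′ → pℝ j x ≈ pℝ j x′
    pℝ-cong j {x} {x′} eq = mk≈ (null-cong
      (λ n → sym (cong₂ _-_ (pℝ-seq j x n) (pℝ-seq j x′ n))) (p-continuous j x x′ eq))

    module _ (d : ℕ) (nz : NonDegenerate (suc d)) (v₂₊d≋0 : v (suc (suc d)) ≋ 𝟎) where

      -- Bisecting the sign of p_D alone would need a starting point where p_D is not positive, and
      -- none is at hand. For the joint condition there is one, since p₂ vanishes at `α 0`. The
      -- price is to show that the boundary point found is a root of p_D and not of an earlier pⱼ.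
      Positive-upto : ℕ → ℚ → Set
      Positive-upto zero    x = ⊤
      Positive-upto (suc m) x = Positive-upto m x × 0ℚ < p (suc m) x

      positive-upto? : ∀ m x → Dec (Positive-upto m x)
      positive-upto? zero    x = yes tt
      positive-upto? (suc m) x = positive-upto? m x ×-dec (0ℚ ℚ.<? p (suc m) x)

      positive-at : ∀ m {x} → Positive-upto m x → ∀ j → j ℕ.< m → 0ℚ < p (suc j) x
      positive-at (suc m) (pos , last) j j<1+m with ℕ.m≤n⇒m<n∨m≡n (ℕ.≤-pred j<1+m)
      ... | inj₁ j<m  = positive-at m pos j j<m
      ... | inj₂ refl = last

      bound : ℕ → ℚ
      bound = sumTo (λ j → ∣ α j ∣ + ∣ β j ∣)

      bound-nonNeg : ∀ m → 0ℚ ≤ bound m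
      bound-nonNeg zero    = ℚ.≤-refl
      bound-nonNeg (suc m) = +-nonNeg (bound-nonNeg m) (+-nonNeg (ℚ.0≤∣p∣ (α m)) (ℚ.0≤∣p∣ (β m)))

      bound-≥ : ∀ m j → j ℕ.< m → ∣ α j ∣ + ∣ β j ∣ ≤ bound m
      bound-≥ (suc m) j j<1+m with ℕ.m≤n⇒m<n∨m≡n (ℕ.≤-pred j<1+m)
      ... | inj₁ j<m  = ℚ.≤-trans (bound-≥ m j j<m)
                          (≤-shift _ (+-nonNeg (ℚ.0≤∣p∣ (α m)) (ℚ.0≤∣p∣ (β m))) refl)
      ... | inj₂ refl = ≤-shift (bound m) (bound-nonNeg m) (ℚ.+-comm (bound m) (∣ α m ∣ + ∣ β m ∣))

      x⁺ : ℚ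
      x⁺ = 1ℚ + bound (suc d)

      -- Beyond x⁺ the recurrence keeps the values of the pⱼ increasing.
      p-increasing : ∀ m → m ℕ.≤ suc d → 0ℚ ≤ p m x⁺ × p m x⁺ ≤ p (suc m) x⁺ × 0ℚ < p (suc m) x⁺
      p-increasing zero    _   = ℚ.≤-refl , 0≤1 , 0<1
      p-increasing (suc m) m<1+d =
        let 0≤p₀ , p₀≤p₁ , 0<p₁ = p-increasing m (ℕ.<⇒≤ m<1+d)
            p₁≤p₂ = step 0≤p₀ p₀≤p₁ (ℚ.<⇒≤ 0<p₁)
        in ℚ.<⇒≤ 0<p₁ , p₁≤p₂ , ℚ.<-≤-trans 0<p₁ p₁≤p₂
        where
        a b p₀ p₁ B : ℚ
        a = α m
        b = β m
        p₀ = p m x⁺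
        p₁ = p (suc m) x⁺
        B = bound (suc d)
        eq : ∀ B a b p₀ p₁ A C → ((1ℚ + B) - a) * p₁ - b * p₀ ≡
          p₁ + ((((B - (A + C)) * p₁ + (A - a) * p₁) + C * (p₁ - p₀)) + (C - b) * p₀)
        eq = solve-∀ ℚ-acr
        step : 0ℚ ≤ p₀ → p₀ ≤ p₁ → 0ℚ ≤ p₁ → p₁ ≤ p (suc (suc m)) x⁺
        step 0≤p₀ p₀≤p₁ 0≤p₁ = ≤-shift
          ((((B - (∣ a ∣ + ∣ b ∣)) * p₁ + (∣ a ∣ - a) * p₁) + ∣ b ∣ * (p₁ - p₀)) + (∣ b ∣ - b) * p₀)
          (+-nonNeg {((B - (∣ a ∣ + ∣ b ∣)) * p₁ + (∣ a ∣ - a) * p₁) + ∣ b ∣ * (p₁ - p₀)} {(∣ b ∣ - b) * p₀}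
            (+-nonNeg {(B - (∣ a ∣ + ∣ b ∣)) * p₁ + (∣ a ∣ - a) * p₁} {∣ b ∣ * (p₁ - p₀)}
              (+-nonNeg {(B - (∣ a ∣ + ∣ b ∣)) * p₁} {(∣ a ∣ - a) * p₁}
                (*-nonNeg (p≤q⇒0≤q-p (bound-≥ (suc d) m m<1+d)) 0≤p₁)
                (*-nonNeg (p≤q⇒0≤q-p (p≤∣p∣ a)) 0≤p₁))
              (*-nonNeg (ℚ.0≤∣p∣ b) (p≤q⇒0≤q-p p₀≤p₁)))
            (*-nonNeg (p≤q⇒0≤q-p (p≤∣p∣ b)) 0≤p₀))
          (eq B a b p₀ p₁ ∣ a ∣ ∣ b ∣)

      D : ℕ
      D = suc (suc d)

      positive-at-x⁺ : ∀ m → m ℕ.≤ D → Positive-upto m x⁺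
      positive-at-x⁺ zero    _   = tt
      positive-at-x⁺ (suc m) m<D = positive-at-x⁺ m (ℕ.<⇒≤ m<D) , proj₂ (proj₂ (p-increasing m (ℕ.≤-pred m<D)))

      not-positive-at-α₀ : ¬ Positive-upto D (α 0)
      not-positive-at-α₀ pos = ℚ.<-irrefl (sym (vanish (α 0) (β 0))) (positive-at D pos 1 (s≤s (s≤s z≤n)))
        where
        vanish : ∀ a b → (a - a) * 1ℚ - b * 0ℚ ≡ 0ℚ
        vanish = solve-∀ ℚ-acr

      open Bisection (positive-upto? D)

      I₀ : Interval
      I₀ = record { lo = α 0 ; hi = x⁺ ; ¬Q-lo = not-positive-at-α₀ ; Q-hi = positive-at-x⁺ D ℕ.≤-refl
                  ; lo≤hi = ℚ.≤-trans (p≤∣p∣ (α 0)) (ℚ.≤-trans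
                      (≤-shift ∣ β 0 ∣ (ℚ.0≤∣p∣ (β 0)) refl) (ℚ.≤-trans (bound-≥ (suc d) 0 (s≤s z≤n))
                        (≤-shift 1ℚ 0≤1 (ℚ.+-comm 1ℚ (bound (suc d)))))) }

      λ₀ λ⁺ : ℝ
      λ₀ = limit I₀
      λ⁺ = limit⁺ I₀

      p-upper-pos : ∀ j → j ℕ.< D → ∀ n → 0ℚ < p (suc j) (upper I₀ n)
      p-upper-pos j j<D n = positive-at D (Interval.Q-hi (interval I₀ n)) j j<D

      nonNeg-at-λ⁺ : ∀ j → j ℕ.< D → ∀ n → 0ℚ ≤ seq (pℝ (suc j) λ⁺) n
      nonNeg-at-λ⁺ j j<D n = subst (0ℚ ≤_) (sym (pℝ-seq (suc j) λ⁺ n)) (ℚ.<⇒≤ (p-upper-pos j j<D n))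

      zero-or-positive : ∀ j → j ℕ.< D → ¬ (0ℝ ℝ.< pℝ (suc j) λ⁺) → Null (λ n → p (suc j) (upper I₀ n))
      zero-or-positive j j<D ¬pos = null-cong {seq (pℝ (suc j) λ⁺)} {λ n → p (suc j) (upper I₀ n)} (λ n → pℝ-seq (suc j) λ⁺ n)
        (≈0⇒null {pℝ (suc j) λ⁺} (nonNeg∧≯0⇒≈0 {pℝ (suc j) λ⁺} (nonNeg-at-λ⁺ j j<D) ¬pos))

      β-pos : ∀ j → j ℕ.< d → 0ℚ < β (suc j)
      β-pos j j<d = *-pos (h-pos (suc j) (s≤s j<d)) (inv-pos (h-pos j (ℕ.m<n⇒m<1+n j<d)))
        where
        h-pos : ∀ j → j ℕ.< suc d → 0ℚ < h (suc j)
        h-pos j j<1+d = nonNeg∧≢0⇒pos (dot-self-nonNegℚ (v (suc j))) (nz j j<1+d)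

      -- If pⱼ₊₁ vanished at λ⁺ and pⱼ > 0 there, then pⱼ₊₂ would be negative at λ⁺.
      no-interior-zero : ∀ j → j ℕ.< d → 0ℝ ℝ.< pℝ (suc j) λ⁺ → ¬ Null (λ n → p (suc (suc j)) (upper I₀ n))
      no-interior-zero j j<d 0<pⱼ null =
        let δ , 0<δ , ev = positive-eventually {pℝ (suc j) λ⁺} 0<pⱼ
            small = bounded-*-null {λ n → upper I₀ n - α (suc j)} {λ n → p (suc (suc j)) (upper I₀ n)}
              (seq-bounded (λ⁺ ℝ.- fromℚ (α (suc j)))) null (b * δ) (*-pos (β-pos j j<d) 0<δ)
            N , both = Eventually-× {λ n → δ ≤ seq (pℝ (suc j) λ⁺) n} {λ n → ∣ t n ∣ < b * δ} ev small
        in ℚ.<-irrefl refl (ℚ.<-trans (p-upper-pos (suc (suc j)) (s≤s (s≤s j<d)) N)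
             (negative-value δ N (subst (δ ≤_) (pℝ-seq (suc j) λ⁺ N) (proj₁ (both N ℕ.≤-refl)))
               (ℚ.≤-<-trans (p≤∣p∣ (t N)) (proj₂ (both N ℕ.≤-refl)))))
        where
        b : ℚ
        b = β (suc j)
        t : ℕ → ℚ
        t n = (upper I₀ n - α (suc j)) * p (suc (suc j)) (upper I₀ n)
        eq : ∀ t b δ q → 0ℚ ≡ (t - b * q) + ((b * δ - t) + b * (q - δ))
        eq = solve-∀ ℚ-acr
        negative-value : ∀ δ N → δ ≤ p (suc j) (upper I₀ N) → t N < b * δ → p (suc (suc (suc j))) (upper I₀ N) < 0ℚ
        negative-value δ N δ≤ t< = <-shift ((b * δ - t N) + b * (p (suc j) (upper I₀ N) - δ))
          (ℚ.+-mono-<-≤ {0ℚ} {b * δ - t N} {0ℚ} {b * (p (suc j) (upper I₀ N) - δ)} (p<q⇒0<q-p t<)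
            (*-nonNeg (ℚ.<⇒≤ (β-pos j j<d)) (p≤q⇒0≤q-p δ≤)))
          (eq (t N) b δ (p (suc j) (upper I₀ N)))

      module _ (no-root : ¬ Null (λ n → p D (upper I₀ n))) where

        -- Suppose pⱼ₊₁ is positive at λ⁺ and pⱼ₊₂ is not, hence vanishes there. If j + 2 < D, this
        -- contradicts `no-interior-zero`; if j + 2 = D, it contradicts `no-root`.
        all-positive : ∀ j → j ℕ.< D → ¬ ¬ (0ℝ ℝ.< pℝ (suc j) λ⁺)
        all-positive zero    _   none = none (eventually-positive {1ℝ} 1ℚ 0<1 (0 , λ _ _ → ℚ.≤-refl))
        all-positive (suc j) j<D none = all-positive j (ℕ.<⇒≤ j<D) λ 0<pⱼ → case 0<pⱼ (ℕ.m≤n⇒m<n∨m≡n j<D)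
          where
          null : Null (λ n → p (suc (suc j)) (upper I₀ n))
          null = zero-or-positive (suc j) j<D none
          case : 0ℝ ℝ.< pℝ (suc j) λ⁺ → ¬ (suc (suc j) ℕ.< D ⊎ suc (suc j) ≡ D)
          case 0<pⱼ (inj₁ lt) = no-interior-zero j (ℕ.≤-pred (ℕ.≤-pred lt)) 0<pⱼ null
          case 0<pⱼ (inj₂ eq) = no-root (subst (λ m → Null (λ n → p m (upper I₀ n))) eq null)

        -- Positivity is an open condition: it passes from λ⁺ to the equal real λ₀ and then to all
        -- late left ends. With m = D this contradicts the invariant that Q fails at left ends,
        -- which is how `root` concludes.
        positive-below : ∀ m → m ℕ.≤ D → ¬ ¬ Eventually (λ n → Positive-upto m (lower I₀ n))
        positive-below zero    _   none = none (0 , λ _ _ → tt)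
        positive-below (suc m) m<D none = positive-below m (ℕ.<⇒≤ m<D) λ ev → all-positive m m<D λ 0<p →
          let δ , 0<δ , ev′ = positive-eventually {pℝ (suc m) λ₀}
                (<0-respʳ {pℝ (suc m) λ⁺} {pℝ (suc m) λ₀} (pℝ-cong (suc m) {λ⁺} {λ₀} (limit⁺≈limit I₀)) 0<p)
          in none (Eventually-× ev (Eventually-map {λ n → δ ≤ seq (pℝ (suc m) λ₀) n} {λ n → 0ℚ < p (suc m) (lower I₀ n)}
               (λ n δ≤ → ℚ.<-≤-trans 0<δ (subst (δ ≤_) (pℝ-seq (suc m) λ₀ n) δ≤)) ev′))

      root : ¬ ¬ Null (λ n → p D (lower I₀ n))
      root none = positive-below no-root D ℕ.≤-refl λ (N , pos) → Interval.¬Q-lo (interval I₀ N) (pos N ℕ.≤-refl)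
        where
        no-root : ¬ Null (λ n → p D (upper I₀ n))
        no-root null = none (null-cong {λ n → p D (upper I₀ n) + - (p D (upper I₀ n) - p D (lower I₀ n))} {λ n → p D (lower I₀ n)} (λ n → cancel (p D (upper I₀ n)) (p D (lower I₀ n)))
          (null-+ {λ n → p D (upper I₀ n)} {λ n → - (p D (upper I₀ n) - p D (lower I₀ n))} null
            (null-neg {λ n → p D (upper I₀ n) - p D (lower I₀ n)} (p-continuous D λ⁺ λ₀ (limit⁺≈limit I₀)))))
          where
          cancel : ∀ a b → a + - (a - b) ≡ b
          cancel = solve-∀ ℚ-acr

      yℝ : ℕ → Vector ℝ k
      yℝ zero    i = 0ℝ
      yℝ (suc m) i = yℝ m i ℝ.+ (pℝ (suc m) λ₀ ℝ.* fromℚ (inv (h (suc m)))) ℝ.* fromℚ (v (suc m) i)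

      yℝ-seq : ∀ m i n → seq (yℝ m i) n ≡ y m (lower I₀ n) i
      yℝ-seq zero    i n = refl
      yℝ-seq (suc m) i n = cong₂ (λ s t → s + t * inv (h (suc m)) * v (suc m) i)
        (yℝ-seq m i n) (pℝ-seq (suc m) λ₀ n)

    -- The eigenvalue equation holds only in the limit, but the normalisation is exact at every
    -- stage, because `y·w` holds for every rational x and not only at a root.
    RationalApproximation : ℝ → Vector ℝ k → Set
    RationalApproximation μ z =
      (∀ i → Null (λ n → (L *ᵥ (λ j → seq (z j) n)) i - seq μ n * seq (z i) n))
      × (∀ n → dot (λ j → seq (z j) n) w ≡ 1ℚ)

    eigenpair : ¬ (w ≋ 𝟎) → ¬ ¬ (∃[ μ ] ∃[ z ] RationalApproximation μ z)
    eigenpair w≢0 none = by-cases breakdown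
      where
      module _ (d : ℕ) (nz : NonDegenerate (suc d)) (v≋0 : v (suc (suc d)) ≋ 𝟎) where
        x : ℕ → ℚ
        x = seq (λ₀ d nz v≋0)
        eigen : Null (λ n → p (suc (suc d)) (x n)) → ∀ i →
          Null (λ n → (L *ᵥ (λ j → seq (yℝ d nz v≋0 (suc d) j) n)) i - x n * seq (yℝ d nz v≋0 (suc d) i) n)
        -- Of the two boundary terms in `L-y`, one carries the factor v (d + 2) = 0, and the other
        -- the factor `P n`, which tends to zero.
        eigen null i = null-cong {λ n → (- (I * v (suc d) i)) * P n} (λ n → sym (begin
          (L *ᵥ (λ j → seq (yℝ d nz v≋0 (suc d) j) n)) i - x n * seq (yℝ d nz v≋0 (suc d) i) n
            ≡⟨ cong₂ (λ s t → s - x n * t) (*ᵥ-cong L (λ j → yℝ-seq d nz v≋0 (suc d) j n) i) (yℝ-seq d nz v≋0 (suc d) i n) ⟩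
          (L *ᵥ y (suc d) (x n)) i - x n * y (suc d) (x n) i
            ≡⟨ cong (_- x n * y (suc d) (x n) i) (L-y (suc d) (x n) nz i) ⟩
          x n * y (suc d) (x n) i + I * (p (suc d) (x n) * v (suc (suc d)) i - P n * v (suc d) i) - x n * y (suc d) (x n) i
            ≡⟨ cong (λ t → x n * y (suc d) (x n) i + I * (p (suc d) (x n) * t - P n * v (suc d) i) - x n * y (suc d) (x n) i) (v≋0 i) ⟩
          x n * y (suc d) (x n) i + I * (p (suc d) (x n) * 0ℚ - P n * v (suc d) i) - x n * y (suc d) (x n) i
            ≡⟨ simplify (x n * y (suc d) (x n) i) I (p (suc d) (x n)) (P n) (v (suc d) i) ⟩
          (- (I * v (suc d) i)) * P n ∎))
          (null-* (- (I * v (suc d) i)) {P} null)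
          where
          open ≡-Reasoning
          I = inv (h (suc d))
          P : ℕ → ℚ
          P n = p (suc (suc d)) (x n)
          simplify : ∀ a I q P v → a + I * (q * 0ℚ - P * v) - a ≡ (- (I * v)) * P
          simplify = solve-∀ ℚ-acr

      by-cases : ¬ (w ≋ 𝟎 ⊎ ∃[ d ] NonDegenerate (suc d) × v (suc (suc d)) ≋ 𝟎)
      by-cases (inj₁ w≋0) = w≢0 w≋0
      by-cases (inj₂ (d , nz , v≋0)) = root d nz v≋0 λ null →
        none (λ₀ d nz v≋0 , yℝ d nz v≋0 (suc d) , eigen d nz v≋0 null , λ n →
          trans (dot-congˡ w (λ i → yℝ-seq d nz v≋0 (suc d) i n)) (y·w d (x d nz v≋0 n) nz))

-- Integral support makes e_v a sum of rational eigenvectors.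

module IntegralSupport where

  open import Data.Integer.Base using (ℤ; +_; -[1+_])
  open import Data.Rational.Base
  open ≡
  open Defs using (_≈_)
  open Rationals
  open Reals
  open RationalVectors
  open RealEigenprojections
  open Eigenpairs
  open LAℚ

  open LinearAlgebraProperties ℝ-rawRing ℝ-isCommutativeRing using () renaming (sum to sumℝ)

  adjℚ : ∀ {k} → Graph k → Matrix k
  adjℚ G a b = if adj G a b then 1ℚ else 0ℚ

  degℚ : ∀ {k} → Graph k → Vector ℚ k
  degℚ G a = sum (adjℚ G a)

  laplacianℚ : ∀ {k} → Graph k → Matrix k
  laplacianℚ G a b = (if does (a Fin.≟ b) then degℚ G a else 0ℚ) - adjℚ G a b

  if-seq : ∀ c (x y : ℝ) n → seq (if c then x else y) n ≡ (if c then seq x n else seq y n)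
  if-seq true  x y n = refl
  if-seq false x y n = refl

  adjacency-seq : ∀ {k} (G : Graph k) a b n → seq (adjacencyMatrix G a b) n ≡ adjℚ G a b
  adjacency-seq G a b n = if-seq (adj G a b) 1ℝ 0ℝ n

  laplacian-seq : ∀ {k} (G : Graph k) a b n → seq (laplacian G a b) n ≡ laplacianℚ G a b
  laplacian-seq G a b n = cong₂ _-_
    (trans (if-seq (does (a Fin.≟ b)) _ 0ℝ n) (cong (λ t → if does (a Fin.≟ b) then t else 0ℚ)
      (trans (sum-seq (adjacencyMatrix G a) n) (sum-cong-≋ (λ c → adjacency-seq G a c n)))))
    (adjacency-seq G a b n)

  laplacianℚ-symmetric : ∀ {k} (G : Graph k) → Symmetric (laplacianℚ G)
  laplacianℚ-symmetric G a b with a Fin.≟ b | b Fin.≟ a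
  ... | yes refl | yes _   = refl
  ... | yes a≡b  | no  b≢a = contradiction (sym a≡b) b≢a
  ... | no  a≢b  | yes b≡a = contradiction (sym b≡a) a≢b
  ... | no  _    | no  _   = cong (λ c → 0ℚ - (if c then 1ℚ else 0ℚ)) (symm G a b)

  null-sum : ∀ {k} (f : Fin k → ℕ → ℚ) → (∀ i → Null (f i)) → Null (λ n → sum (λ i → f i n))
  null-sum {zero}  f h = null-0
  null-sum {suc k} f h = null-+ {f zero} {λ n → sum (λ i → f (suc i) n)} (h zero) (null-sum (f ∘ suc) (h ∘ suc))

  null-dot : ∀ {k} (f : ℕ → Vector ℚ k) (c : Vector ℚ k) → (∀ i → Null (λ n → f n i)) → Null (λ n → dot (f n) c)
  null-dot f c h = null-sum (λ i n → f n i * c i) (λ i →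
    null-cong {λ n → c i * f n i} (λ n → ℚ.*-comm (c i) (f n i)) (null-* (c i) {λ n → f n i} (h i)))

  row⇒sum≈ : ∀ {k} {f : Vector ℝ k} {y} (r : Vector ℚ k) (z : Vector ℝ k) →
    (∀ j n → seq (f j) n ≡ r j * seq (z j) n) → Null (λ n → dot r (λ j → seq (z j) n) - seq y n) → S.sum f ≈ y
  row⇒sum≈ {f = f} {y} r z eq h = null⇒sum≈ {f = f} {y} (null-cong
    {λ n → dot r (λ j → seq (z j) n) - seq y n} {λ n → sum (λ j → seq (f j) n) - seq y n}
    (λ n → cong (_- seq y n) (sum-cong-≋ (λ j → sym (eq j n)))) h)

  sum≈⇒row : ∀ {k} {f : Vector ℝ k} {y} (r : Vector ℚ k) (z : Vector ℝ k) →
    (∀ j n → seq (f j) n ≡ r j * seq (z j) n) → S.sum f ≈ y → Null (λ n → dot r (λ j → seq (z j) n) - seq y n)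
  sum≈⇒row {f = f} {y} r z eq h = null-cong
    {λ n → sum (λ j → seq (f j) n) - seq y n} {λ n → dot r (λ j → seq (z j) n) - seq y n}
    (λ n → cong (_- seq y n) (sum-cong-≋ (λ j → eq j n))) (sum≈⇒null {f = f} {y} h)

  Mℝ-𝐞-seq : ∀ {k} (i j : Fin k) n → seq (Mℝ.𝐞 i j) n ≡ 𝐞 i j
  Mℝ-𝐞-seq i j n with does (i Fin.≟ j)
  ... | true  = refl
  ... | false = refl

  -- The conversions below leave the summands of the matrix products to unification: comparing them
  -- as real numbers would compare their Cauchy moduli.
  approximate⇒support : ∀ {k} (G : Graph k) v λ′ (z : Vector ℝ k) →
    ApproximateEigenvector (laplacianℚ G) λ′ z → ¬ Null (seq (z v)) →
    (∃[ E ] ApproximateProjection (laplacianℚ G) λ′ E) → eigenvalueSupport G v λ′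
  approximate⇒support {k} G v λ′ z eigen zᵥ≢0 (E , image , orthogonal , kernel) =
    (z , (λ i → row⇒sum≈ (laplacianℚ G i) z (λ j n → cong (_* seq (z j) n) (laplacian-seq G i j n)) (eigen i))
       , (λ z≋0 → zᵥ≢0 (≈0⇒null {z v} (z≋0 v)))) ,
    E ,
    ((λ x i → row⇒sum≈ (laplacianℚ G i) (E Mℝ.*ᵥ x)
        (λ j n → cong (_* seq ((E Mℝ.*ᵥ x) j) n) (laplacian-seq G i j n)) (image x i)) ,
     (λ x y Ly≋λy → orthogonal x y (λ i →
        sum≈⇒row (laplacianℚ G i) y (λ j n → cong (_* seq (y j) n) (laplacian-seq G i j n)) (Ly≋λy i)))) ,
    (λ Ee≋0 → zᵥ≢0 (kernel v z eigen (λ j → column j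
       (sum≈⇒row (𝐞 v) (E j) (λ l n → trans (cong (seq (E j l) n *_) (Mℝ-𝐞-seq v l n)) (ℚ.*-comm (seq (E j l) n) (𝐞 v l))) (Ee≋0 j)))))
    where
    column : ∀ j → Null (λ n → dot (𝐞 v) (λ l → seq (E j l) n) - 0ℚ) → Null (seq (E j v))
    column j = null-cong {λ n → dot (𝐞 v) (λ l → seq (E j l) n) - 0ℚ} {seq (E j v)}
      (λ n → trans (ℚ.+-identityʳ (dot (𝐞 v) (λ l → seq (E j l) n))) (dot-𝐞ˡ v (λ l → seq (E j l) n)))

  bounded-cong : ∀ {s t} → (∀ n → s n ≡ t n) → Bounded s → Bounded t
  bounded-cong s≡t (B , 0<B , N , h) = B , 0<B , N , λ n N≤n → subst (λ q → ∣ q ∣ ≤ B) (s≡t n) (h n N≤n)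

  dot-seq-bounded : ∀ {k} (z : Vector ℝ k) (u : Vector ℚ k) → Bounded (λ n → dot (λ i → seq (z i) n) u)
  dot-seq-bounded {k} z u = bounded-cong {seq (sumℝ (λ i → z i ℝ.* fromℚ (u i)))} {λ n → dot (λ i → seq (z i) n) u}
    (λ n → sum-seq (λ i → z i ℝ.* fromℚ (u i)) n) (seq-bounded (sumℝ (λ i → z i ℝ.* fromℚ (u i))))

  ℓ¹ : ∀ {k} → Vector ℚ k → ℚ
  ℓ¹ x = sum (λ i → ∣ x i ∣)

  ∣sum∣≤sum∣∣ : ∀ {k} (f : Vector ℚ k) → ∣ sum f ∣ ≤ ℓ¹ f
  ∣sum∣≤sum∣∣ {zero}  f = ℚ.≤-refl
  ∣sum∣≤sum∣∣ {suc k} f = ℚ.≤-trans (ℚ.∣p+q∣≤∣p∣+∣q∣ (f zero) (sum (f ∘ suc)))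
    (ℚ.+-monoʳ-≤ ∣ f zero ∣ (∣sum∣≤sum∣∣ (f ∘ suc)))

  ℓ¹-matrix : ∀ {k} → Matrix k → ℚ
  ℓ¹-matrix M = sum (λ i → ℓ¹ (M i))

  ∣x∣≤ℓ¹ : ∀ {k} (x : Vector ℚ k) i → ∣ x i ∣ ≤ ℓ¹ x
  ∣x∣≤ℓ¹ x = summand≤sum (λ i → ∣ x i ∣) (λ i → ℚ.0≤∣p∣ (x i))

  ℓ¹-nonNeg : ∀ {k} (x : Vector ℚ k) → 0ℚ ≤ ℓ¹ x
  ℓ¹-nonNeg x = sum-nonNeg (λ i → ∣ x i ∣) (λ i → ℚ.0≤∣p∣ (x i))

  ∣dot∣≤ : ∀ {k} (x y : Vector ℚ k) B → (∀ i → ∣ y i ∣ ≤ B) → ∣ dot x y ∣ ≤ ℓ¹ x * B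
  ∣dot∣≤ x y B y≤B = ℚ.≤-trans (∣sum∣≤sum∣∣ (λ i → x i * y i)) (subst (ℓ¹ (λ i → x i * y i) ≤_)
    (sym (*-distribʳ-sum B (λ i → ∣ x i ∣)))
    (sum-mono (λ i → ∣ x i * y i ∣) (λ i → ∣ x i ∣ * B) (λ i → subst (_≤ ∣ x i ∣ * B) (sym (ℚ.∣p*q∣≡∣p∣*∣q∣ (x i) (y i)))
      (*-monoˡ ∣ x i ∣ (ℚ.0≤∣p∣ (x i)) (y≤B i)))))

  ℓ¹-*ᵥ : ∀ {k} (M : Matrix k) x → ℓ¹ (M *ᵥ x) ≤ ℓ¹-matrix M * ℓ¹ x
  ℓ¹-*ᵥ M x = subst (ℓ¹ (M *ᵥ x) ≤_) (sym (*-distribʳ-sum (ℓ¹ x) (λ i → ℓ¹ (M i))))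
    (sum-mono (λ i → ∣ (M *ᵥ x) i ∣) (λ i → ℓ¹ (M i) * ℓ¹ x) (λ i → ∣dot∣≤ (M i) x (ℓ¹ x) (∣x∣≤ℓ¹ x)))

  module IntegralSpectrum {k} (L : Matrix k) (C : ℕ) where

    -- Integers indexed by naturals: μ 0, ..., μ (2C) run through -C, ..., C, the range that a norm
    -- bound C leaves for an integer eigenvalue.
    μ : ℕ → ℚ
    μ j = ι j - ι C

    shifted : ℕ → Vector ℚ k → Vector ℚ k
    shifted j u = L *ᵥ u -ᵥ μ j · u

    annihilate : ℕ → Vector ℚ k → Vector ℚ k
    annihilate zero    u = u
    annihilate (suc N) u = annihilate N (shifted N u)

    data EigenvectorSum (N : ℕ) (u : Vector ℚ k) : Set where
      nil  : u ≋ 𝟎 → EigenvectorSum N u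
      cons : ∀ j x y → j ℕ.< N → L *ᵥ x ≋ μ j · x → EigenvectorSum N y → u ≋ x +ᵥ y → EigenvectorSum N u

    weaken : ∀ {N u} → EigenvectorSum N u → EigenvectorSum (suc N) u
    weaken (nil u≋0) = nil u≋0
    weaken (cons j x y j<N e s eq) = cons j x y (ℕ.m<n⇒m<1+n j<N) e (weaken s) eq

    shifted-+ : ∀ N x y → shifted N (x +ᵥ y) ≋ shifted N x +ᵥ shifted N y
    shifted-+ N x y i = trans (cong (_- μ N * (x i + y i)) (*ᵥ-+ L x y i))
      (expand ((L *ᵥ x) i) ((L *ᵥ y) i) (μ N) (x i) (y i))
      where
      expand : ∀ a b m x y → a + b - m * (x + y) ≡ (a - m * x) + (b - m * y)
      expand = solve-∀ ℚ-acr

    -- On eigenvectors for μ j with j < N, the operator L − μ N is invertible.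
    solve-shifted : ∀ N u → EigenvectorSum N u → ∃[ y ] EigenvectorSum N y × shifted N y ≋ u
    solve-shifted N u (nil u≋0) = 𝟎 , nil (λ _ → refl) , λ i →
      trans (cong (_- μ N * 0ℚ) (dot-0ʳ (L i))) (trans (vanish (μ N)) (sym (u≋0 i)))
      where
      vanish : ∀ m → 0ℚ - m * 0ℚ ≡ 0ℚ
      vanish = solve-∀ ℚ-acr
    solve-shifted N u (cons j x y j<N Lx≋μx s u≋x+y) =
      let y′ , s′ , eq = solve-shifted N y s in
      c · x +ᵥ y′ , cons j (c · x) y′ j<N eigen s′ (λ _ → refl) , λ i →
        trans (shifted-+ N (c · x) y′ i) (trans (cong₂ _+_ (scaled i) (eq i)) (sym (u≋x+y i)))
      where
      open ≡-Reasoning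
      δ = μ j - μ N
      c = inv δ
      difference : ∀ a b c → (a - c) - (b - c) ≡ a - b
      difference = solve-∀ ℚ-acr
      δ≢0 : δ ≢ 0ℚ
      δ≢0 δ≡0 = ℚ.<-irrefl (trans (sym (difference (ι j) (ι N) (ι C))) δ≡0)
        (ℚ.≰⇒> λ 0≤ → ℕ.<⇒≱ j<N (ι-cancel-≤ (≤-shift (ι j - ι N) 0≤ (back (ι j) (ι N)))))
        where
        back : ∀ a b → a ≡ b + (a - b)
        back = solve-∀ ℚ-acr
      swap : ∀ a b c → a * (b * c) ≡ b * (a * c)
      swap = solve-∀ ℚ-acr
      eigen : L *ᵥ (c · x) ≋ μ j · (c · x)
      eigen i = trans (*ᵥ-· L c x i) (trans (cong (c *_) (Lx≋μx i)) (swap c (μ j) (x i)))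
      factor : ∀ m n c x → m * (c * x) - n * (c * x) ≡ (c * (m - n)) * x
      factor = solve-∀ ℚ-acr
      scaled : shifted N (c · x) ≋ x
      scaled i = begin
        (L *ᵥ (c · x)) i - μ N * (c * x i)    ≡⟨ cong (_- μ N * (c * x i)) (eigen i) ⟩
        μ j * (c * x i) - μ N * (c * x i)     ≡⟨ factor (μ j) (μ N) c (x i) ⟩
        c * δ * x i                           ≡⟨ cong (_* x i) (inv-inverseˡ δ≢0) ⟩
        1ℚ * x i                              ≡⟨ ℚ.*-identityˡ (x i) ⟩
        x i                                   ∎

    -- By induction (L - μ N) u is a sum of eigenvectors for smaller indices. On such sums L - μ N
    -- can be inverted, so (L - μ N) y = (L - μ N) u for some y that is again such a sum, and u - y
    -- is an eigenvector for μ N.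
    annihilated⇒sum : ∀ N u → annihilate N u ≋ 𝟎 → EigenvectorSum N u
    annihilated⇒sum zero    u h = nil h
    annihilated⇒sum (suc N) u h =
      let y , s , eq = solve-shifted N (shifted N u) (annihilated⇒sum N (shifted N u) h)
      in cons N (u -ᵥ y) y ℕ.≤-refl (λ i → eigen y eq i) (weaken s) (λ i → rejoin (u i) (y i))
      where
      rejoin : ∀ a b → a ≡ (a - b) + b
      rejoin = solve-∀ ℚ-acr
      rearrange : ∀ a b m x y → a - b ≡ ((a - m * x) - (b - m * y)) + m * (x - y)
      rearrange = solve-∀ ℚ-acr
      drop : ∀ a b → (a - a) + b ≡ b
      drop = solve-∀ ℚ-acr
      eigen : ∀ y → shifted N y ≋ shifted N u → L *ᵥ (u -ᵥ y) ≋ μ N · (u -ᵥ y)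
      eigen y eq i = trans (*ᵥ-- L u y i) (trans
        (rearrange ((L *ᵥ u) i) ((L *ᵥ y) i) (μ N) (u i) (y i))
        (trans (cong (λ t → (shifted N u i - t) + μ N * (u i - y i)) (eq i))
          (drop (shifted N u i) (μ N * (u i - y i)))))

    module _ (L-symmetric : Symmetric L) (λ′ : ℝ) (z : Vector ℝ k) where
      private
        zₙ : ℕ → Vector ℚ k
        zₙ n i = seq (z i) n

      module _ (residual-null : ∀ i → Null (λ n → (L *ᵥ zₙ n) i - seq λ′ n * zₙ n i)) where

        dot-shifted : ∀ j u n → dot (zₙ n) (shifted j u) ≡
          dot (L *ᵥ zₙ n -ᵥ seq λ′ n · zₙ n) u + (seq λ′ n - μ j) * dot (zₙ n) u
        dot-shifted j u n = begin
          dot (zₙ n) (L *ᵥ u -ᵥ μ j · u)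
            ≡⟨ dot--ʳ (zₙ n) (L *ᵥ u) (μ j · u) ⟩
          dot (zₙ n) (L *ᵥ u) - dot (zₙ n) (μ j · u)
            ≡⟨ cong₂ _-_ (sym (*ᵥ-adjoint L L-symmetric (zₙ n) u)) (dot-·ʳ (zₙ n) (μ j) u) ⟩
          dot (L *ᵥ zₙ n) u - μ j * dot (zₙ n) u
            ≡⟨ rearrange (dot (L *ᵥ zₙ n) u) (seq λ′ n) (μ j) (dot (zₙ n) u) ⟩
          dot (L *ᵥ zₙ n) u - seq λ′ n * dot (zₙ n) u + (seq λ′ n - μ j) * dot (zₙ n) u
            ≡⟨ cong (_+ (seq λ′ n - μ j) * dot (zₙ n) u) (sym (trans (dot--ˡ (L *ᵥ zₙ n) (seq λ′ n · zₙ n) u)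
                 (cong (λ t → dot (L *ᵥ zₙ n) u - t) (dot-·ˡ (seq λ′ n) (zₙ n) u)))) ⟩
          dot (L *ᵥ zₙ n -ᵥ seq λ′ n · zₙ n) u + (seq λ′ n - μ j) * dot (zₙ n) u ∎
          where
          open ≡-Reasoning
          rearrange : ∀ a l m d → a - m * d ≡ a - l * d + (l - m) * d
          rearrange = solve-∀ ℚ-acr

        dot-shifted-null : ∀ j u → Null (λ n → (seq λ′ n - μ j) * dot (zₙ n) u) → Null (λ n → dot (zₙ n) (shifted j u))
        dot-shifted-null j u h = null-cong {λ n → dot (L *ᵥ zₙ n -ᵥ seq λ′ n · zₙ n) u + (seq λ′ n - μ j) * dot (zₙ n) u}
          (λ n → sym (dot-shifted j u n))
          (null-+ {λ n → dot (L *ᵥ zₙ n -ᵥ seq λ′ n · zₙ n) u} {λ n → (seq λ′ n - μ j) * dot (zₙ n) u}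
            (null-dot (λ n → L *ᵥ zₙ n -ᵥ seq λ′ n · zₙ n) u residual-null) h)

        -- An eigenvector orthogonal to u is orthogonal to every polynomial in L applied to u. With
        -- u = e_v it follows that the entry at v of an eigenvector with ⟨z , w⟩ = 1 is nonzero.
        orthogonal-annihilate : ∀ N u → Null (λ n → dot (zₙ n) u) → Null (λ n → dot (zₙ n) (annihilate N u))
        orthogonal-annihilate zero    u h = h
        orthogonal-annihilate (suc N) u h = orthogonal-annihilate N (shifted N u) (dot-shifted-null N u
          (bounded-*-null {λ n → seq λ′ n - μ N} {λ n → dot (zₙ n) u} (seq-bounded (λ′ ℝ.- fromℚ (μ N))) h))

        -- Under the pairing with z the factor L - μ j becomes the scalar λ′ - μ j, up to the
        -- residual; it tends to zero, and the factors applied afterwards preserve orthogonality.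
        eigenvalue-annihilate : ∀ N u j → j ℕ.< N → Null (λ n → seq λ′ n - μ j) → Null (λ n → dot (zₙ n) (annihilate N u))
        eigenvalue-annihilate (suc N) u j j<1+N h = cases (ℕ.m≤n⇒m<n∨m≡n (ℕ.≤-pred j<1+N))
          where
          cases : j ℕ.< N ⊎ j ≡ N → Null (λ n → dot (zₙ n) (annihilate (suc N) u))
          cases (inj₁ j<N)  = eigenvalue-annihilate N (shifted N u) j j<N h
          cases (inj₂ refl) = orthogonal-annihilate N (shifted N u) (dot-shifted-null N u
            (null-cong {λ n → dot (zₙ n) u * (seq λ′ n - μ j)} (λ n → ℚ.*-comm (dot (zₙ n) u) (seq λ′ n - μ j))
              (bounded-*-null {λ n → dot (zₙ n) u} {λ n → seq λ′ n - μ j} (dot-seq-bounded z u) h)))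

        -- The residual r = (L − m) z satisfies |m| ‖z‖ ≤ ‖L z‖ + ‖r‖ in the ℓ¹ norm.
        large⇒null : ℓ¹-matrix L ≤ ι C → ∀ m → Null (λ n → seq λ′ n - m) → ι (suc C) ≤ ∣ m ∣ →
          ∀ i → Null (λ n → zₙ n i)
        large⇒null K≤C m λ′→m C<m i = null-dominated {λ n → zₙ n i} {λ n → ℓ¹ (r n)}
          (0 , λ n _ → ℚ.≤-trans (∣x∣≤ℓ¹ (zₙ n) i) (ℚ.≤-trans (small n) (p≤∣p∣ (ℓ¹ (r n)))))
          (null-sum (λ i n → ∣ r n i ∣) (λ i ε 0<ε → Eventually-map {λ n → ∣ r n i ∣ < ε}
            (λ n → subst (_< ε) (sym (ℚ.∣∣p∣∣≡∣p∣ (r n i)))) (r-null i ε 0<ε)))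
          where
          r : ℕ → Vector ℚ k
          r n = L *ᵥ zₙ n -ᵥ m · zₙ n
          split : ∀ a l m z → (a - l * z) + z * (l - m) ≡ a - m * z
          split = solve-∀ ℚ-acr
          r-null : ∀ i → Null (λ n → r n i)
          r-null i = null-cong {λ n → ((L *ᵥ zₙ n) i - seq λ′ n * zₙ n i) + zₙ n i * (seq λ′ n - m)}
            (λ n → split ((L *ᵥ zₙ n) i) (seq λ′ n) m (zₙ n i))
            (null-+ {λ n → (L *ᵥ zₙ n) i - seq λ′ n * zₙ n i} {λ n → zₙ n i * (seq λ′ n - m)} (residual-null i)
              (bounded-*-null {λ n → zₙ n i} {λ n → seq λ′ n - m} (seq-bounded (z i)) λ′→m))
          small : ∀ n → ℓ¹ (zₙ n) ≤ ℓ¹ (r n)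
          small n = conclude (ℓ¹ (zₙ n)) (ℓ¹-nonNeg (zₙ n)) triangle
            where
            Z = zₙ n
            component : ∀ i → ∣ m ∣ * ∣ Z i ∣ ≤ ∣ (L *ᵥ Z) i ∣ + ∣ r n i ∣
            component i = subst₂ _≤_ (trans (cong ∣_∣ (cancel ((L *ᵥ Z) i) (m * Z i))) (ℚ.∣p*q∣≡∣p∣*∣q∣ m (Z i))) refl
              (ℚ.∣p-q∣≤∣p∣+∣q∣ ((L *ᵥ Z) i) (r n i))
              where
              cancel : ∀ a b → a - (a - b) ≡ b
              cancel = solve-∀ ℚ-acr
            triangle : ∣ m ∣ * ℓ¹ Z ≤ ι C * ℓ¹ Z + ℓ¹ (r n)
            triangle = begin
              ∣ m ∣ * ℓ¹ Z
                ≡⟨ *-distribˡ-sum ∣ m ∣ (λ i → ∣ Z i ∣) ⟩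
              sum (λ i → ∣ m ∣ * ∣ Z i ∣)
                ≤⟨ sum-mono (λ i → ∣ m ∣ * ∣ Z i ∣) (λ i → ∣ (L *ᵥ Z) i ∣ + ∣ r n i ∣) component ⟩
              sum (λ i → ∣ (L *ᵥ Z) i ∣ + ∣ r n i ∣)
                ≡⟨ ∑-distrib-+ (λ i → ∣ (L *ᵥ Z) i ∣) (λ i → ∣ r n i ∣) ⟩
              ℓ¹ (L *ᵥ Z) + ℓ¹ (r n)
                ≤⟨ ℚ.+-monoˡ-≤ (ℓ¹ (r n)) (ℚ.≤-trans (ℓ¹-*ᵥ L Z)
                     (ℚ.*-monoʳ-≤-nonNeg (ℓ¹ Z) {{nonNegative (ℓ¹-nonNeg Z)}} K≤C)) ⟩
              ι C * ℓ¹ Z + ℓ¹ (r n) ∎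
              where open ℚ.≤-Reasoning
            eq : ∀ s m c r → r ≡ s + (((c * s + r) - m * s) + (m - (1ℚ + c)) * s)
            eq = solve-∀ ℚ-acr
            conclude : ∀ s → 0ℚ ≤ s → ∣ m ∣ * s ≤ ι C * s + ℓ¹ (r n) → s ≤ ℓ¹ (r n)
            conclude s 0≤s h = ≤-shift (((ι C * s + ℓ¹ (r n)) - ∣ m ∣ * s) + (∣ m ∣ - (1ℚ + ι C)) * s)
              (+-nonNeg (p≤q⇒0≤q-p h) (*-nonNeg (p≤q⇒0≤q-p C<m) 0≤s)) (eq s ∣ m ∣ (ι C) (ℓ¹ (r n)))

  integer-in-range : ∀ C (m : ℤ) → ∣ m / 1 ∣ < ι (suc C) → ∃[ j ] j ℕ.< suc (C ℕ.+ C) × m / 1 ≡ ι j - ι C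
  integer-in-range C (+ a) lt = a ℕ.+ C , s≤s (ℕ.+-monoˡ-≤ C a≤C) ,
    trans (n/1≡ι a) (trans (add (ι a) (ι C)) (cong (_- ι C) (sym (ι-homo-+ a C))))
    where
    add : ∀ a c → a ≡ (a + c) - c
    add = solve-∀ ℚ-acr
    a≤C : a ℕ.≤ C
    a≤C = ℕ.≮⇒≥ λ C<a → ℚ.<-irrefl refl (ℚ.<-≤-trans lt (subst (ι (suc C) ≤_)
      (sym (trans (cong ∣_∣ (n/1≡ι a)) (ℚ.0≤p⇒∣p∣≡p (ι-nonNeg a)))) (ι-mono C<a)))
  integer-in-range C -[1+ a ] lt = C ℕ.∸ suc a , s≤s (ℕ.≤-trans (ℕ.m∸n≤m C (suc a)) (ℕ.m≤m+n C C)) ,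
    trans (cong -_ (n/1≡ι (suc a))) (sub (ι (suc a)) (ι (C ℕ.∸ suc a)) (ι C)
      (trans (cong ι (sym (ℕ.m+[n∸m]≡n a<C))) (ι-homo-+ (suc a) (C ℕ.∸ suc a))))
    where
    sub : ∀ a b c → c ≡ a + b → - a ≡ b - c
    sub a b c refl = eq a b
      where
      eq : ∀ a b → - a ≡ b - (a + b)
      eq = solve-∀ ℚ-acr
    a<C : suc a ℕ.≤ C
    a<C = ℕ.≮⇒≥ λ C<a → ℚ.<-irrefl refl (ℚ.<-≤-trans lt (subst (ι (suc C) ≤_)
      (sym (trans (ℚ.∣-p∣≡∣p∣ (+ suc a / 1)) (trans (cong ∣_∣ (n/1≡ι (suc a))) (ℚ.0≤p⇒∣p∣≡p (ι-nonNeg (suc a))))))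
      (ι-mono C<a)))

  module _ {k} (G : Graph k) (vertex : Fin k) (integral : eigenvalueSupport G vertex ⊆ IsInteger) where
    private
      L : Matrix k
      L = laplacianℚ G
      -- An integer above the sum of the absolute values of the entries of L, hence above the
      -- modulus of every eigenvalue.
      C : ℕ
      C = proj₁ (archimedean (ℓ¹-matrix L))
      K≤C : ℓ¹-matrix L ≤ ι C
      K≤C = ℚ.<⇒≤ (proj₂ (archimedean (ℓ¹-matrix L)))
      N : ℕ
      N = suc (C ℕ.+ C)
    open IntegralSpectrum L C

    private
      w : Vector ℚ k
      w = annihilate N (𝐞 vertex)
    open Eigenpair L (laplacianℚ-symmetric G) w using (RationalApproximation; eigenpair)

    -- The eigenvalue is an integer m. If |m| < C + 1, then L - m is among the factors that produce
    -- `w`, and ⟨z , w⟩ tends to zero; otherwise |m| exceeds the norm of L, and z itself tends to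
    -- zero. Either contradicts ⟨z , w⟩ = 1. The conclusion being a negation, a doubly negated
    -- projection is enough.
    no-approximation : ∀ λ′ z → ¬ RationalApproximation λ′ z
    no-approximation λ′ z (residual-null , normalised) = real-eigenprojection L λ′ λ projection →
      let m , λ′≈m = integral {λ′} (approximate⇒support G vertex λ′ z residual-null entry-not-null projection)
      in in-range m λ′≈m (∣ m / 1 ∣ ℚ.<? ι (suc C))
      where
      sym-L : Symmetric L
      sym-L = laplacianℚ-symmetric G
      w-not-orthogonal : ¬ Null (λ n → dot (λ i → seq (z i) n) w)
      w-not-orthogonal h = one-not-null (null-cong {λ n → dot (λ i → seq (z i) n) w} normalised h)
        where
        one-not-null : ¬ Null (λ _ → 1ℚ)
        one-not-null h = let N , lt = h 1ℚ 0<1 in ℚ.<-irrefl refl (lt N ℕ.≤-refl)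
      not-null : ¬ (∀ i → Null (λ n → seq (z i) n))
      not-null h = w-not-orthogonal (null-dot (λ n i → seq (z i) n) w h)
      entry-not-null : ¬ Null (seq (z vertex))
      entry-not-null h = w-not-orthogonal (orthogonal-annihilate sym-L λ′ z residual-null N (𝐞 vertex)
        (null-cong {seq (z vertex)} {λ n → dot (λ i → seq (z i) n) (𝐞 vertex)}
          (λ n → sym (trans (dot-comm (λ i → seq (z i) n) (𝐞 vertex)) (dot-𝐞ˡ vertex (λ i → seq (z i) n)))) h))
      in-range : ∀ m → λ′ ≈ ℝ.fromℤ m → ¬ Dec (∣ m / 1 ∣ < ι (suc C))
      in-range m (mk≈ λ′→m) (yes lt) =
        let j , j<N , m≡μⱼ = integer-in-range C m lt
        in w-not-orthogonal (eigenvalue-annihilate sym-L λ′ z residual-null N (𝐞 vertex) j j<N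
             (subst (λ t → Null (λ n → seq λ′ n - t)) m≡μⱼ λ′→m))
      in-range m (mk≈ λ′→m) (no ≮) = not-null
        (large⇒null sym-L λ′ z residual-null K≤C (m / 1) λ′→m (ℚ.≮⇒≥ ≮))

    -- The entries of `w` are rational, so w = 0 can be decided from ⟨w , w⟩. This turns the double
    -- negation of `eigenpair` into a genuine decomposition.
    integral-support⇒sum : ∃[ N ] ∃[ C ] IntegralSpectrum.EigenvectorSum L C N (𝐞 vertex)
    integral-support⇒sum = N , C , annihilated⇒sum N (𝐞 vertex) w≋0
      where
      w≋0 : w ≋ 𝟎
      w≋0 = decide (dot w w ℚ.≟ 0ℚ)
        where
        decide : Dec (dot w w ≡ 0ℚ) → w ≋ 𝟎
        decide (yes eq) = dot-self≡0⇒≋0 w eq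
        decide (no neq) = contradiction (λ (λ′ , z , approx) → no-approximation λ′ z approx)
          (eigenpair (λ w≋0 → neq (trans (dot-congʳ w w≋0) (dot-0ʳ w))))

-- Partial sums of exp, cos and sin over ℚ, with addition formulas up to a tail.

module ExponentialSums where

  open import Data.Rational.Base
  open ≡
  open Rationals
  open Reals
  open RationalVectors using (sumTo; sumTo-cong)

  sumTo-+ : ∀ f g n → sumTo (λ i → f i + g i) n ≡ sumTo f n + sumTo g n
  sumTo-+ f g zero    = refl
  sumTo-+ f g (suc n) = trans (cong (_+ (f n + g n)) (sumTo-+ f g n)) (swap (sumTo f n) (sumTo g n) (f n) (g n))
    where
    swap : ∀ a b c d → (a + b) + (c + d) ≡ (a + c) + (b + d)
    swap = solve-∀ ℚ-acr

  sumTo-* : ∀ c f n → sumTo (λ i → c * f i) n ≡ c * sumTo f n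
  sumTo-* c f zero    = sym (ℚ.*-zeroʳ c)
  sumTo-* c f (suc n) = trans (cong (_+ c * f n) (sumTo-* c f n)) (sym (ℚ.*-distribˡ-+ c (sumTo f n) (f n)))

  sumTo-neg : ∀ f n → sumTo (λ i → - f i) n ≡ - sumTo f n
  sumTo-neg f zero    = refl
  sumTo-neg f (suc n) = trans (cong (_- f n) (sumTo-neg f n)) (sym (ℚ.neg-distrib-+ (sumTo f n) (f n)))

  sumTo-first : ∀ f n → sumTo f (suc n) ≡ f 0 + sumTo (λ i → f (suc i)) n
  sumTo-first f zero    = ℚ.+-comm 0ℚ (f 0)
  sumTo-first f (suc n) = trans (cong (_+ f (suc n)) (sumTo-first f n)) (ℚ.+-assoc (f 0) _ (f (suc n)))

  sumTo-mono : ∀ f g n → (∀ i → i ℕ.< n → f i ≤ g i) → sumTo f n ≤ sumTo g n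
  sumTo-mono f g zero    f≤g = ℚ.≤-refl
  sumTo-mono f g (suc n) f≤g = ℚ.+-mono-≤ {sumTo f n} {sumTo g n} {f n} {g n}
    (sumTo-mono f g n (λ i i<n → f≤g i (ℕ.m<n⇒m<1+n i<n))) (f≤g n ℕ.≤-refl)

  sumTo-difference : ∀ f F → (∀ i → ∣ f i ∣ ≤ F i) → ∀ m j →
    ∣ sumTo f (j ℕ.+ m) - sumTo f m ∣ ≤ sumTo F (j ℕ.+ m) - sumTo F m
  sumTo-difference f F f≤F m zero    = ℚ.≤-reflexive
    (trans (cong ∣_∣ (ℚ.+-inverseʳ (sumTo f m))) (sym (ℚ.+-inverseʳ (sumTo F m))))
  sumTo-difference f F f≤F m (suc j) = subst₂ _≤_
    (cong ∣_∣ (shuffle (sumTo f (j ℕ.+ m)) (sumTo f m) (f (j ℕ.+ m))))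
    (shuffle (sumTo F (j ℕ.+ m)) (sumTo F m) (F (j ℕ.+ m)))
    (ℚ.≤-trans (ℚ.∣p+q∣≤∣p∣+∣q∣ (sumTo f (j ℕ.+ m) - sumTo f m) (f (j ℕ.+ m)))
      (ℚ.+-mono-≤ {∣ sumTo f (j ℕ.+ m) - sumTo f m ∣} {sumTo F (j ℕ.+ m) - sumTo F m} {∣ f (j ℕ.+ m) ∣} {F (j ℕ.+ m)}
        (sumTo-difference f F f≤F m j) (f≤F (j ℕ.+ m))))
    where
    shuffle : ∀ a b c → (a - b) + c ≡ (a + c) - b
    shuffle = solve-∀ ℚ-acr

  sumTo-difference′ : ∀ f F → (∀ i → ∣ f i ∣ ≤ F i) → ∀ {m n} → m ℕ.≤ n →
    ∣ sumTo f n - sumTo f m ∣ ≤ sumTo F n - sumTo F m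
  sumTo-difference′ f F f≤F {m} {n} m≤n =
    subst (λ n → ∣ sumTo f n - sumTo f m ∣ ≤ sumTo F n - sumTo F m) (ℕ.m∸n+n≡m m≤n) (sumTo-difference f F f≤F m (n ℕ.∸ m))

  sumTo-abs : ∀ f F → (∀ i → ∣ f i ∣ ≤ F i) → ∀ n → ∣ sumTo f n ∣ ≤ sumTo F n
  sumTo-abs f F f≤F n = subst₂ _≤_ (cong ∣_∣ (ℚ.+-identityʳ (sumTo f n))) (ℚ.+-identityʳ (sumTo F n))
    (sumTo-difference′ f F f≤F {0} {n} z≤n)

  sumTo-extend : ∀ F → (∀ i → 0ℚ ≤ F i) → ∀ {m n} → m ℕ.≤ n → sumTo F m ≤ sumTo F n
  sumTo-extend F 0≤F {m} {n} m≤n = ≤-shift (sumTo F n - sumTo F m)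
    (ℚ.≤-trans (ℚ.0≤∣p∣ (sumTo F n - sumTo F m))
      (sumTo-difference′ F F (λ i → ℚ.≤-reflexive (ℚ.0≤p⇒∣p∣≡p (0≤F i))) m≤n))
    (back (sumTo F m) (sumTo F n))
    where
    back : ∀ a b → b ≡ a + (b - a)
    back = solve-∀ ℚ-acr

  pow : ℚ → ℕ → ℚ
  pow x zero    = 1ℚ
  pow x (suc k) = x * pow x k

  pow-nonNeg : ∀ x → 0ℚ ≤ x → ∀ k → 0ℚ ≤ pow x k
  pow-nonNeg x 0≤x zero    = 0≤1
  pow-nonNeg x 0≤x (suc k) = *-nonNeg 0≤x (pow-nonNeg x 0≤x k)

  -- expTerm x k = xᵏ / k!
  expTerm : ℚ → ℕ → ℚ
  expTerm x zero    = 1ℚ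
  expTerm x (suc k) = expTerm x k * (x * inv (ι (suc k)))

  0<inv-ι : ∀ k → 0ℚ < inv (ι (suc k))
  0<inv-ι k = inv-pos (ι-suc-pos k)

  expTerm-suc : ∀ x k → ι (suc k) * expTerm x (suc k) ≡ x * expTerm x k
  expTerm-suc x k = trans (shuffle (ι (suc k)) (expTerm x k) x (inv (ι (suc k))))
    (trans (cong (λ u → x * expTerm x k * u) (inv-inverseʳ (pos⇒≢0 (ι-suc-pos k)))) (ℚ.*-identityʳ (x * expTerm x k)))
    where
    shuffle : ∀ n t x i → n * (t * (x * i)) ≡ x * t * (n * i)
    shuffle = solve-∀ ℚ-acr

  expTerm-scale : ∀ c x k → expTerm (c * x) k ≡ pow c k * expTerm x k
  expTerm-scale c x zero    = sym (ℚ.*-identityˡ 1ℚ)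
  expTerm-scale c x (suc k) = trans (cong (_* (c * x * inv (ι (suc k)))) (expTerm-scale c x k))
    (shuffle (pow c k) (expTerm x k) c x (inv (ι (suc k))))
    where
    shuffle : ∀ p t c x i → p * t * (c * x * i) ≡ c * p * (t * (x * i))
    shuffle = solve-∀ ℚ-acr

  expTerm-nonNeg : ∀ R → 0ℚ ≤ R → ∀ k → 0ℚ ≤ expTerm R k
  expTerm-nonNeg R 0≤R zero    = 0≤1
  expTerm-nonNeg R 0≤R (suc k) = *-nonNeg (expTerm-nonNeg R 0≤R k) (*-nonNeg 0≤R (ℚ.<⇒≤ (0<inv-ι k)))

  expTerm-abs : ∀ x R → ∣ x ∣ ≤ R → ∀ k → ∣ expTerm x k ∣ ≤ expTerm R k
  expTerm-abs x R x≤R zero    = ℚ.≤-refl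
  expTerm-abs x R x≤R (suc k) = subst (_≤ expTerm R (suc k))
    (sym (trans (ℚ.∣p*q∣≡∣p∣*∣q∣ (expTerm x k) (x * inv (ι (suc k)))) (cong (∣ expTerm x k ∣ *_)
      (trans (ℚ.∣p*q∣≡∣p∣*∣q∣ x (inv (ι (suc k)))) (cong (∣ x ∣ *_) (ℚ.0≤p⇒∣p∣≡p (ℚ.<⇒≤ (0<inv-ι k))))))))
    (*-mono-≤ (ℚ.0≤∣p∣ (expTerm x k)) (expTerm-abs x R x≤R k) (*-nonNeg (ℚ.0≤∣p∣ x) (ℚ.<⇒≤ (0<inv-ι k)))
      (ℚ.*-monoʳ-≤-nonNeg (inv (ι (suc k))) {{nonNegative (ℚ.<⇒≤ (0<inv-ι k))}} x≤R))

  module _ (R : ℚ) (0≤R : 0ℚ ≤ R) where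
    private
      S : ℕ → ℚ
      S = sumTo (expTerm R)
      T : ℕ → ℚ
      T = expTerm R
      arch = archimedean (R + R)
      K : ℕ
      K = proj₁ arch

      -- Consecutive terms have ratio R/(k + 1), which is at most 1/2 because K > 2R.
      halving : ∀ k → K ℕ.≤ k → T (suc k) + T (suc k) ≤ T k
      halving k K≤k = ≤-shift (T k * (inv n * (n - (R + R)))) (*-nonNeg (expTerm-nonNeg R 0≤R k)
          (*-nonNeg (ℚ.<⇒≤ (0<inv-ι k)) (p≤q⇒0≤q-p (ℚ.<⇒≤ (ℚ.<-≤-trans (proj₂ arch) (ι-mono (ℕ.m≤n⇒m≤1+n K≤k)))))))
        (sym (trans (regroup (T k) R (inv n) n) (trans (cong (T k *_) (inv-inverseˡ (pos⇒≢0 (ι-suc-pos k)))) (ℚ.*-identityʳ (T k)))))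
        where
        n = ι (suc k)
        regroup : ∀ t r i n → (t * (r * i) + t * (r * i)) + t * (i * (n - (r + r))) ≡ t * (i * n)
        regroup = solve-∀ ℚ-acr

      decreasing : ∀ j → T (j ℕ.+ K) ≤ T K
      decreasing zero    = ℚ.≤-refl
      decreasing (suc j) = ℚ.≤-trans (ℚ.≤-trans
        (≤-shift (T (suc j ℕ.+ K)) (expTerm-nonNeg R 0≤R (suc j ℕ.+ K)) refl)
        (halving (j ℕ.+ K) (ℕ.m≤n+m K j))) (decreasing j)

      -- By `halving`, S m + 2 T m does not increase for m ≥ K. Keeping the last 2 T on the left is
      -- what makes the induction close.
      tail-bound : ∀ N → K ℕ.≤ N → ∀ j → S (j ℕ.+ N) - S N + (T (j ℕ.+ N) + T (j ℕ.+ N)) ≤ T N + T N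
      tail-bound N K≤N zero    = ℚ.≤-reflexive (cancel (S N) (T N))
        where
        cancel : ∀ s t → s - s + (t + t) ≡ t + t
        cancel = solve-∀ ℚ-acr
      tail-bound N K≤N (suc j) = ℚ.≤-trans
        (≤-shift (T m - (T (suc m) + T (suc m))) (p≤q⇒0≤q-p (halving m (ℕ.≤-trans K≤N (ℕ.m≤n+m N j))))
          (regroup (S m) (S N) (T m) (T (suc m) + T (suc m))))
        (tail-bound N K≤N j)
        where
        m = j ℕ.+ N
        regroup : ∀ s s′ t u → s - s′ + (t + t) ≡ (s + t) - s′ + u + (t - u)
        regroup = solve-∀ ℚ-acr

      -- For m > K one has m T m = R T (m - 1) ≤ R T K. Thus the bound 2 T m for the tail is O(1/m),
      -- the form required by `harmonic-null`.
      harmonic : ∀ j → ι (suc j ℕ.+ K) * (T (suc j ℕ.+ K) + T (suc j ℕ.+ K)) ≤ (R + R) * T K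
      harmonic j = subst (_≤ (R + R) * T K)
        (sym (trans (double (ι (suc (j ℕ.+ K))) (T (suc (j ℕ.+ K)))) (trans (cong (λ u → u + u) (expTerm-suc R (j ℕ.+ K))) (collect R (T (j ℕ.+ K))))))
        (*-monoˡ (R + R) (+-nonNeg 0≤R 0≤R) (decreasing j))
        where
        double : ∀ n t → n * (t + t) ≡ n * t + n * t
        double = solve-∀ ℚ-acr
        collect : ∀ r t → r * t + r * t ≡ (r + r) * t
        collect = solve-∀ ℚ-acr

    exp-tail : ∀ ε → 0ℚ < ε → Eventually (λ N → ∀ M → N ℕ.≤ M → S M - S N < ε)
    exp-tail ε 0<ε =
      let N₀ , small = harmonic-null ((R + R) * T K) ε 0<ε in
      N₀ ℕ.⊔ suc K , λ N N₀⊔K≤N M N≤M →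
        let K<N = ℕ.m⊔n≤o⇒n≤o N₀ (suc K) N₀⊔K≤N in
        ℚ.≤-<-trans (bound N M (ℕ.<⇒≤ K<N) N≤M) (small N (ℕ.m⊔n≤o⇒m≤o N₀ (suc K) N₀⊔K≤N) (T N + T N)
          (subst (λ n → ι n * (T n + T n) ≤ (R + R) * T K) (trans (sym (ℕ.+-suc (N ℕ.∸ suc K) K)) (ℕ.m∸n+n≡m K<N)) (harmonic (N ℕ.∸ suc K))))
      where
      bound : ∀ N M → K ℕ.≤ N → N ℕ.≤ M → S M - S N ≤ T N + T N
      bound N M K≤N N≤M = subst (λ M → S M - S N ≤ T N + T N) (ℕ.m∸n+n≡m N≤M)
        (ℚ.≤-trans (≤-shift (T m + T m) (+-nonNeg (expTerm-nonNeg R 0≤R m) (expTerm-nonNeg R 0≤R m)) refl)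
          (tail-bound N K≤N (M ℕ.∸ N)))
        where m = (M ℕ.∸ N) ℕ.+ N

    exp-bounded : Bounded S
    exp-bounded =
      let N , small = exp-tail 1ℚ 0<1
          0≤SN = sumTo-extend T (expTerm-nonNeg R 0≤R) {0} {N} z≤n
      in S N + 1ℚ , ℚ.+-mono-≤-< {0ℚ} {S N} {0ℚ} {1ℚ} 0≤SN 0<1 , N , λ n N≤n →
        subst (_≤ S N + 1ℚ) (sym (ℚ.0≤p⇒∣p∣≡p (sumTo-extend T (expTerm-nonNeg R 0≤R) {0} {n} z≤n)))
          (≤-shift (1ℚ - (S n - S N)) (p≤q⇒0≤q-p (ℚ.<⇒≤ (small N ℕ.≤-refl n N≤n))) (back (S N) (S n)))
      where
      back : ∀ a b → a + 1ℚ ≡ b + (1ℚ - (b - a))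
      back = solve-∀ ℚ-acr

  square triangle : (ℕ → ℕ → ℚ) → ℕ → ℚ
  square   f n = sumTo (λ i → sumTo (f i) n) n
  triangle f n = sumTo (λ i → sumTo (f i) (n ℕ.∸ i)) n

  convolution : (ℕ → ℕ → ℚ) → ℕ → ℚ
  convolution f k = sumTo (λ i → f i (k ℕ.∸ i)) (suc k)

  triangle≡sum-convolution : ∀ f n → triangle f n ≡ sumTo (convolution f) n
  triangle≡sum-convolution f zero    = refl
  triangle≡sum-convolution f (suc n) = begin
    sumTo (λ i → sumTo (f i) (suc n ℕ.∸ i)) n + sumTo (f n) (suc n ℕ.∸ n)
      ≡⟨ cong₂ _+_ (trans (sumTo-cong n (λ i i<n → cong (sumTo (f i)) (ℕ.+-∸-assoc 1 (ℕ.<⇒≤ i<n))))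
                     (sumTo-+ (λ i → sumTo (f i) (n ℕ.∸ i)) (λ i → f i (n ℕ.∸ i)) n))
                   (trans (cong (sumTo (f n)) (ℕ.m+n∸n≡m 1 n)) (trans (ℚ.+-identityˡ (f n 0)) (cong (f n) (sym (ℕ.n∸n≡0 n))))) ⟩
    (triangle f n + sumTo (λ i → f i (n ℕ.∸ i)) n) + f n (n ℕ.∸ n)
      ≡⟨ ℚ.+-assoc (triangle f n) _ _ ⟩
    triangle f n + convolution f n
      ≡⟨ cong (_+ convolution f n) (triangle≡sum-convolution f n) ⟩
    sumTo (convolution f) n + convolution f n ∎
    where open ≡-Reasoning

  square-product : ∀ f g n → sumTo f n * sumTo g n ≡ square (λ i j → f i * g j) n
  square-product f g n = trans (ℚ.*-comm (sumTo f n) (sumTo g n)) (trans (sym (sumTo-* (sumTo g n) f n))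
    (sumTo-cong n (λ i _ → trans (ℚ.*-comm (sumTo g n) (f i)) (sym (sumTo-* (f i) g n)))))

  -- |square − triangle| is dominated by the same difference for a majorant F, which in turn is
  -- at most the difference of the triangles of sizes 2n and n.
  square-triangle : ∀ f F → (∀ i j → ∣ f i j ∣ ≤ F i j) → ∀ n →
    ∣ square f n - triangle f n ∣ ≤ triangle F (n ℕ.+ n) - triangle F n
  square-triangle f F f≤F n = ℚ.≤-trans rowwise (ℚ.+-monoˡ-≤ (- triangle F n) enlarge)
    where
    0≤F : ∀ i j → 0ℚ ≤ F i j
    0≤F i j = ℚ.≤-trans (ℚ.0≤∣p∣ (f i j)) (f≤F i j)
    as-difference : ∀ f → square f n - triangle f n ≡ sumTo (λ i → sumTo (f i) n - sumTo (f i) (n ℕ.∸ i)) n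
    as-difference f = trans (cong (square f n +_) (sym (sumTo-neg (λ i → sumTo (f i) (n ℕ.∸ i)) n)))
      (sym (sumTo-+ (λ i → sumTo (f i) n) (λ i → - sumTo (f i) (n ℕ.∸ i)) n))
    rowwise : ∣ square f n - triangle f n ∣ ≤ square F n - triangle F n
    rowwise = subst₂ _≤_ (cong ∣_∣ (sym (as-difference f))) (sym (as-difference F))
      (sumTo-abs _ (λ i → sumTo (F i) n - sumTo (F i) (n ℕ.∸ i))
        (λ i → sumTo-difference′ (f i) (F i) (f≤F i) (ℕ.m∸n≤m n i)) n)
    enlarge : square F n ≤ triangle F (n ℕ.+ n)
    enlarge = ℚ.≤-trans
      (sumTo-mono _ _ n (λ i i<n → sumTo-extend (F i) (0≤F i)
        (subst (n ℕ.≤_) (sym (ℕ.+-∸-assoc n (ℕ.<⇒≤ i<n))) (ℕ.m≤m+n n (n ℕ.∸ i)))))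
      (sumTo-extend (λ i → sumTo (F i) (n ℕ.+ n ℕ.∸ i)) (λ i → sumTo-extend (F i) (0≤F i) {0} {n ℕ.+ n ℕ.∸ i} z≤n) (ℕ.m≤m+n n n))

  -- The binomial theorem divided by k!, without binomial coefficients: the factor k + 1 is split as
  -- i + (k + 1 - i) in each summand, and `expTerm-suc` turns the two halves into x and y times the
  -- convolution of order k.
  expTerm-convolution : ∀ x y k → convolution (λ i j → expTerm x i * expTerm y j) k ≡ expTerm (x + y) k
  expTerm-convolution x y zero    = refl
  expTerm-convolution x y (suc k) = begin
    c (suc k)                                     ≡⟨ sym (ℚ.*-identityˡ (c (suc k))) ⟩
    1ℚ * c (suc k)                                ≡⟨ cong (_* c (suc k)) (sym (inv-inverseˡ (pos⇒≢0 (ι-suc-pos k)))) ⟩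
    inv n * n * c (suc k)                         ≡⟨ ℚ.*-assoc (inv n) n (c (suc k)) ⟩
    inv n * (n * c (suc k))                       ≡⟨ cong (inv n *_) step ⟩
    inv n * ((x + y) * c k)                       ≡⟨ cong (λ t → inv n * ((x + y) * t)) (expTerm-convolution x y k) ⟩
    inv n * ((x + y) * expTerm (x + y) k)         ≡⟨ shuffle (inv n) (x + y) (expTerm (x + y) k) ⟩
    expTerm (x + y) k * ((x + y) * inv n)         ∎
    where
    open ≡-Reasoning
    n = ι (suc k)
    c : ℕ → ℚ
    c = convolution (λ i j → expTerm x i * expTerm y j)
    shuffle : ∀ i s t → i * (s * t) ≡ t * (s * i)
    shuffle = solve-∀ ℚ-acr
    X Y : ℕ → ℚ
    X = expTerm x
    Y = expTerm y
    A B : ℕ → ℚ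
    A i = ι i * X i * Y (suc k ℕ.∸ i)
    B i = X i * (ι (suc k ℕ.∸ i) * Y (suc k ℕ.∸ i))
    sum-A : sumTo A (suc (suc k)) ≡ x * c k
    sum-A = trans (sumTo-first A (suc k)) (trans (cong₂ _+_ (vanish (X 0) (Y (suc k)))
        (trans (sumTo-cong (suc k) (λ i _ → trans (cong (_* Y (k ℕ.∸ i)) (expTerm-suc x i)) (ℚ.*-assoc x (X i) (Y (k ℕ.∸ i)))))
          (sumTo-* x (λ i → X i * Y (k ℕ.∸ i)) (suc k)))) (ℚ.+-identityˡ (x * c k)))
      where
      vanish : ∀ a b → 0ℚ * a * b ≡ 0ℚ
      vanish = solve-∀ ℚ-acr
    sum-B : sumTo B (suc (suc k)) ≡ y * c k
    sum-B = trans (cong₂ _+_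
        (trans (sumTo-cong (suc k) (λ i i<1+k → trans
            (cong (λ m → X i * (ι m * Y m)) (ℕ.+-∸-assoc 1 (ℕ.≤-pred i<1+k)))
            (trans (cong (X i *_) (expTerm-suc y (k ℕ.∸ i))) (swap (X i) y (Y (k ℕ.∸ i))))))
          (sumTo-* y (λ i → X i * Y (k ℕ.∸ i)) (suc k)))
        (trans (cong (λ m → X (suc k) * (ι m * Y m)) (ℕ.n∸n≡0 k)) (vanish (X (suc k)) (Y 0))))
      (ℚ.+-identityʳ (y * c k))
      where
      vanish : ∀ a b → a * (0ℚ * b) ≡ 0ℚ
      vanish = solve-∀ ℚ-acr
      swap : ∀ a b c → a * (b * c) ≡ b * (a * c)
      swap = solve-∀ ℚ-acr
    split : ∀ i → i ℕ.< suc (suc k) → n * (X i * Y (suc k ℕ.∸ i)) ≡ A i + B i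
    split i i<2+k = trans (cong (_* (X i * Y (suc k ℕ.∸ i)))
        (trans (cong ι (sym (ℕ.m+[n∸m]≡n (ℕ.≤-pred i<2+k)))) (ι-homo-+ i (suc k ℕ.∸ i))))
      (expand (ι i) (ι (suc k ℕ.∸ i)) (X i) (Y (suc k ℕ.∸ i)))
      where
      expand : ∀ a b s t → (a + b) * (s * t) ≡ a * s * t + s * (b * t)
      expand = solve-∀ ℚ-acr
    step : n * c (suc k) ≡ (x + y) * c k
    step = begin
      n * c (suc k)                                        ≡⟨ sym (sumTo-* n (λ i → X i * Y (suc k ℕ.∸ i)) (suc (suc k))) ⟩
      sumTo (λ i → n * (X i * Y (suc k ℕ.∸ i))) (suc (suc k)) ≡⟨ sumTo-cong (suc (suc k)) split ⟩
      sumTo (λ i → A i + B i) (suc (suc k))                ≡⟨ sumTo-+ A B (suc (suc k)) ⟩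
      sumTo A (suc (suc k)) + sumTo B (suc (suc k))        ≡⟨ cong₂ _+_ sum-A sum-B ⟩
      x * c k + y * c k                                    ≡⟨ sym (ℚ.*-distribʳ-+ (c k) x y) ⟩
      (x + y) * c k                                        ∎

  -- iᵏ = κ k + σ k · i
  κ σ : ℕ → ℚ
  κ zero    = 1ℚ
  κ (suc k) = - σ k
  σ zero    = 0ℚ
  σ (suc k) = κ k

  κσ-+ : ∀ i j → κ (i ℕ.+ j) ≡ κ i * κ j - σ i * σ j × σ (i ℕ.+ j) ≡ σ i * κ j + κ i * σ j
  κσ-+ zero    j = one₁ (κ j) (σ j) , one₂ (κ j) (σ j)
    where
    one₁ : ∀ a b → a ≡ 1ℚ * a - 0ℚ * b
    one₁ = solve-∀ ℚ-acr
    one₂ : ∀ a b → b ≡ 0ℚ * a + 1ℚ * b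
    one₂ = solve-∀ ℚ-acr
  κσ-+ (suc i) j = let p , q = κσ-+ i j in
    trans (cong -_ q) (flip₁ (σ i) (κ j) (κ i) (σ j)) , trans p (flip₂ (σ i) (κ j) (κ i) (σ j))
    where
    flip₁ : ∀ s k k′ s′ → - (s * k + k′ * s′) ≡ - s * k - k′ * s′
    flip₁ = solve-∀ ℚ-acr
    flip₂ : ∀ s k k′ s′ → k′ * k - s * s′ ≡ k′ * k + - s * s′
    flip₂ = solve-∀ ℚ-acr

  κσ-abs : ∀ k → ∣ κ k ∣ ≤ 1ℚ × ∣ σ k ∣ ≤ 1ℚ
  κσ-abs zero    = ℚ.≤-refl , 0≤1
  κσ-abs (suc k) = let p , q = κσ-abs k in subst (_≤ 1ℚ) (sym (ℚ.∣-p∣≡∣p∣ (σ k))) q , p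

  -- Both run over all k, with zero coefficients at odd and at even k respectively. As real and
  -- imaginary part of one partial sum of exp (ix), they share the addition formula and the tail
  -- bound.
  cosSum sinSum : ℚ → ℕ → ℚ
  cosSum x = sumTo (λ k → κ k * expTerm x k)
  sinSum x = sumTo (λ k → σ k * expTerm x k)

  signed-abs : ∀ s x R → ∣ s ∣ ≤ 1ℚ → ∣ x ∣ ≤ R → ∣ s * x ∣ ≤ R
  signed-abs s x R s≤1 x≤R = subst₂ _≤_ (sym (ℚ.∣p*q∣≡∣p∣*∣q∣ s x)) (ℚ.*-identityˡ R)
    (*-mono-≤ (ℚ.0≤∣p∣ s) s≤1 (ℚ.0≤∣p∣ x) x≤R)

  convolution-signed : ∀ (s : ℕ → ℚ) x y k →
    convolution (λ i j → s (i ℕ.+ j) * (expTerm x i * expTerm y j)) k ≡ s k * expTerm (x + y) k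
  convolution-signed s x y k = trans
    (sumTo-cong (suc k) (λ i i<1+k → cong (λ m → s m * (expTerm x i * expTerm y (k ℕ.∸ i))) (ℕ.m+[n∸m]≡n (ℕ.≤-pred i<1+k))))
    (trans (sumTo-* (s k) (λ i → expTerm x i * expTerm y (k ℕ.∸ i)) (suc k)) (cong (s k *_) (expTerm-convolution x y k)))

  module _ (x y X Y : ℚ) (x≤X : ∣ x ∣ ≤ X) (y≤Y : ∣ y ∣ ≤ Y) (n : ℕ) where
    private
      tail : ℚ
      tail = sumTo (expTerm (X + Y)) (n ℕ.+ n) - sumTo (expTerm (X + Y)) n

      -- A product of two partial sums is a sum over a square of indices, and the partial sum for x
      -- + y is a sum over a triangle. By `square-triangle` the difference is at most the sum of the
      -- terms n, ..., 2n - 1 of the series of exp (X + Y).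
      signed-addition : ∀ (s : ℕ → ℚ) → (∀ k → ∣ s k ∣ ≤ 1ℚ) →
        ∣ square (λ i j → s (i ℕ.+ j) * (expTerm x i * expTerm y j)) n - sumTo (λ k → s k * expTerm (x + y) k) n ∣ ≤ tail
      signed-addition s s≤1 = subst₂ (λ u v → ∣ square f n - u ∣ ≤ v)
        (trans (triangle≡sum-convolution f n) (sumTo-cong n (λ k _ → convolution-signed s x y k)))
        (cong₂ _-_ (total (n ℕ.+ n)) (total n))
        (square-triangle f F f≤F n)
        where
        f F : ℕ → ℕ → ℚ
        f i j = s (i ℕ.+ j) * (expTerm x i * expTerm y j)
        F i j = expTerm X i * expTerm Y j
        f≤F : ∀ i j → ∣ f i j ∣ ≤ F i j
        f≤F i j = signed-abs (s (i ℕ.+ j)) (expTerm x i * expTerm y j) (F i j) (s≤1 (i ℕ.+ j))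
          (subst (_≤ F i j) (sym (ℚ.∣p*q∣≡∣p∣*∣q∣ (expTerm x i) (expTerm y j)))
            (*-mono-≤ (ℚ.0≤∣p∣ (expTerm x i)) (expTerm-abs x X x≤X i) (ℚ.0≤∣p∣ (expTerm y j)) (expTerm-abs y Y y≤Y j)))
        total : ∀ m → triangle F m ≡ sumTo (expTerm (X + Y)) m
        total m = trans (triangle≡sum-convolution F m) (sumTo-cong m (λ k _ → expTerm-convolution X Y k))

      square-combine : ∀ (f g h : ℕ → ℕ → ℚ) → (∀ i j → f i j + g i j ≡ h i j) → square f n + square g n ≡ square h n
      square-combine f g h eq = trans (sym (sumTo-+ (λ i → sumTo (f i) n) (λ i → sumTo (g i) n) n))
        (sumTo-cong n (λ i _ → trans (sym (sumTo-+ (f i) (g i) n)) (sumTo-cong n (λ j _ → eq i j))))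

      square-neg : ∀ (f : ℕ → ℕ → ℚ) → - square f n ≡ square (λ i j → - f i j) n
      square-neg f = sym (trans (sumTo-cong n (λ i _ → sumTo-neg (f i) n)) (sumTo-neg (λ i → sumTo (f i) n) n))

    cos-addition : ∣ (cosSum x n * cosSum y n - sinSum x n * sinSum y n) - cosSum (x + y) n ∣ ≤ tail
    cos-addition = subst (λ u → ∣ u - cosSum (x + y) n ∣ ≤ tail)
      (sym (trans (cong₂ _-_ (square-product (λ i → κ i * expTerm x i) (λ j → κ j * expTerm y j) n)
                    (square-product (λ i → σ i * expTerm x i) (λ j → σ j * expTerm y j) n))
        (trans (cong (square (λ i j → κ i * expTerm x i * (κ j * expTerm y j)) n +_) (square-neg _))
          (square-combine _ _ _ (λ i j → trans (regroup (κ i) (expTerm x i) (κ j) (expTerm y j) (σ i) (σ j))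
            (cong (_* (expTerm x i * expTerm y j)) (sym (proj₁ (κσ-+ i j)))))))))
      (signed-addition κ (λ k → proj₁ (κσ-abs k)))
      where
      regroup : ∀ k t k′ t′ s s′ → k * t * (k′ * t′) + - (s * t * (s′ * t′)) ≡ (k * k′ - s * s′) * (t * t′)
      regroup = solve-∀ ℚ-acr

    sin-addition : ∣ (sinSum x n * cosSum y n + cosSum x n * sinSum y n) - sinSum (x + y) n ∣ ≤ tail
    sin-addition = subst (λ u → ∣ u - sinSum (x + y) n ∣ ≤ tail)
      (sym (trans (cong₂ _+_ (square-product (λ i → σ i * expTerm x i) (λ j → κ j * expTerm y j) n)
                    (square-product (λ i → κ i * expTerm x i) (λ j → σ j * expTerm y j) n))
        (square-combine _ _ _ (λ i j → trans (regroup (σ i) (expTerm x i) (κ j) (expTerm y j) (κ i) (σ j))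
          (cong (_* (expTerm x i * expTerm y j)) (sym (proj₂ (κσ-+ i j))))))))
      (signed-addition σ (λ k → proj₂ (κσ-abs k)))
      where
      regroup : ∀ s t k t′ k′ s′ → s * t * (k * t′) + k′ * t * (s′ * t′) ≡ (s * k + k′ * s′) * (t * t′)
      regroup = solve-∀ ℚ-acr

  cosSum-neg : ∀ x n → cosSum (- x) n ≡ cosSum x n
  sinSum-neg : ∀ x n → sinSum (- x) n ≡ - sinSum x n

  private
    sign : ℕ → ℚ
    sign = pow (- 1ℚ)

    expTerm-neg : ∀ x k → expTerm (- x) k ≡ sign k * expTerm x k
    expTerm-neg x k = trans (cong (λ y → expTerm y k) (minus x)) (expTerm-scale (- 1ℚ) x k)
      where
      minus : ∀ x → - x ≡ - 1ℚ * x
      minus = solve-∀ ℚ-acr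

    κσ-sign : ∀ k → κ k * sign k ≡ κ k × σ k * sign k ≡ - σ k
    κσ-sign zero    = refl , refl
    κσ-sign (suc k) = let p , q = κσ-sign k in
      trans (twice (σ k) (sign k)) q , trans (once (κ k) (sign k)) (cong -_ p)
      where
      twice : ∀ s e → - s * (- 1ℚ * e) ≡ s * e
      twice = solve-∀ ℚ-acr
      once : ∀ s e → s * (- 1ℚ * e) ≡ - (s * e)
      once = solve-∀ ℚ-acr

  cosSum-neg x n = sumTo-cong n (λ k _ → trans (cong (κ k *_) (expTerm-neg x k))
    (trans (sym (ℚ.*-assoc (κ k) (sign k) (expTerm x k))) (cong (_* expTerm x k) (proj₁ (κσ-sign k)))))
  sinSum-neg x n = trans (sumTo-cong n (λ k _ → trans (cong (σ k *_) (expTerm-neg x k))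
      (trans (sym (ℚ.*-assoc (σ k) (sign k) (expTerm x k))) (trans (cong (_* expTerm x k) (proj₂ (κσ-sign k)))
        (sym (ℚ.neg-distribˡ-* (σ k) (expTerm x k)))))))
    (sumTo-neg (λ k → σ k * expTerm x k) n)

-- Limits, summation of dominated series, and the values of exp (iqτ).

module Convergence where

  import Data.Integer.Base as ℤ
  open import Data.Nat.Base using (_!)
  open import Data.Rational.Base
  open ≡
  open Defs using (1/_!)
  open Rationals
  open Reals
  open RationalVectors using (sumTo; sumTo-cong)
  open ExponentialSums

  Lim : (ℕ → ℚ) → ℚ → Set
  Lim s c = Null (λ n → s n - c)

  lim-cong : ∀ {s t c} → (∀ n → s n ≡ t n) → Lim s c → Lim t c
  lim-cong {s} {t} {c} s≡t = null-cong {λ n → s n - c} {λ n → t n - c} (λ n → cong (_- c) (s≡t n))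

  lim-approx : ∀ {s t c} → Null (λ n → s n - t n) → Lim s c → Lim t c
  lim-approx {s} {t} {c} s~t s→c = null-cong {λ n → - (s n - t n) + (s n - c)} {λ n → t n - c}
    (λ n → cancel (s n) (t n) c)
    (null-+ {λ n → - (s n - t n)} {λ n → s n - c} (null-neg {λ n → s n - t n} s~t) s→c)
    where
    cancel : ∀ s t c → - (s - t) + (s - c) ≡ t - c
    cancel = solve-∀ ℚ-acr

  lim-+ : ∀ {s t c d} → Lim s c → Lim t d → Lim (λ n → s n + t n) (c + d)
  lim-+ {s} {t} {c} {d} p q = null-cong {λ n → (s n - c) + (t n - d)} {λ n → (s n + t n) - (c + d)}
    (λ n → regroup (s n) (t n) c d) (null-+ {λ n → s n - c} {λ n → t n - d} p q)
    where
    regroup : ∀ s t c d → (s - c) + (t - d) ≡ (s + t) - (c + d)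
    regroup = solve-∀ ℚ-acr

  lim-neg : ∀ {s c} → Lim s c → Lim (λ n → - s n) (- c)
  lim-neg {s} {c} p = null-cong {λ n → - (s n - c)} {λ n → - s n - (- c)} (λ n → regroup (s n) c) (null-neg {λ n → s n - c} p)
    where
    regroup : ∀ s c → - (s - c) ≡ - s - (- c)
    regroup = solve-∀ ℚ-acr

  lim-* : ∀ {s t c d} → Bounded s → Lim s c → Lim t d → Lim (λ n → s n * t n) (c * d)
  lim-* {s} {t} {c} {d} b p q = null-cong {λ n → s n * (t n - d) + d * (s n - c)} {λ n → s n * t n - c * d}
    (λ n → regroup (s n) (t n) c d)
    (null-+ {λ n → s n * (t n - d)} {λ n → d * (s n - c)} (bounded-*-null {s} {λ n → t n - d} b q) (null-* d {λ n → s n - c} p))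
    where
    regroup : ∀ s t c d → s * (t - d) + d * (s - c) ≡ s * t - c * d
    regroup = solve-∀ ℚ-acr

  lim-const : ∀ c → Lim (λ _ → c) c
  lim-const c = null-cong {λ _ → 0ℚ} {λ _ → c - c} (λ _ → sym (ℚ.+-inverseʳ c)) null-0

  partialSum-seq : ∀ (s : ℕ → ℝ) n p → seq (partialSum s n) p ≡ sumTo (λ k → seq (s k) p) n
  partialSum-seq s zero    p = refl
  partialSum-seq s (suc n) p = cong (_+ seq (s n) p) (partialSum-seq s n p)

  -- A series of reals with an eventual exponential majorant, summed along the diagonal: the p-th
  -- approximant of the sum adds p terms, each approximated to stage p.
  module Diagonal (s : ℕ → ℝ) (R : ℚ) (0≤R : 0ℚ ≤ R) (N₀ : ℕ)
    (dominated : ∀ p → N₀ ℕ.≤ p → ∀ k → ∣ seq (s k) p ∣ ≤ expTerm R k) where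

    private
      f : ℕ → ℕ → ℚ
      f n p = seq (partialSum s n) p

      tail : ∀ {m n} p → N₀ ℕ.≤ p → m ℕ.≤ n → ∣ f n p - f m p ∣ ≤ sumTo (expTerm R) n - sumTo (expTerm R) m
      tail {m} {n} p N₀≤p m≤n = subst₂ (λ u v → ∣ u - v ∣ ≤ sumTo (expTerm R) n - sumTo (expTerm R) m)
        (sym (partialSum-seq s n p)) (sym (partialSum-seq s m p))
        (sumTo-difference′ (λ k → seq (s k) p) (expTerm R) (dominated p N₀≤p) m≤n)

    -- The tail estimate is uniform in the stage p; this is what lets the number of terms and the
    -- stage grow together.
    close-partial : ∀ ε → 0ℚ < ε → ∃[ N ] (∀ n → N ℕ.≤ n → ∀ p → n ℕ.⊔ N₀ ℕ.≤ p → ∣ f p p - f n p ∣ < ε)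
    close-partial ε 0<ε = let N , small = exp-tail R 0≤R ε 0<ε in N , λ n N≤n p h →
      let n≤p = ℕ.m⊔n≤o⇒m≤o n N₀ h
      in ℚ.≤-<-trans (tail p (ℕ.m⊔n≤o⇒n≤o n N₀ h) n≤p) (small n N≤n p n≤p)

    private
      cauchy : ℝ.IsCauchy (λ p → f p p)
      cauchy ε 0<ε =
        let η = ½ * (½ * ε)
            N , near = close-partial η (½*-pos (½*-pos 0<ε))
            M , mid = isCauchy (partialSum s N) (½ * ε) (½*-pos 0<ε)
            K = M ℕ.⊔ (N ℕ.⊔ N₀)
        in K , λ m n K≤m K≤n →
          let a = near N ℕ.≤-refl m (ℕ.m⊔n≤o⇒n≤o M (N ℕ.⊔ N₀) K≤m)
              b = near N ℕ.≤-refl n (ℕ.m⊔n≤o⇒n≤o M (N ℕ.⊔ N₀) K≤n)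
              c = mid m n (ℕ.m⊔n≤o⇒m≤o M (N ℕ.⊔ N₀) K≤m) (ℕ.m⊔n≤o⇒m≤o M (N ℕ.⊔ N₀) K≤n)
          in three (f m m) (f N m) (f N n) (f n n) ε a c b
        where
        split : ∀ a b c d → (a - b) + ((b - c) - (d - c)) ≡ a - d
        split = solve-∀ ℚ-acr
        three : ∀ a b c d ε → ∣ a - b ∣ < ½ * (½ * ε) → ∣ b - c ∣ < ½ * ε → ∣ d - c ∣ < ½ * (½ * ε) → ∣ a - d ∣ < ε
        three a b c d ε p q r = begin-strict
          ∣ a - d ∣                                  ≡⟨ cong ∣_∣ (sym (split a b c d)) ⟩
          ∣ (a - b) + ((b - c) - (d - c)) ∣          ≤⟨ ℚ.∣p+q∣≤∣p∣+∣q∣ (a - b) ((b - c) - (d - c)) ⟩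
          ∣ a - b ∣ + ∣ (b - c) - (d - c) ∣          ≤⟨ ℚ.+-monoʳ-≤ ∣ a - b ∣ (ℚ.∣p-q∣≤∣p∣+∣q∣ (b - c) (d - c)) ⟩
          ∣ a - b ∣ + (∣ b - c ∣ + ∣ d - c ∣)        <⟨ ℚ.+-mono-< p (ℚ.+-mono-< q r) ⟩
          ½ * (½ * ε) + (½ * ε + ½ * (½ * ε))        ≡⟨ total ε ⟩
          ε                                          ∎
          where
          open ℚ.≤-Reasoning
          total : ∀ ε → ½ * (½ * ε) + (½ * ε + ½ * (½ * ε)) ≡ ε
          total = solve-∀ ℚ-acr

    diagonal : ℝ
    diagonal = mkℝ (λ p → f p p) cauchy

    hasSum : HasSum s diagonal
    hasSum ε 0<ε =
      let g , 0<g , M , g≤ε = positive-eventually {ε} 0<ε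
          N , near = close-partial (½ * g) (½*-pos 0<g)
      in N , λ n N≤n →
        let K = M ℕ.⊔ (n ℕ.⊔ N₀)
            bounds = λ p (K≤p : K ℕ.≤ p) → near n N≤n p (ℕ.m⊔n≤o⇒n≤o M (n ℕ.⊔ N₀) K≤p)
            g≤ε′ = λ p (K≤p : K ℕ.≤ p) → g≤ε p (ℕ.m⊔n≤o⇒m≤o M (n ℕ.⊔ N₀) K≤p)
        in mk< (½ * g) (½*-pos 0<g) (K , λ p K≤p → below (f p p) (f n p) (seq ε p) g (g≤ε′ p K≤p) (bounds p K≤p))
         , mk< (½ * g) (½*-pos 0<g) (K , λ p K≤p → above (f p p) (f n p) (seq ε p) g (g≤ε′ p K≤p) (bounds p K≤p))
      where
      below : ∀ D S e g → g ≤ e → ∣ D - S ∣ < ½ * g → (D - e) + ½ * g ≤ S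
      below D S e g g≤e lt = ≤-shift ((e - g) + (½ * g - (D - S)))
        (+-nonNeg (p≤q⇒0≤q-p g≤e) (p≤q⇒0≤q-p (ℚ.≤-trans (p≤∣p∣ (D - S)) (ℚ.<⇒≤ lt)))) (eq D S e g)
        where
        eq : ∀ D S e g → S ≡ ((D - e) + ½ * g) + ((e - g) + (½ * g - (D - S)))
        eq = solve-∀ ℚ-acr
      above : ∀ D S e g → g ≤ e → ∣ D - S ∣ < ½ * g → S + ½ * g ≤ D + e
      above D S e g g≤e lt = ≤-shift ((e - g) + (½ * g - - (D - S)))
        (+-nonNeg (p≤q⇒0≤q-p g≤e) (p≤q⇒0≤q-p (ℚ.≤-trans (-p≤∣p∣ (D - S)) (ℚ.<⇒≤ lt)))) (eq D S e g)
        where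
        eq : ∀ D S e g → D + e ≡ (S + ½ * g) + ((e - g) + (½ * g - - (D - S)))
        eq = solve-∀ ℚ-acr

  invFactorial : ℕ → ℚ
  invFactorial k = (ℤ.+ 1 / (k !)) {{ℕ._!≢0 k}}

  -- Both 1/k! and the recursive product `g k` are inverse to k!, hence equal, and `g` unfolds in
  -- step with `expTerm`.
  invFactorial-pow : ∀ x k → invFactorial k * pow x k ≡ expTerm x k
  invFactorial-pow x k = trans (cong (_* pow x k)
      (unique (invFactorial k) (g k) (ι (k !)) (1/n*n≡1 (k !) {{ℕ._!≢0 k}}) (g-inverse k))) (g-pow k)
    where
    g : ℕ → ℚ
    g zero    = 1ℚ
    g (suc k) = inv (ι (suc k)) * g k
    unique : ∀ a b n → a * n ≡ 1ℚ → b * n ≡ 1ℚ → a ≡ b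
    unique a b n p q = trans (sym (ℚ.*-identityʳ a)) (trans (cong (a *_) (sym q))
      (trans (swap a b n) (trans (cong (b *_) p) (ℚ.*-identityʳ b))))
      where
      swap : ∀ a b n → a * (b * n) ≡ b * (a * n)
      swap = solve-∀ ℚ-acr
    g-inverse : ∀ k → g k * ι (k !) ≡ 1ℚ
    g-inverse zero    = refl
    g-inverse (suc k) = trans (cong (g (suc k) *_) (ι-homo-* (suc k) (k !)))
      (trans (swap (inv (ι (suc k))) (g k) (ι (suc k)) (ι (k !)))
        (cong₂ _*_ (inv-inverseˡ (pos⇒≢0 (ι-suc-pos k))) (g-inverse k)))
      where
      swap : ∀ i g n f → i * g * (n * f) ≡ (i * n) * (g * f)
      swap = solve-∀ ℚ-acr
    g-pow : ∀ k → g k * pow x k ≡ expTerm x k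
    g-pow zero    = refl
    g-pow (suc k) = trans (swap (inv (ι (suc k))) (g k) x (pow x k)) (cong (_* (x * inv (ι (suc k)))) (g-pow k))
      where
      swap : ∀ i g x p → i * g * (x * p) ≡ g * p * (x * i)
      swap = solve-∀ ℚ-acr

  private
    module ℝ-semiring = RawSemiringDefs (RawRing.rawSemiring ℝ-rawRing)

  ^-seq : ∀ x k p → seq (x ℝ-semiring.^ k) p ≡ pow (seq x p) k
  ^-seq x zero    p = refl
  ^-seq x (suc k) p = cong (seq x p *_) (^-seq x k p)

  κ-even : ∀ k → κ (2 ℕ.* k) ≡ pow (- 1ℚ) k × σ (2 ℕ.* k) ≡ 0ℚ
  κ-even zero    = refl , refl
  κ-even (suc k) = subst (λ m → κ m ≡ pow (- 1ℚ) (suc k) × σ m ≡ 0ℚ) (sym (ℕ.*-suc 2 k))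
    (let p , q = κ-even k in trans (cong -_ p) (minus (pow (- 1ℚ) k)) , cong -_ q)
    where
    minus : ∀ a → - a ≡ - 1ℚ * a
    minus = solve-∀ ℚ-acr

  cosTerm : ℝ → ℕ → ℝ
  cosTerm x k = (ℝ.- 1ℝ) ℝ-semiring.^ k ℝ.* (1/ (2 ℕ.* k) ! ℝ.* x ℝ-semiring.^ (2 ℕ.* k))

  -- Each term of the cosine series accounts for two terms of `cosSum`, an even one and an odd one;
  -- the odd one has coefficient -σ (2n) = 0.
  cosTerm-sum : ∀ x n p → sumTo (λ k → seq (cosTerm x k) p) n ≡ cosSum (seq x p) (2 ℕ.* n)
  cosTerm-sum x zero    p = refl
  cosTerm-sum x (suc n) p = trans (cong₂ _+_ (cosTerm-sum x n p) term) (trans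
    (collect (cosSum y (2 ℕ.* n)) (κ (2 ℕ.* n) * expTerm y (2 ℕ.* n)) (expTerm y (suc (2 ℕ.* n))))
    (trans (cong (λ t → cosSum y (2 ℕ.* n) + κ (2 ℕ.* n) * expTerm y (2 ℕ.* n) + t * expTerm y (suc (2 ℕ.* n)))
        (sym (cong -_ (proj₂ (κ-even n)))))
      (cong (cosSum y) (sym (ℕ.*-suc 2 n)))))
    where
    y = seq x p
    collect : ∀ a b c → a + b ≡ a + b + - 0ℚ * c
    collect = solve-∀ ℚ-acr
    term : seq (cosTerm x n) p ≡ κ (2 ℕ.* n) * expTerm y (2 ℕ.* n)
    term = cong₂ _*_ (trans (^-seq (ℝ.- 1ℝ) n p) (sym (proj₁ (κ-even n))))
      (trans (cong (invFactorial (2 ℕ.* n) *_) (^-seq x (2 ℕ.* n) p)) (invFactorial-pow y (2 ℕ.* n)))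

  module Trigonometry (τ : ℝ) (cosτ≈0 : Cos τ 0ℝ) where
    private
      B : ℚ
      B = proj₁ (seq-bounded τ)
      0≤B : 0ℚ ≤ B
      0≤B = ℚ.<⇒≤ (proj₁ (proj₂ (seq-bounded τ)))
      N₀ : ℕ
      N₀ = proj₁ (proj₂ (proj₂ (seq-bounded τ)))
      τ≤B : ∀ p → N₀ ℕ.≤ p → ∣ seq τ p ∣ ≤ B
      τ≤B = proj₂ (proj₂ (proj₂ (seq-bounded τ)))

      scaled≤ : ∀ q p → N₀ ℕ.≤ p → ∣ q * seq τ p ∣ ≤ ∣ q ∣ * B
      scaled≤ q p N₀≤p = subst (_≤ ∣ q ∣ * B) (sym (ℚ.∣p*q∣≡∣p∣*∣q∣ q (seq τ p)))
        (*-monoˡ ∣ q ∣ (ℚ.0≤∣p∣ q) (τ≤B p N₀≤p))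

      0≤∣∣*B : ∀ q → 0ℚ ≤ ∣ q ∣ * B
      0≤∣∣*B q = *-nonNeg (ℚ.0≤∣p∣ q) 0≤B

    -- Diagonal approximants of cos (qτ) and sin (qτ): p terms of the series, evaluated at the p-th
    -- approximant of τ. Trigonometry at a real argument thus becomes limits of rational sequences.
    C S : ℚ → ℕ → ℚ
    C q p = cosSum (q * seq τ p) p
    S q p = sinSum (q * seq τ p) p

    private
      tail-null : ∀ R → 0ℚ ≤ R → (f : ℕ → ℚ) →
        (∀ p → N₀ ℕ.≤ p → ∣ f p ∣ ≤ sumTo (expTerm R) (p ℕ.+ p) - sumTo (expTerm R) p) → Null f
      tail-null R 0≤R f bound ε 0<ε = let N , small = exp-tail R 0≤R ε 0<ε in
        N ℕ.⊔ N₀ , λ p h → ℚ.≤-<-trans (bound p (ℕ.m⊔n≤o⇒n≤o N N₀ h))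
          (small p (ℕ.m⊔n≤o⇒m≤o N N₀ h) (p ℕ.+ p) (ℕ.m≤m+n p p))

      signed-bounded : ∀ (s : ℕ → ℚ) → (∀ k → ∣ s k ∣ ≤ 1ℚ) → ∀ q →
        Bounded (λ p → sumTo (λ k → s k * expTerm (q * seq τ p) k) p)
      signed-bounded s s≤1 q =
        let M , 0<M , N , bound = exp-bounded (∣ q ∣ * B) (0≤∣∣*B q) in
        M , 0<M , N ℕ.⊔ N₀ , λ p h → ℚ.≤-trans
          (sumTo-abs (λ k → s k * expTerm (q * seq τ p) k) (expTerm (∣ q ∣ * B)) (λ k →
            signed-abs (s k) (expTerm (q * seq τ p) k) (expTerm (∣ q ∣ * B) k) (s≤1 k)
              (expTerm-abs (q * seq τ p) (∣ q ∣ * B) (scaled≤ q p (ℕ.m⊔n≤o⇒n≤o N N₀ h)) k)) p)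
          (ℚ.≤-trans (p≤∣p∣ (sumTo (expTerm (∣ q ∣ * B)) p)) (bound p (ℕ.m⊔n≤o⇒m≤o N N₀ h)))

    C-bounded : ∀ q → Bounded (C q)
    C-bounded = signed-bounded κ (λ k → proj₁ (κσ-abs k))

    S-bounded : ∀ q → Bounded (S q)
    S-bounded = signed-bounded σ (λ k → proj₂ (κσ-abs k))

    C-+ : ∀ q r → Null (λ p → (C q p * C r p - S q p * S r p) - C (q + r) p)
    C-+ q r = tail-null (∣ q ∣ * B + ∣ r ∣ * B) (+-nonNeg (0≤∣∣*B q) (0≤∣∣*B r)) _ λ p N₀≤p →
      subst (λ t → ∣ (C q p * C r p - S q p * S r p) - cosSum t p ∣ ≤ sumTo (expTerm (∣ q ∣ * B + ∣ r ∣ * B)) (p ℕ.+ p) - sumTo (expTerm (∣ q ∣ * B + ∣ r ∣ * B)) p)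
        (sym (ℚ.*-distribʳ-+ (seq τ p) q r))
        (cos-addition (q * seq τ p) (r * seq τ p) (∣ q ∣ * B) (∣ r ∣ * B) (scaled≤ q p N₀≤p) (scaled≤ r p N₀≤p) p)

    S-+ : ∀ q r → Null (λ p → (S q p * C r p + C q p * S r p) - S (q + r) p)
    S-+ q r = tail-null (∣ q ∣ * B + ∣ r ∣ * B) (+-nonNeg (0≤∣∣*B q) (0≤∣∣*B r)) _ λ p N₀≤p →
      subst (λ t → ∣ (S q p * C r p + C q p * S r p) - sinSum t p ∣ ≤ sumTo (expTerm (∣ q ∣ * B + ∣ r ∣ * B)) (p ℕ.+ p) - sumTo (expTerm (∣ q ∣ * B + ∣ r ∣ * B)) p)
        (sym (ℚ.*-distribʳ-+ (seq τ p) q r))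
        (sin-addition (q * seq τ p) (r * seq τ p) (∣ q ∣ * B) (∣ r ∣ * B) (scaled≤ q p N₀≤p) (scaled≤ r p N₀≤p) p)

    -- exp (i q τ) = c
    Unit : ℚ → ℚ → Set
    Unit q c = Lim (C q) c × Lim (S q) 0ℚ

    unit-+ : ∀ {q r c d} → Unit q c → Unit r d → Unit (q + r) (c * d)
    unit-+ {q} {r} {c} {d} (Cq , Sq) (Cr , Sr) =
      lim-approx {λ p → C q p * C r p - S q p * S r p} {C (q + r)} {c * d} (C-+ q r)
        (subst (Lim (λ p → C q p * C r p - S q p * S r p)) (simplify₁ c d)
          (lim-+ {λ p → C q p * C r p} {λ p → - (S q p * S r p)} {c * d} { - (0ℚ * 0ℚ) }
            (lim-* {C q} {C r} {c} {d} (C-bounded q) Cq Cr)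
            (lim-neg {λ p → S q p * S r p} {0ℚ * 0ℚ} (lim-* {S q} {S r} {0ℚ} {0ℚ} (S-bounded q) Sq Sr)))) ,
      lim-approx {λ p → S q p * C r p + C q p * S r p} {S (q + r)} {0ℚ} (S-+ q r)
        (subst (Lim (λ p → S q p * C r p + C q p * S r p)) (simplify₂ c d)
          (lim-+ {λ p → S q p * C r p} {λ p → C q p * S r p} {0ℚ * d} {c * 0ℚ}
            (lim-* {S q} {C r} {0ℚ} {d} (S-bounded q) Sq Cr) (lim-* {C q} {S r} {c} {0ℚ} (C-bounded q) Cq Sr)))
      where
      simplify₁ : ∀ c d → c * d + - (0ℚ * 0ℚ) ≡ c * d
      simplify₁ = solve-∀ ℚ-acr
      simplify₂ : ∀ c d → 0ℚ * d + c * 0ℚ ≡ 0ℚ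
      simplify₂ = solve-∀ ℚ-acr

    private
      C-neg : ∀ q p → C (- q) p ≡ C q p
      C-neg q p = trans (cong (λ t → cosSum t p) (sym (ℚ.neg-distribˡ-* q (seq τ p)))) (cosSum-neg (q * seq τ p) p)
      S-neg : ∀ q p → S (- q) p ≡ - S q p
      S-neg q p = trans (cong (λ t → sinSum t p) (sym (ℚ.neg-distribˡ-* q (seq τ p)))) (sinSum-neg (q * seq τ p) p)

    unit-neg : ∀ {q c} → Unit q c → Unit (- q) c
    unit-neg {q} {c} (Cq , Sq) =
      lim-cong {C q} {C (- q)} {c} (λ p → sym (C-neg q p)) Cq ,
      lim-cong {λ p → - S q p} {S (- q)} {0ℚ} (λ p → sym (S-neg q p)) (lim-neg {S q} {0ℚ} Sq)

    private
      expTerm-0 : ∀ k → expTerm 0ℚ (suc k) ≡ 0ℚ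
      expTerm-0 k = trans (cong (expTerm 0ℚ k *_) (ℚ.*-zeroˡ (inv (ι (suc k))))) (ℚ.*-zeroʳ (expTerm 0ℚ k))

      sum-0 : ∀ (s : ℕ → ℚ) n → sumTo (λ k → s k * expTerm 0ℚ k) (suc n) ≡ s 0
      sum-0 s n = trans (sumTo-first (λ k → s k * expTerm 0ℚ k) n) (trans (cong₂ _+_ (ℚ.*-identityʳ (s 0))
        (trans (sumTo-cong n (λ i _ → trans (cong (s (suc i) *_) (expTerm-0 i)) (trans (ℚ.*-zeroʳ (s (suc i))) (sym (ℚ.*-zeroˡ 0ℚ)))))
          (trans (sumTo-* 0ℚ (λ _ → 0ℚ) n) (ℚ.*-zeroˡ (sumTo (λ _ → 0ℚ) n))))) (ℚ.+-identityʳ (s 0)))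

      lim-0 : ∀ (s : ℕ → ℚ) → Lim (λ p → sumTo (λ k → s k * expTerm (0ℚ * seq τ p) k) p) (s 0)
      -- The sum is empty at p = 0, so the value s 0 is attained only from p = 1 on.
      lim-0 s ε 0<ε = 1 , λ { (suc p) _ → subst (λ t → ∣ t ∣ < ε)
        (sym (trans (cong (_- s 0) (trans (cong (λ y → sumTo (λ k → s k * expTerm y k) (suc p)) (ℚ.*-zeroˡ (seq τ (suc p)))) (sum-0 s p)))
          (ℚ.+-inverseʳ (s 0)))) 0<ε }

    unit-0 : Unit 0ℚ 1ℚ
    unit-0 = lim-0 κ , lim-0 σ

    private
      -- The hypothesis controls a fixed partial sum of n cosine terms at late stages p. The
      -- diagonal value differs from it by the terms of index 2n to p - 1, which an exponential tail
      -- bounds. Each of the two errors gets ε/2.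
      C₁→0 : Lim (C 1ℚ) 0ℚ
      C₁→0 = null-cong {C₁} {λ p → C 1ℚ p - 0ℚ} (λ p → trans (cong (λ t → cosSum t p) (sym (ℚ.*-identityˡ (seq τ p)))) (sym (ℚ.+-identityʳ (C 1ℚ p))))
        null
        where
        C₁ : ℕ → ℚ
        C₁ p = cosSum (seq τ p) p
        null : Null C₁
        null ε 0<ε =
          let δ = ½ * ε
              0<δ = ½*-pos 0<ε
              N , near = cosτ≈0 (fromℚ δ) (eventually-positive {fromℚ δ} δ 0<δ (0 , λ _ _ → ℚ.≤-refl))
              M , tail = exp-tail B 0≤B δ 0<δ
              n = N ℕ.⊔ M
              m = 2 ℕ.* n
              lo , hi = near n (ℕ.m≤m⊔n N M)
              P₁ , lo′ = separated lo
              P₂ , hi′ = separated hi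
              K = (P₁ ℕ.⊔ P₂) ℕ.⊔ (N₀ ℕ.⊔ m)
          in K , λ p K≤p →
            let h₁ = ℕ.m⊔n≤o⇒m≤o (P₁ ℕ.⊔ P₂) (N₀ ℕ.⊔ m) K≤p
                h₂ = ℕ.m⊔n≤o⇒n≤o (P₁ ℕ.⊔ P₂) (N₀ ℕ.⊔ m) K≤p
                partial = trans (partialSum-seq (cosTerm τ) n p) (cosTerm-sum τ n p)
            in combine ε (C₁ p) (cosSum (seq τ p) m)
                 (lower δ (gap lo) (gap>0 lo) (subst (λ t → (0ℚ + - δ) + gap lo ≤ t) partial (lo′ p (ℕ.m⊔n≤o⇒m≤o P₁ P₂ h₁))))
                 (upper δ (gap hi) (gap>0 hi) (subst (λ t → t + gap hi ≤ 0ℚ + δ) partial (hi′ p (ℕ.m⊔n≤o⇒n≤o P₁ P₂ h₁))))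
                 (ℚ.≤-<-trans (sumTo-difference′ (λ k → κ k * expTerm (seq τ p) k) (expTerm B)
                     (λ k → signed-abs (κ k) (expTerm (seq τ p) k) (expTerm B k) (proj₁ (κσ-abs k))
                       (expTerm-abs (seq τ p) B (τ≤B p (ℕ.m⊔n≤o⇒m≤o N₀ m h₂)) k))
                     (ℕ.m⊔n≤o⇒n≤o N₀ m h₂))
                   (tail m (ℕ.≤-trans (ℕ.m≤n⊔m N M) (ℕ.m≤m+n n (n ℕ.+ 0))) p (ℕ.m⊔n≤o⇒n≤o N₀ m h₂)))
          where
          lower : ∀ δ g {t} → 0ℚ < g → (0ℚ + - δ) + g ≤ t → - t ≤ δ
          lower δ g {t} 0<g le = ≤-shift ((t - ((0ℚ + - δ) + g)) + g) (+-nonNeg (p≤q⇒0≤q-p le) (ℚ.<⇒≤ 0<g)) (eq δ g t)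
            where
            eq : ∀ d g t → d ≡ - t + ((t - ((0ℚ + - d) + g)) + g)
            eq = solve-∀ ℚ-acr
          upper : ∀ δ g {t} → 0ℚ < g → t + g ≤ 0ℚ + δ → t ≤ δ
          upper δ g {t} 0<g le = ≤-shift (((0ℚ + δ) - (t + g)) + g) (+-nonNeg (p≤q⇒0≤q-p le) (ℚ.<⇒≤ 0<g)) (eq δ g t)
            where
            eq : ∀ d g t → d ≡ t + (((0ℚ + d) - (t + g)) + g)
            eq = solve-∀ ℚ-acr
          combine : ∀ ε a b → - b ≤ ½ * ε → b ≤ ½ * ε → ∣ a - b ∣ < ½ * ε → ∣ a ∣ < ε
          combine ε a b p q r = subst (λ t → ∣ t ∣ < ε) (back a b) (ℚ.≤-<-trans (ℚ.∣p+q∣≤∣p∣+∣q∣ (a - b) b)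
            (subst (∣ a - b ∣ + ∣ b ∣ <_) (½+½ ε) (ℚ.+-mono-<-≤ {∣ a - b ∣} {½ * ε} {∣ b ∣} {½ * ε} r (∣∣-≤ q p))))
            where
            back : ∀ a b → (a - b) + b ≡ a
            back = solve-∀ ℚ-acr

      C₁²→0 : Lim (λ p → C 1ℚ p * C 1ℚ p) 0ℚ
      C₁²→0 = lim-* {C 1ℚ} {C 1ℚ} {0ℚ} {0ℚ} (C-bounded 1ℚ) C₁→0 C₁→0

      -- cos² + sin² = 1, from exp (iτ) exp (−iτ) = 1.
      S₁²→1 : Lim (λ p → S 1ℚ p * S 1ℚ p) 1ℚ
      S₁²→1 = lim-cong {λ p → (C 1ℚ p * C 1ℚ p - S 1ℚ p * S (- 1ℚ) p) + - (C 1ℚ p * C 1ℚ p)} {λ p → S 1ℚ p * S 1ℚ p} {1ℚ}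
        (λ p → trans (cong (λ t → (C 1ℚ p * C 1ℚ p - S 1ℚ p * t) + - (C 1ℚ p * C 1ℚ p)) (S-neg 1ℚ p)) (simplify (C 1ℚ p) (S 1ℚ p)))
        (lim-+ {λ p → C 1ℚ p * C 1ℚ p - S 1ℚ p * S (- 1ℚ) p} {λ p → - (C 1ℚ p * C 1ℚ p)} {1ℚ} { - 0ℚ }
          (lim-approx {C 0ℚ} {λ p → C 1ℚ p * C 1ℚ p - S 1ℚ p * S (- 1ℚ) p} {1ℚ}
            (null-cong {λ p → - ((C 1ℚ p * C (- 1ℚ) p - S 1ℚ p * S (- 1ℚ) p) - C 0ℚ p)}
              {λ p → C 0ℚ p - (C 1ℚ p * C 1ℚ p - S 1ℚ p * S (- 1ℚ) p)}
              (λ p → trans (cong (λ t → - ((C 1ℚ p * t - S 1ℚ p * S (- 1ℚ) p) - C 0ℚ p)) (C-neg 1ℚ p))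
                (flip (C 1ℚ p * C 1ℚ p - S 1ℚ p * S (- 1ℚ) p) (C 0ℚ p)))
              (null-neg {λ p → (C 1ℚ p * C (- 1ℚ) p - S 1ℚ p * S (- 1ℚ) p) - C 0ℚ p} (C-+ 1ℚ (- 1ℚ))))
            (proj₁ unit-0))
          (lim-neg {λ p → C 1ℚ p * C 1ℚ p} {0ℚ} C₁²→0))
        where
        simplify : ∀ c s → (c * c - s * - s) + - (c * c) ≡ s * s
        simplify = solve-∀ ℚ-acr
        flip : ∀ a b → - (a - b) ≡ b - a
        flip = solve-∀ ℚ-acr

    -- From the double-angle formulas: cos² τ - sin² τ = 0 - 1, and 2 sin τ cos τ = 0 since sin τ is
    -- bounded. Squaring settles the value although the sign of sin τ is undetermined.
    unit-2 : Unit (1ℚ + 1ℚ) (- 1ℚ)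
    unit-2 =
      lim-approx {λ p → C 1ℚ p * C 1ℚ p - S 1ℚ p * S 1ℚ p} {C (1ℚ + 1ℚ)} { - 1ℚ } (C-+ 1ℚ 1ℚ)
        (lim-+ {λ p → C 1ℚ p * C 1ℚ p} {λ p → - (S 1ℚ p * S 1ℚ p)} {0ℚ} { - 1ℚ } C₁²→0
          (lim-neg {λ p → S 1ℚ p * S 1ℚ p} {1ℚ} S₁²→1)) ,
      lim-approx {λ p → S 1ℚ p * C 1ℚ p + C 1ℚ p * S 1ℚ p} {S (1ℚ + 1ℚ)} {0ℚ} (S-+ 1ℚ 1ℚ)
        (lim-+ {λ p → S 1ℚ p * C 1ℚ p} {λ p → C 1ℚ p * S 1ℚ p} {0ℚ} {0ℚ} S₁C₁→0
          (lim-cong {λ p → S 1ℚ p * C 1ℚ p} {λ p → C 1ℚ p * S 1ℚ p} {0ℚ} (λ p → ℚ.*-comm (S 1ℚ p) (C 1ℚ p)) S₁C₁→0))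
      where
      S₁C₁→0 : Lim (λ p → S 1ℚ p * C 1ℚ p) 0ℚ
      S₁C₁→0 = null-cong {λ p → S 1ℚ p * (C 1ℚ p - 0ℚ)} {λ p → S 1ℚ p * C 1ℚ p - 0ℚ} (λ p → simplify (S 1ℚ p) (C 1ℚ p))
        (bounded-*-null {S 1ℚ} {λ p → C 1ℚ p - 0ℚ} (S-bounded 1ℚ) C₁→0)
        where
        simplify : ∀ s c → s * (c - 0ℚ) ≡ s * c - 0ℚ
        simplify = solve-∀ ℚ-acr

    -- exp (4iτ) = (-1)² = 1; this is where divisibility by four takes effect.
    unit-ι4* : ∀ j → Unit (ι (4 ℕ.* j)) 1ℚ
    unit-ι4* zero    = unit-0
    unit-ι4* (suc j) = subst (λ q → Unit q 1ℚ) (trans (regroup (ι (4 ℕ.* j))) (cong ι (sym (ℕ.*-suc 4 j))))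
      (unit-+ {((1ℚ + 1ℚ) + (1ℚ + 1ℚ))} {ι (4 ℕ.* j)} {1ℚ} {1ℚ} (unit-+ {1ℚ + 1ℚ} {1ℚ + 1ℚ} { - 1ℚ } { - 1ℚ } unit-2 unit-2) (unit-ι4* j))
      where
      regroup : ∀ m → ((1ℚ + 1ℚ) + (1ℚ + 1ℚ)) + m ≡ 1ℚ + (1ℚ + (1ℚ + (1ℚ + m)))
      regroup = solve-∀ ℚ-acr

-- The exponential of iτL for a rational matrix L, column by column.

module MatrixExponentials where

  open import Data.Rational.Base
  open ≡
  open Defs using (_+i_; 1/_!)
  open Rationals
  open Reals
  open RationalVectors
  open IntegralSupport
  open ExponentialSums
  open Convergence
  open LAℚ

  module Sℂ = RawSemiringDefs (RawRing.rawSemiring ℂ-rawRing)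

  re-sum-seq : ∀ {k} (f : Vector ℂ k) p → seq (re (Sℂ.sum f)) p ≡ sum (λ j → seq (re (f j)) p)
  re-sum-seq {zero}  f p = refl
  re-sum-seq {suc k} f p = cong (seq (re (f zero)) p +_) (re-sum-seq (f ∘ suc) p)

  im-sum-seq : ∀ {k} (f : Vector ℂ k) p → seq (im (Sℂ.sum f)) p ≡ sum (λ j → seq (im (f j)) p)
  im-sum-seq {zero}  f p = refl
  im-sum-seq {suc k} f p = cong (seq (im (f zero)) p +_) (im-sum-seq (f ∘ suc) p)

  module Power {k} (L : Matrix k) where
    iterate : ℕ → Vector ℚ k → Vector ℚ k
    iterate zero    f = f
    iterate (suc m) f = L *ᵥ iterate m f

    iterate-cong : ∀ m {f g} → f ≋ g → iterate m f ≋ iterate m g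
    iterate-cong zero    f≋g = f≋g
    iterate-cong (suc m) f≋g = *ᵥ-cong L (iterate-cong m f≋g)

    iterate-+ : ∀ m f g → iterate m (f +ᵥ g) ≋ iterate m f +ᵥ iterate m g
    iterate-+ zero    f g i = refl
    iterate-+ (suc m) f g i = trans (*ᵥ-cong L (iterate-+ m f g) i) (*ᵥ-+ L (iterate m f) (iterate m g) i)

    iterate-· : ∀ m c f → iterate m (c · f) ≋ c · iterate m f
    iterate-· zero    c f i = refl
    iterate-· (suc m) c f i = trans (*ᵥ-cong L (iterate-· m c f) i) (*ᵥ-· L c (iterate m f) i)

    iterate-eigen : ∀ m θ x → L *ᵥ x ≋ θ · x → iterate m x ≋ pow θ m · x
    iterate-eigen zero    θ x Lx≋θx i = sym (ℚ.*-identityˡ (x i))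
    iterate-eigen (suc m) θ x Lx≋θx i = trans (*ᵥ-cong L (iterate-eigen m θ x Lx≋θx) i)
      (trans (*ᵥ-· L (pow θ m) x i) (trans (cong (pow θ m *_) (Lx≋θx i)) (swap (pow θ m) θ (x i))))
      where
      swap : ∀ a b c → a * (b * c) ≡ b * a * c
      swap = solve-∀ ℚ-acr

    iterate-𝐞-bound : ∀ m i j → ∣ iterate m (𝐞 j) i ∣ ≤ pow (ℓ¹-matrix L) m
    iterate-𝐞-bound zero    i j with does (j Fin.≟ i)
    ... | true  = ℚ.≤-refl
    ... | false = 0≤1
    iterate-𝐞-bound (suc m) i j = ℚ.≤-trans
      (∣dot∣≤ (L i) (iterate m (𝐞 j)) (pow (ℓ¹-matrix L) m) (λ c → iterate-𝐞-bound m c j))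
      (ℚ.*-monoʳ-≤-nonNeg (pow (ℓ¹-matrix L) m) {{nonNegative (pow-nonNeg (ℓ¹-matrix L) 0≤K m)}}
        (summand≤sum (λ i → ℓ¹ (L i)) (λ i → ℓ¹-nonNeg (L i)) i))
      where
      0≤K : 0ℚ ≤ ℓ¹-matrix L
      0≤K = sum-nonNeg (λ i → ℓ¹ (L i)) (λ i → ℓ¹-nonNeg (L i))

  module MatrixPower {n} = RawSemiringDefs (RawRing.rawSemiring (Mℂ.matrixRawRing n)) using (_^_)
  open MatrixPower using (_^_)

  -- A power is an iterated operation of the multiplicative monoid: `A ^ suc m` unfolds to the
  -- product of `A` with `m ×ₘ A`, the expression on which the induction for powers works.
  module MatrixMultiple {n} = RawMonoidDefs (RawSemiring.*-rawMonoid (RawRing.rawSemiring (Mℂ.matrixRawRing n))) using (_×_)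
  open MatrixMultiple using () renaming (_×_ to _×ₘ_)

  product-seq : ∀ {k} (M N : Mℂ.Matrix k) i j p →
    seq (re (RawRing._*_ (Mℂ.matrixRawRing k) M N i j)) p
      ≡ sum (λ c → seq (re (M i c)) p * seq (re (N c j)) p + - (seq (im (M i c)) p * seq (im (N c j)) p))
    × seq (im (RawRing._*_ (Mℂ.matrixRawRing k) M N i j)) p
      ≡ sum (λ c → seq (re (M i c)) p * seq (im (N c j)) p + seq (im (M i c)) p * seq (re (N c j)) p)
  product-seq M N i j p =
    re-sum-seq (λ c → RawRing._*_ ℂ-rawRing (M i c) (N c j)) p ,
    im-sum-seq (λ c → RawRing._*_ ℂ-rawRing (M i c) (N c j)) p

  𝐞ℚ-sym : ∀ {k} (i j : Fin k) → 𝐞 i j ≡ 𝐞 j i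
  𝐞ℚ-sym zero    zero    = refl
  𝐞ℚ-sym zero    (suc j) = refl
  𝐞ℚ-sym (suc i) zero    = refl
  𝐞ℚ-sym (suc i) (suc j) = 𝐞ℚ-sym i j

  𝐞-re-seq : ∀ {k} (i j : Fin k) p → seq (re (Mℂ.𝐞 i j)) p ≡ 𝐞 i j
  𝐞-re-seq i j p with does (i Fin.≟ j)
  ... | true  = refl
  ... | false = refl

  𝐞-im-seq : ∀ {k} (i j : Fin k) p → seq (im (Mℂ.𝐞 i j)) p ≡ 0ℚ
  𝐞-im-seq i j p with does (i Fin.≟ j)
  ... | true  = refl
  ... | false = refl

  -- `A` stands for iτL and is known only through its approximants. So the computation applies both
  -- to a matrix written down in simplified form and to the literal complex product in
  -- `IsTransitionMatrix`.
  module Exponential {k} (L : Matrix k) (τ : ℝ) (A : Mℂ.Matrix k)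
    (re-A : ∀ i j p → seq (re (A i j)) p ≡ 0ℚ) (im-A : ∀ i j p → seq (im (A i j)) p ≡ seq τ p * L i j) where

    open Power L

    power-seq : ∀ m i j p →
      seq (re ((A ^ m) i j)) p ≡ κ m * pow (seq τ p) m * iterate m (𝐞 j) i
      × seq (im ((A ^ m) i j)) p ≡ σ m * pow (seq τ p) m * iterate m (𝐞 j) i
    power-seq zero    i j p =
      trans (𝐞-re-seq i j p) (trans (𝐞ℚ-sym i j) (one (𝐞 j i))) , trans (𝐞-im-seq i j p) (nought (𝐞 j i))
      where
      one : ∀ d → d ≡ 1ℚ * 1ℚ * d
      one = solve-∀ ℚ-acr
      nought : ∀ d → 0ℚ ≡ 0ℚ * 1ℚ * d
      nought = solve-∀ ℚ-acr
    power-seq (suc m) i j p =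
      trans (proj₁ (product-seq A (m ×ₘ A) i j p)) (trans (sum-cong-≋ (λ c →
          trans (cong₂ (λ a b → a * seq (re ((m ×ₘ A) c j)) p + - (b * seq (im ((m ×ₘ A) c j)) p)) (re-A i c p) (im-A i c p))
          (trans (cong₂ (λ a b → 0ℚ * a + - (t * L i c * b)) (proj₁ (power-seq m c j p)) (proj₂ (power-seq m c j p)))
            (re-step t (L i c) (κ m) (σ m) (pow t m) (iterate m (𝐞 j) c)))))
        (sym (*-distribˡ-sum (κ (suc m) * pow t (suc m)) (λ c → L i c * iterate m (𝐞 j) c)))) ,
      trans (proj₂ (product-seq A (m ×ₘ A) i j p)) (trans (sum-cong-≋ (λ c →
          trans (cong₂ (λ a b → a * seq (im ((m ×ₘ A) c j)) p + b * seq (re ((m ×ₘ A) c j)) p) (re-A i c p) (im-A i c p))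
          (trans (cong₂ (λ a b → 0ℚ * b + t * L i c * a) (proj₁ (power-seq m c j p)) (proj₂ (power-seq m c j p)))
            (im-step t (L i c) (κ m) (σ m) (pow t m) (iterate m (𝐞 j) c)))))
        (sym (*-distribˡ-sum (σ (suc m) * pow t (suc m)) (λ c → L i c * iterate m (𝐞 j) c))))
      where
      t = seq τ p
      re-step : ∀ t l k s q d → 0ℚ * (k * q * d) + - (t * l * (s * q * d)) ≡ - s * (t * q) * (l * d)
      re-step = solve-∀ ℚ-acr
      im-step : ∀ t l k s q d → 0ℚ * (s * q * d) + t * l * (k * q * d) ≡ k * (t * q) * (l * d)
      im-step = solve-∀ ℚ-acr

    -- At stage p, the m-th term of the i-th entry of exp (iτL) f: its real part for s = κ, its
    -- imaginary part for s = σ.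
    coefficient : (ℕ → ℚ) → Vector ℚ k → Fin k → ℕ → ℕ → ℚ
    coefficient s f i p m = s m * iterate m f i * expTerm (seq τ p) m

    term : Fin k → Fin k → ℕ → ℂ
    term i j m = RawRing._*_ ℂ-rawRing (fromℝ (1/ m !)) ((A ^ m) i j)

    re-term : ∀ i j m p → seq (re (term i j m)) p ≡ coefficient κ (𝐞 j) i p m
    re-term i j m p = trans (cong₂ (λ a b → invFactorial m * a + - (0ℚ * b)) (proj₁ (power-seq m i j p)) (proj₂ (power-seq m i j p)))
      (trans (regroup (invFactorial m) (κ m) (pow (seq τ p) m) (iterate m (𝐞 j) i) (σ m * pow (seq τ p) m * iterate m (𝐞 j) i))
        (cong (κ m * iterate m (𝐞 j) i *_) (invFactorial-pow (seq τ p) m)))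
      where
      regroup : ∀ f s t d e → f * (s * t * d) + - (0ℚ * e) ≡ s * d * (f * t)
      regroup = solve-∀ ℚ-acr

    im-term : ∀ i j m p → seq (im (term i j m)) p ≡ coefficient σ (𝐞 j) i p m
    im-term i j m p = trans (cong₂ (λ a b → invFactorial m * b + 0ℚ * a) (proj₁ (power-seq m i j p)) (proj₂ (power-seq m i j p)))
      (trans (regroup (invFactorial m) (σ m) (pow (seq τ p) m) (iterate m (𝐞 j) i) (κ m * pow (seq τ p) m * iterate m (𝐞 j) i))
        (cong (σ m * iterate m (𝐞 j) i *_) (invFactorial-pow (seq τ p) m)))
      where
      regroup : ∀ f s t d e → f * (s * t * d) + 0ℚ * e ≡ s * d * (f * t)
      regroup = solve-∀ ℚ-acr

    private
      K : ℚ
      K = ℓ¹-matrix L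
      0≤K : 0ℚ ≤ K
      0≤K = sum-nonNeg (λ i → ℓ¹ (L i)) (λ i → ℓ¹-nonNeg (L i))
      B : ℚ
      B = proj₁ (seq-bounded τ)
      0≤B : 0ℚ ≤ B
      0≤B = ℚ.<⇒≤ (proj₁ (proj₂ (seq-bounded τ)))
      N₀ : ℕ
      N₀ = proj₁ (proj₂ (proj₂ (seq-bounded τ)))

      coefficient-bound : ∀ (s : ℕ → ℚ) → (∀ m → ∣ s m ∣ ≤ 1ℚ) → ∀ i j p → N₀ ℕ.≤ p → ∀ m →
        ∣ coefficient s (𝐞 j) i p m ∣ ≤ expTerm (K * B) m
      coefficient-bound s s≤1 i j p N₀≤p m = subst₂ _≤_
        (sym (ℚ.∣p*q∣≡∣p∣*∣q∣ (s m * iterate m (𝐞 j) i) (expTerm (seq τ p) m))) (sym (expTerm-scale K B m))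
        (*-mono-≤ (ℚ.0≤∣p∣ (s m * iterate m (𝐞 j) i))
          (signed-abs (s m) (iterate m (𝐞 j) i) (pow K m) (s≤1 m) (iterate-𝐞-bound m i j))
          (ℚ.0≤∣p∣ (expTerm (seq τ p) m))
          (expTerm-abs (seq τ p) B (proj₂ (proj₂ (proj₂ (seq-bounded τ))) p N₀≤p) m))

    -- The entries of Lᵐ are at most Kᵐ in absolute value and the approximants of τ eventually at
    -- most B, so the series of exp (K B) majorises every entry.
    module Re i j = Diagonal (λ m → re (term i j m)) (K * B) (*-nonNeg 0≤K 0≤B) N₀
      (λ p N₀≤p m → subst (λ t → ∣ t ∣ ≤ expTerm (K * B) m) (sym (re-term i j m p))
        (coefficient-bound κ (λ m → proj₁ (κσ-abs m)) i j p N₀≤p m))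
    module Im i j = Diagonal (λ m → im (term i j m)) (K * B) (*-nonNeg 0≤K 0≤B) N₀
      (λ p N₀≤p m → subst (λ t → ∣ t ∣ ≤ expTerm (K * B) m) (sym (im-term i j m p))
        (coefficient-bound σ (λ m → proj₂ (κσ-abs m)) i j p N₀≤p m))

    U : Mℂ.Matrix k
    U i j = Re.diagonal i j +i Im.diagonal i j

    re-U : ∀ i j p → seq (re (U i j)) p ≡ sumTo (coefficient κ (𝐞 j) i p) p
    re-U i j p = trans (partialSum-seq (λ m → re (term i j m)) p p) (sumTo-cong p (λ m _ → re-term i j m p))

    im-U : ∀ i j p → seq (im (U i j)) p ≡ sumTo (coefficient σ (𝐞 j) i p) p
    im-U i j p = trans (partialSum-seq (λ m → im (term i j m)) p p) (sumTo-cong p (λ m _ → im-term i j m p))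

    module Column (cosτ≈0 : Cos τ 0ℝ) where
      open Trigonometry τ cosτ≈0

      -- exp (i τ L) f = g
      Maps : Vector ℚ k → Vector ℚ k → Set
      Maps f g = ∀ i → Lim (λ p → sumTo (coefficient κ f i p) p) (g i) × Lim (λ p → sumTo (coefficient σ f i p) p) 0ℚ

      private
        sum-cong : ∀ (s : ℕ → ℚ) {f g} → f ≋ g → ∀ i p → sumTo (coefficient s f i p) p ≡ sumTo (coefficient s g i p) p
        sum-cong s f≋g i p = sumTo-cong p (λ m _ → cong (λ t → s m * t * expTerm (seq τ p) m) (iterate-cong m f≋g i))

        sum-+ : ∀ (s : ℕ → ℚ) f g i p →
          sumTo (coefficient s f i p) p + sumTo (coefficient s g i p) p ≡ sumTo (coefficient s (f +ᵥ g) i p) p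
        sum-+ s f g i p = trans (sym (sumTo-+ (coefficient s f i p) (coefficient s g i p) p))
          (sumTo-cong p (λ m _ → trans (expand (s m) (iterate m f i) (iterate m g i) (expTerm (seq τ p) m))
            (cong (λ t → s m * t * expTerm (seq τ p) m) (sym (iterate-+ m f g i)))))
          where
          expand : ∀ s a b t → s * a * t + s * b * t ≡ s * (a + b) * t
          expand = solve-∀ ℚ-acr

        sum-· : ∀ (s : ℕ → ℚ) c f i p → c * sumTo (coefficient s f i p) p ≡ sumTo (coefficient s (c · f) i p) p
        sum-· s c f i p = trans (sym (sumTo-* c (coefficient s f i p) p))
          (sumTo-cong p (λ m _ → trans (regroup c (s m) (iterate m f i) (expTerm (seq τ p) m))
            (cong (λ t → s m * t * expTerm (seq τ p) m) (sym (iterate-· m c f i)))))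
          where
          regroup : ∀ c s a t → c * (s * a * t) ≡ s * (c * a) * t
          regroup = solve-∀ ℚ-acr

        sum-eigen : ∀ (s : ℕ → ℚ) θ x → L *ᵥ x ≋ θ · x → ∀ i p →
          x i * sumTo (λ m → s m * expTerm (θ * seq τ p) m) p ≡ sumTo (coefficient s x i p) p
        sum-eigen s θ x Lx≋θx i p = trans (sym (sumTo-* (x i) (λ m → s m * expTerm (θ * seq τ p) m) p))
          (sumTo-cong p (λ m _ → trans (cong (λ t → x i * (s m * t)) (expTerm-scale θ (seq τ p) m))
            (trans (regroup (x i) (s m) (pow θ m) (expTerm (seq τ p) m))
              (cong (λ t → s m * t * expTerm (seq τ p) m) (sym (iterate-eigen m θ x Lx≋θx i))))))
          where
          regroup : ∀ x s q t → x * (s * (q * t)) ≡ s * (q * x) * t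
          regroup = solve-∀ ℚ-acr

      maps-cong : ∀ {f f′ g g′} → f ≋ f′ → g ≋ g′ → Maps f g → Maps f′ g′
      maps-cong {f} {f′} {g} {g′} f≋f′ g≋g′ h i =
        subst (Lim (λ p → sumTo (coefficient κ f′ i p) p)) (g≋g′ i)
          (lim-cong {λ p → sumTo (coefficient κ f i p) p} {λ p → sumTo (coefficient κ f′ i p) p} {g i} (sum-cong κ f≋f′ i) (proj₁ (h i))) ,
        lim-cong {λ p → sumTo (coefficient σ f i p) p} {λ p → sumTo (coefficient σ f′ i p) p} {0ℚ} (sum-cong σ f≋f′ i) (proj₂ (h i))

      maps-· : ∀ {f g} c → Maps f g → Maps (c · f) (c · g)
      maps-· {f} {g} c h i =
        lim-cong {λ p → c * sumTo (coefficient κ f i p) p} {λ p → sumTo (coefficient κ (c · f) i p) p} {c * g i} (sum-· κ c f i)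
          (lim-* {λ _ → c} {λ p → sumTo (coefficient κ f i p) p} {c} {g i} (const-bounded c) (lim-const c) (proj₁ (h i))) ,
        subst (Lim (λ p → sumTo (coefficient σ (c · f) i p) p)) (ℚ.*-zeroʳ c)
          (lim-cong {λ p → c * sumTo (coefficient σ f i p) p} {λ p → sumTo (coefficient σ (c · f) i p) p} {c * 0ℚ} (sum-· σ c f i)
            (lim-* {λ _ → c} {λ p → sumTo (coefficient σ f i p) p} {c} {0ℚ} (const-bounded c) (lim-const c) (proj₂ (h i))))

      maps-+ : ∀ {f f′ g g′} → Maps f g → Maps f′ g′ → Maps (f +ᵥ f′) (g +ᵥ g′)
      maps-+ {f} {f′} {g} {g′} h h′ i =
        lim-cong {λ p → sumTo (coefficient κ f i p) p + sumTo (coefficient κ f′ i p) p} {λ p → sumTo (coefficient κ (f +ᵥ f′) i p) p} {g i + g′ i}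
          (sum-+ κ f f′ i)
          (lim-+ {λ p → sumTo (coefficient κ f i p) p} {λ p → sumTo (coefficient κ f′ i p) p} {g i} {g′ i} (proj₁ (h i)) (proj₁ (h′ i))) ,
        lim-cong {λ p → sumTo (coefficient σ f i p) p + sumTo (coefficient σ f′ i p) p} {λ p → sumTo (coefficient σ (f +ᵥ f′) i p) p} {0ℚ}
          (sum-+ σ f f′ i)
          (lim-+ {λ p → sumTo (coefficient σ f i p) p} {λ p → sumTo (coefficient σ f′ i p) p} {0ℚ} {0ℚ} (proj₂ (h i)) (proj₂ (h′ i)))

      maps-eigen : ∀ {θ c} x → L *ᵥ x ≋ θ · x → Unit θ c → Maps x (c · x)
      maps-eigen {θ} {c} x Lx≋θx (Cθ , Sθ) i =
        subst (Lim (λ p → sumTo (coefficient κ x i p) p)) (ℚ.*-comm (x i) c)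
          (lim-cong {λ p → x i * C θ p} {λ p → sumTo (coefficient κ x i p) p} {x i * c} (sum-eigen κ θ x Lx≋θx i)
            (lim-* {λ _ → x i} {C θ} {x i} {c} (const-bounded (x i)) (lim-const (x i)) Cθ)) ,
        subst (Lim (λ p → sumTo (coefficient σ x i p) p)) (ℚ.*-zeroʳ (x i))
          (lim-cong {λ p → x i * S θ p} {λ p → sumTo (coefficient σ x i p) p} {x i * 0ℚ} (sum-eigen σ θ x Lx≋θx i)
            (lim-* {λ _ → x i} {S θ} {x i} {0ℚ} (const-bounded (x i)) (lim-const (x i)) Sθ))

      maps-0 : ∀ {f} → f ≋ 𝟎 → Maps f 𝟎
      maps-0 {f} f≋0 = maps-cong {𝟎} {f} {1ℚ · 𝟎} {𝟎} (λ i → sym (f≋0 i)) (λ i → ℚ.*-zeroʳ 1ℚ)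
        (maps-eigen {0ℚ} {1ℚ} 𝟎 (λ i → trans (dot-0ʳ (L i)) (sym (ℚ.*-zeroʳ 0ℚ))) unit-0)

      re-column : ∀ {g} a → Maps (𝐞 a) g → ∀ i → Lim (seq (re (U i a))) (g i)
      re-column {g} a h i = lim-cong {λ p → sumTo (coefficient κ (𝐞 a) i p) p} {seq (re (U i a))} {g i}
        (λ p → sym (re-U i a p)) (proj₁ (h i))

      im-column : ∀ {g} a → Maps (𝐞 a) g → ∀ i → Lim (seq (im (U i a))) 0ℚ
      im-column {g} a h i = lim-cong {λ p → sumTo (coefficient σ (𝐞 a) i p) p} {seq (im (U i a))} {0ℚ}
        (λ p → sym (im-U i a p)) (proj₂ (h i))

      -- From here on the exponential is known only by the property `P` and by the limits of those
      -- columns whose images under `Maps` have been found.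
      packColumns : (P : Mℂ.Matrix k → Set) → P U → ∃[ W ] P W
        × (∀ {g} a → Maps (𝐞 a) g → ∀ i → Lim (seq (re (W i a))) (g i))
        × (∀ {g} a → Maps (𝐞 a) g → ∀ i → Lim (seq (im (W i a))) 0ℚ)
      packColumns P u = U , u , (λ {g} → re-column {g}) , (λ {g} → im-column {g})

-- Transition matrices of graphs; perfect state transfer and periodicity from column limits.

module TransitionMatrices where

  open import Data.Rational.Base
  open ≡
  open Defs using (_+i_)
  open Rationals
  open Reals
  open RationalVectors
  open IntegralSupport
  open ExponentialSums
  open Convergence
  open MatrixExponentials
  open LAℚ using (𝐞; sum-cong-≋; dot-𝐞ˡ)

  column-re : ∀ {k} {f : Vector ℂ k} (W : Mℂ.Matrix k) a i p →
    (∀ j → seq (re (f j)) p ≡ seq (re (W i j)) p * seq (re (Mℂ.𝐞 a j)) p + - (seq (im (W i j)) p * seq (im (Mℂ.𝐞 a j)) p)) →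
    seq (re (Sℂ.sum f)) p ≡ seq (re (W i a)) p
  column-re {k} {f} W a i p eq = trans (re-sum-seq f p) (trans (sum-cong-≋ (λ j → trans (eq j)
      (trans (cong₂ (λ s t → seq (re (W i j)) p * s + - (seq (im (W i j)) p * t)) (𝐞-re-seq a j p) (𝐞-im-seq a j p))
        (simplify (seq (re (W i j)) p) (seq (im (W i j)) p) (𝐞 a j)))))
    (dot-𝐞ˡ a (λ j → seq (re (W i j)) p)))
    where
    simplify : ∀ x y d → x * d + - (y * 0ℚ) ≡ d * x
    simplify = solve-∀ ℚ-acr

  column-im : ∀ {k} {f : Vector ℂ k} (W : Mℂ.Matrix k) a i p →
    (∀ j → seq (im (f j)) p ≡ seq (re (W i j)) p * seq (im (Mℂ.𝐞 a j)) p + seq (im (W i j)) p * seq (re (Mℂ.𝐞 a j)) p) →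
    seq (im (Sℂ.sum f)) p ≡ seq (im (W i a)) p
  column-im {k} {f} W a i p eq = trans (im-sum-seq f p) (trans (sum-cong-≋ (λ j → trans (eq j)
      (trans (cong₂ (λ s t → seq (re (W i j)) p * t + seq (im (W i j)) p * s) (𝐞-re-seq a j p) (𝐞-im-seq a j p))
        (simplify (seq (re (W i j)) p) (seq (im (W i j)) p) (𝐞 a j)))))
    (dot-𝐞ˡ a (λ j → seq (im (W i j)) p)))
    where
    simplify : ∀ x y d → x * 0ℚ + y * d ≡ d * y
    simplify = solve-∀ ℚ-acr

  unit-multiple : ∀ {k} (b i : Fin k) p →
    seq (re ((RawRing.1# ℂ-rawRing Mℂ.· Mℂ.𝐞 b) i)) p ≡ 𝐞 b i × seq (im ((RawRing.1# ℂ-rawRing Mℂ.· Mℂ.𝐞 b) i)) p ≡ 0ℚ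
  unit-multiple b i p =
    trans (cong₂ (λ s t → 1ℚ * s + - (0ℚ * t)) (𝐞-re-seq b i p) (𝐞-im-seq b i p)) (simplify₁ (𝐞 b i)) ,
    trans (cong₂ (λ s t → 1ℚ * t + 0ℚ * s) (𝐞-re-seq b i p) (𝐞-im-seq b i p)) (simplify₂ (𝐞 b i))
    where
    simplify₁ : ∀ d → 1ℚ * d + - (0ℚ * 0ℚ) ≡ d
    simplify₁ = solve-∀ ℚ-acr
    simplify₂ : ∀ d → 1ℚ * 0ℚ + 0ℚ * d ≡ 0ℚ
    simplify₂ = solve-∀ ℚ-acr

  limit⇒modulus : ∀ z → Lim (seq (re z)) 1ℚ → Lim (seq (im z)) 0ℚ → HasModulus z 1ℝ
  limit⇒modulus z re→1 im→0 =
    (λ (mk< g 0<g (N , h)) → ℚ.<-irrefl refl (ℚ.<-≤-trans (ℚ.<-trans 0<1 (<-shift g 0<g refl)) (h N ℕ.≤-refl))) ,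
    mk≈ (null-cong {λ p → - ((seq (re z) p * seq (re z) p + seq (im z) p * seq (im z) p) - (1ℚ * 1ℚ + 0ℚ * 0ℚ))}
      (λ p → flip (seq (re z) p * seq (re z) p + seq (im z) p * seq (im z) p))
      (null-neg {λ p → (seq (re z) p * seq (re z) p + seq (im z) p * seq (im z) p) - (1ℚ * 1ℚ + 0ℚ * 0ℚ)}
        (lim-+ {λ p → seq (re z) p * seq (re z) p} {λ p → seq (im z) p * seq (im z) p} {1ℚ * 1ℚ} {0ℚ * 0ℚ}
          (lim-* {seq (re z)} {seq (re z)} {1ℚ} {1ℚ} (seq-bounded (re z)) re→1 re→1)
          (lim-* {seq (im z)} {seq (im z)} {0ℚ} {0ℚ} (seq-bounded (im z)) im→0 im→0))))
    where
    flip : ∀ s → - (s - (1ℚ * 1ℚ + 0ℚ * 0ℚ)) ≡ 1ℚ * 1ℚ - s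
    flip = solve-∀ ℚ-acr

  module Transition {k} (H : Graph k) (τ : ℝ) where
    private
      A : Mℂ.Matrix k
      A a b = 0ℝ +i (τ ℝ.* fromℚ (laplacianℚ H a b))

      re-A : ∀ a b p → seq (re (A a b)) p ≡ 0ℚ
      re-A _ _ _ = refl
      im-A : ∀ a b p → seq (im (A a b)) p ≡ seq τ p * laplacianℚ H a b
      im-A _ _ _ = refl

    open Exponential (laplacianℚ H) τ A re-A im-A public

    private
      re-itL : ∀ t l → (0ℚ * t + - (1ℚ * 0ℚ)) * l + - ((0ℚ * 0ℚ + 1ℚ * t) * 0ℚ) ≡ 0ℚ
      re-itL = solve-∀ ℚ-acr
      im-itL : ∀ t l → (0ℚ * t + - (1ℚ * 0ℚ)) * 0ℚ + (0ℚ * 0ℚ + 1ℚ * t) * l ≡ t * l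
      im-itL = solve-∀ ℚ-acr

      re-hyp : ∀ a b p → (0ℚ * seq τ p + - (1ℚ * 0ℚ)) * seq (laplacian H a b) p + - ((0ℚ * 0ℚ + 1ℚ * seq τ p) * 0ℚ) ≡ 0ℚ
      re-hyp a b p = re-itL (seq τ p) (seq (laplacian H a b) p)
      im-hyp : ∀ a b p → (0ℚ * seq τ p + - (1ℚ * 0ℚ)) * 0ℚ + (0ℚ * 0ℚ + 1ℚ * seq τ p) * seq (laplacian H a b) p ≡ seq τ p * laplacianℚ H a b
      im-hyp a b p = trans (im-itL (seq τ p) (seq (laplacian H a b) p)) (cong (seq τ p *_) (laplacian-seq H a b p))

    private
      transfer-≤ : ∀ {s : ℕ → ℝ} {n p q} (c : ℕ → ℚ) → (∀ m → seq (s m) p ≡ c m) → q ≤ sumTo c n → q ≤ seq (partialSum s n) p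
      transfer-≤ {s} {n} {p} {q} c eq = subst (q ≤_) (sym (trans (partialSum-seq s n p) (sumTo-cong n (λ m _ → eq m))))

      transfer-≥ : ∀ {s : ℕ → ℝ} {n p g q} (c : ℕ → ℚ) → (∀ m → seq (s m) p ≡ c m) → sumTo c n + g ≤ q → seq (partialSum s n) p + g ≤ q
      transfer-≥ {s} {n} {p} {g} {q} c eq = subst (λ t → t + g ≤ q) (sym (trans (partialSum-seq s n p) (sumTo-cong n (λ m _ → eq m))))

      module _ {s : ℕ → ℝ} {x : ℝ} (c : ℕ → ℕ → ℚ) (eq : ∀ m p → seq (s m) p ≡ c p m) (h : HasSum s x) where
        -- The inequalities of convergence, stated for rational partial sums and with one gap, the
        -- smaller of the two, for both sides. The series of the simplified matrix and of the
        -- literal iτL have the same rational terms at every stage, so these bounds carry `HasSum`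
        -- from one to the other.
        RationalBounds : ℝ → ℕ → Set
        RationalBounds ε n = ∃[ g ] 0ℚ < g × Eventually (λ p →
          (seq x p + - seq ε p) + g ≤ sumTo (c p) n × sumTo (c p) n + g ≤ seq x p + seq ε p)

        rational-bounds : ∀ ε → 0ℝ ℝ.< ε → ∃[ N ] (∀ n → N ℕ.≤ n → RationalBounds ε n)
        rational-bounds ε 0<ε = let N , near = h ε 0<ε in N , λ n N≤n →
          let lo , hi = near n N≤n
          in common n (gap lo) (gap hi) (gap>0 lo) (gap>0 hi) (separated lo) (separated hi)
          where
          sums : ∀ n p → seq (partialSum s n) p ≡ sumTo (c p) n
          sums n p = trans (partialSum-seq s n p) (sumTo-cong n (λ m _ → eq m p))
          common : ∀ n g g′ → 0ℚ < g → 0ℚ < g′ →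
            Eventually (λ p → (seq x p + - seq ε p) + g ≤ seq (partialSum s n) p) →
            Eventually (λ p → seq (partialSum s n) p + g′ ≤ seq x p + seq ε p) → RationalBounds ε n
          common n g g′ 0<g 0<g′ (P , lo) (Q , hi) with ℚ.≤-total g g′
          ... | inj₁ g≤g′ = g , 0<g , P ℕ.⊔ Q , λ p h →
                subst ((seq x p + - seq ε p) + g ≤_) (sums n p) (lo p (ℕ.m⊔n≤o⇒m≤o P Q h)) ,
                ℚ.≤-trans (ℚ.+-monoʳ-≤ (sumTo (c p) n) g≤g′) (subst (λ t → t + g′ ≤ seq x p + seq ε p) (sums n p) (hi p (ℕ.m⊔n≤o⇒n≤o P Q h)))
          ... | inj₂ g′≤g = g′ , 0<g′ , P ℕ.⊔ Q , λ p h →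
                ℚ.≤-trans (ℚ.+-monoʳ-≤ (seq x p + - seq ε p) g′≤g) (subst ((seq x p + - seq ε p) + g ≤_) (sums n p) (lo p (ℕ.m⊔n≤o⇒m≤o P Q h))) ,
                subst (λ t → t + g′ ≤ seq x p + seq ε p) (sums n p) (hi p (ℕ.m⊔n≤o⇒n≤o P Q h))

    isTransition : IsTransitionMatrix H τ (Exponential.U (laplacianℚ H) τ A re-A im-A)
    isTransition i j =
      (λ ε 0<ε → let N , near = rational-bounds {λ m → re (term i j m)} {Re.diagonal i j} (coefficient κ (𝐞 j) i) (re-term i j) (Re.hasSum i j) ε 0<ε
        in N , λ n N≤n → let g , 0<g , P , bounds = near n N≤n in
          mk< g 0<g (P , λ p P≤p → transfer-≤ {n = n} (coefficient κ (𝐞 j) i p)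
            (λ m → Exponential.re-term (laplacianℚ H) τ _ re-hyp im-hyp i j m p) (proj₁ (bounds p P≤p))) ,
          mk< g 0<g (P , λ p P≤p → transfer-≥ {n = n} (coefficient κ (𝐞 j) i p)
            (λ m → Exponential.re-term (laplacianℚ H) τ _ re-hyp im-hyp i j m p) (proj₂ (bounds p P≤p)))) ,
      (λ ε 0<ε → let N , near = rational-bounds {λ m → im (term i j m)} {Im.diagonal i j} (coefficient σ (𝐞 j) i) (im-term i j) (Im.hasSum i j) ε 0<ε
        in N , λ n N≤n → let g , 0<g , P , bounds = near n N≤n in
          mk< g 0<g (P , λ p P≤p → transfer-≤ {n = n} (coefficient σ (𝐞 j) i p)
            (λ m → Exponential.im-term (laplacianℚ H) τ _ re-hyp im-hyp i j m p) (proj₁ (bounds p P≤p))) ,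
          mk< g 0<g (P , λ p P≤p → transfer-≥ {n = n} (coefficient σ (𝐞 j) i p)
            (λ m → Exponential.im-term (laplacianℚ H) τ _ re-hyp im-hyp i j m p) (proj₂ (bounds p P≤p))))

    module _ (cosτ≈0 : Cos τ 0ℝ) where
      open Column cosτ≈0

      TransitionMatrix : Set
      TransitionMatrix = ∃[ W ] IsTransitionMatrix H τ W
        × (∀ {g} a → Maps (𝐞 a) g → ∀ i → Lim (seq (re (W i a))) (g i))
        × (∀ {g} a → Maps (𝐞 a) g → ∀ i → Lim (seq (im (W i a))) 0ℚ)

      transitionMatrix : TransitionMatrix
      transitionMatrix = Exponential.Column.packColumns (laplacianℚ H) τ A re-A im-A cosτ≈0 (IsTransitionMatrix H τ) isTransition

  module _ {k} (H : Graph k) (τ : ℝ) (cosτ≈0 : Cos τ 0ℝ) where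
    open Transition H τ using (module Column; TransitionMatrix; transitionMatrix)
    open Column cosτ≈0 using (Maps)

    maps⇒PST : ∀ a b → Maps (𝐞 a) (𝐞 b) → LaplacianPST H τ a b
    maps⇒PST a b maps = from-matrix (transitionMatrix cosτ≈0)
      where
      from-matrix : TransitionMatrix cosτ≈0 → LaplacianPST H τ a b
      from-matrix (W , isTransition , re-column , im-column) = W , isTransition , RawRing.1# ℂ-rawRing ,
        λ i →
          mk≈ (null-cong {λ p → seq (re (W i a)) p - 𝐞 b i}
            (λ p → cong₂ _-_ (sym (column-re {k} W a i p (λ j → refl))) (sym (proj₁ (unit-multiple b i p)))) (re-column {𝐞 b} a maps i)) ,
          mk≈ (null-cong {λ p → seq (im (W i a)) p - 0ℚ}
            (λ p → cong₂ _-_ (sym (column-im {k} W a i p (λ j → refl))) (sym (proj₂ (unit-multiple b i p)))) (im-column {𝐞 b} a maps i))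

    maps⇒periodic : 0ℝ ℝ.< τ → ∀ a → Maps (𝐞 a) (𝐞 a) → PeriodicAt H τ a
    maps⇒periodic 0<τ a maps = from-matrix (transitionMatrix cosτ≈0)
      where
      from-matrix : TransitionMatrix cosτ≈0 → PeriodicAt H τ a
      from-matrix (W , isTransition , re-column , im-column) = 0<τ , W , isTransition ,
        limit⇒modulus (W a a)
          (subst (Lim (seq (re (W a a)))) (𝐞-self a) (re-column {𝐞 a} a maps a))
          (im-column {𝐞 a} a maps a)

-- Eigenvectors of the blow-up with an added matching.

module BlowUps where

  open import Data.Fin.Base using (combine; remainder; quotient; _↑ˡ_; _↑ʳ_)
  open import Data.Rational.Base
  open ≡
  open Defs using (_∼[_]_; blowUp; _∪_; IsMatching; Copies)
  open Rationals
  open RationalVectors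
  open IntegralSupport
  open LAℚ

  sum-↑ : ∀ m n (f : Fin (m ℕ.+ n) → ℚ) → sum f ≡ sum (λ i → f (i ↑ˡ n)) + sum (λ j → f (m ↑ʳ j))
  sum-↑ zero    n f = sym (ℚ.+-identityˡ (sum f))
  sum-↑ (suc m) n f = trans (cong (f zero +_) (sum-↑ m n (f ∘ suc)))
    (sym (ℚ.+-assoc (f zero) (sum (λ i → f (suc (i ↑ˡ n)))) (sum (λ j → f (suc (m ↑ʳ j))))))

  remainder-combine : ∀ {n k} (i : Fin n) (j : Fin k) → remainder {n} k (combine i j) ≡ j
  remainder-combine i j = cong proj₂ (Fin.remQuot-combine i j)

  remainder-↑ʳ : ∀ n {k} (c : Fin (n ℕ.* k)) → remainder {suc n} k (k ↑ʳ c) ≡ remainder {n} k c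
  remainder-↑ʳ n {k} c = trans (cong (λ c → remainder {suc n} k (k ↑ʳ c)) (sym (Fin.combine-remQuot {n} k c)))
    (remainder-combine {suc n} (suc (quotient {n} k c)) (remainder {n} k c))

  sum-remainder : ∀ n {k} (h : Vector ℚ k) → sum (λ c → h (remainder {n} k c)) ≡ ι n * sum h
  sum-remainder zero        h = sym (ℚ.*-zeroˡ (sum h))
  sum-remainder (suc n) {k} h = begin
    sum (λ c → h (remainder {suc n} k c))
      ≡⟨ sum-↑ k (n ℕ.* k) (λ c → h (remainder {suc n} k c)) ⟩
    sum (λ j → h (remainder {suc n} k (j ↑ˡ (n ℕ.* k)))) + sum (λ c → h (remainder {suc n} k (k ↑ʳ c)))
      ≡⟨ cong₂ _+_ (sum-cong-≋ (λ j → cong h (remainder-combine {suc n} zero j)))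
                   (trans (sum-cong-≋ (λ c → cong h (remainder-↑ʳ n c))) (sum-remainder n h)) ⟩
    sum h + ι n * sum h
      ≡⟨ expand (sum h) (ι n) ⟩
    (1ℚ + ι n) * sum h ∎
    where
    open ≡-Reasoning
    expand : ∀ s n → s + n * s ≡ (1ℚ + n) * s
    expand = solve-∀ ℚ-acr

  𝐞-off : ∀ {k} {i j : Fin k} → i ≢ j → 𝐞 i j ≡ 0ℚ
  𝐞-off {i = zero}  {zero}  i≢j = contradiction refl i≢j
  𝐞-off {i = zero}  {suc j} i≢j = refl
  𝐞-off {i = suc i} {zero}  i≢j = refl
  𝐞-off {i = suc i} {suc j} i≢j = 𝐞-off (i≢j ∘ cong suc)

  sum-𝐞 : ∀ {k} (i : Fin k) → sum (𝐞 i) ≡ 1ℚ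
  sum-𝐞 i = trans (sum-cong-≋ (λ j → sym (ℚ.*-identityʳ (𝐞 i j)))) (dot-𝐞ˡ i (λ _ → 1ℚ))

  -- The Laplacian as a sum of differences over neighbours. In this form it is visibly additive in
  -- the adjacency matrix, and visibly zero on functions that are constant along edges.
  Δ : ∀ {k} → Graph k → Vector ℚ k → Vector ℚ k
  Δ H f a = sum (λ b → adjℚ H a b * (f a - f b))

  laplacian≋Δ : ∀ {k} (H : Graph k) f → laplacianℚ H *ᵥ f ≋ Δ H f
  laplacian≋Δ H f a = begin
    sum (λ b → ((if does (a Fin.≟ b) then degℚ H a else 0ℚ) - adjℚ H a b) * f b)
      ≡⟨ sum-cong-≋ (λ b → cong (λ t → (t - adjℚ H a b) * f b) (diagonal-entry b)) ⟩
    dot (degℚ H a · 𝐞 a -ᵥ adjℚ H a) f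
      ≡⟨ trans (dot--ˡ (degℚ H a · 𝐞 a) (adjℚ H a) f) (cong (_- dot (adjℚ H a) f)
           (trans (dot-·ˡ (degℚ H a) (𝐞 a) f) (cong (degℚ H a *_) (dot-𝐞ˡ a f)))) ⟩
    degℚ H a * f a - dot (adjℚ H a) f
      ≡⟨ cong (_- dot (adjℚ H a) f) (*-distribʳ-sum (f a) (adjℚ H a)) ⟩
    dot (adjℚ H a) (λ _ → f a) - dot (adjℚ H a) f
      ≡⟨ sym (dot--ʳ (adjℚ H a) (λ _ → f a) f) ⟩
    Δ H f a ∎
    where
    open ≡-Reasoning
    diagonal-entry : ∀ b → (if does (a Fin.≟ b) then degℚ H a else 0ℚ) ≡ degℚ H a * 𝐞 a b
    diagonal-entry b with does (a Fin.≟ b)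
    ... | true  = sym (ℚ.*-identityʳ (degℚ H a))
    ... | false = sym (ℚ.*-zeroʳ (degℚ H a))

  adj-true : ∀ {k} (H : Graph k) {a b} → a ∼[ H ] b → adjℚ H a b ≡ 1ℚ
  adj-true H eq rewrite eq = refl

  Edge? : ∀ {k} (H : Graph k) a b → a ∼[ H ] b ⊎ adjℚ H a b ≡ 0ℚ
  Edge? H a b with adj H a b
  ... | true  = inj₁ refl
  ... | false = inj₂ refl

  Δ-constant-on-edges : ∀ {k} (H : Graph k) f → (∀ a b → a ∼[ H ] b → f a ≡ f b) → Δ H f ≋ 𝟎
  Δ-constant-on-edges {k} H f const a = trans (sum-cong-≋ (λ b → term b (Edge? H a b))) (sum-replicate-zero k)
    where
    term : ∀ b → a ∼[ H ] b ⊎ adjℚ H a b ≡ 0ℚ → adjℚ H a b * (f a - f b) ≡ 0ℚ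
    term b (inj₁ a∼b) = trans (cong (λ t → adjℚ H a b * (t - f b)) (const a b a∼b))
      (trans (cong (adjℚ H a b *_) (ℚ.+-inverseʳ (f b))) (ℚ.*-zeroʳ (adjℚ H a b)))
    term b (inj₂ none) = trans (cong (_* (f a - f b)) none) (ℚ.*-zeroˡ (f a - f b))

  degree-natural : ∀ {k} (H : Graph k) a → ∃[ d ] degℚ H a ≡ ι d
  degree-natural H a = count (adj H a)
    where
    count : ∀ {k} (b : Fin k → Bool) → ∃[ d ] sum (λ i → if b i then 1ℚ else 0ℚ) ≡ ι d
    count {zero}  b = 0 , refl
    count {suc k} b with b zero | count (b ∘ suc)
    ... | true  | d , eq = suc d , cong (1ℚ +_) eq
    ... | false | d , eq = d , trans (ℚ.+-identityˡ _) eq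

  module MatchedBlowUp {k} (G : Graph k) (n : ℕ) (v : Fin k) (M : Graph (n ℕ.* k)) (matching : IsMatching M)
    (inside : ∀ a b → a ∼[ M ] b → a ∈ Copies n v × b ∈ Copies n v) where

    X : Graph (n ℕ.* k)
    X = blowUp n G ∪ M

    π : Fin (n ℕ.* k) → Fin k
    π = remainder {n} k

    copies⇒π : ∀ {a} → a ∈ Copies n v → π a ≡ v
    copies⇒π (j , refl) = remainder-combine j v

    edge-πˡ : ∀ {a b} → a ∼[ M ] b → π a ≡ v
    edge-πˡ {a} {b} a∼b = copies⇒π (proj₁ (inside a b a∼b))

    edge-πʳ : ∀ {a b} → a ∼[ M ] b → π b ≡ v
    edge-πʳ {a} {b} a∼b = copies⇒π (proj₂ (inside a b a∼b))

    -- The blow-up has no edges inside the copies of v, so M adds only new edges.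
    adj-X : ∀ a b → adjℚ X a b ≡ adjℚ G (π a) (π b) + adjℚ M a b
    adj-X a b with adj M a b in eq
    ... | true rewrite edge-πˡ {a} {b} eq | edge-πʳ {a} {b} eq | irrefl G v = refl
    ... | false with adj G (π a) (π b)
    ...   | true  = refl
    ...   | false = refl

    Δ↑ : Vector ℚ (n ℕ.* k) → Vector ℚ (n ℕ.* k)
    Δ↑ f a = sum (λ b → adjℚ G (π a) (π b) * (f a - f b))

    laplacian-X : ∀ f → laplacianℚ X *ᵥ f ≋ Δ↑ f +ᵥ Δ M f
    laplacian-X f a = trans (laplacian≋Δ X f a) (trans
      (sum-cong-≋ (λ b → trans (cong (_* (f a - f b)) (adj-X a b)) (ℚ.*-distribʳ-+ (f a - f b) (adjℚ G (π a) (π b)) (adjℚ M a b))))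
      (∑-distrib-+ (λ b → adjℚ G (π a) (π b) * (f a - f b)) (λ b → adjℚ M a b * (f a - f b))))

    -- Every neighbour in G occurs in n copies, whence the factor n. The matching joins copies of
    -- the same vertex, along which x ∘ π is constant, so it contributes nothing.
    lift-eigenvector : ∀ θ x → laplacianℚ G *ᵥ x ≋ θ · x → laplacianℚ X *ᵥ (x ∘ π) ≋ (ι n * θ) · (x ∘ π)
    lift-eigenvector θ x Lx≋θx a = begin
      (laplacianℚ X *ᵥ (x ∘ π)) a            ≡⟨ laplacian-X (x ∘ π) a ⟩
      Δ↑ (x ∘ π) a + Δ M (x ∘ π) a           ≡⟨ cong₂ _+_ (sum-remainder n (λ w → adjℚ G (π a) w * (x (π a) - x w)))
                                                  (Δ-constant-on-edges M (x ∘ π) (λ a b a∼b → cong x (trans (edge-πˡ {a} {b} a∼b) (sym (edge-πʳ {a} {b} a∼b)))) a) ⟩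
      ι n * Δ G x (π a) + 0ℚ                 ≡⟨ ℚ.+-identityʳ _ ⟩
      ι n * Δ G x (π a)                      ≡⟨ cong (ι n *_) (trans (sym (laplacian≋Δ G x (π a))) (Lx≋θx (π a))) ⟩
      ι n * (θ * x (π a))                    ≡⟨ sym (ℚ.*-assoc (ι n) θ (x (π a))) ⟩
      ι n * θ * x (π a)                      ∎
      where open ≡-Reasoning

    -- Functions on the copies of v with sum zero are seen by the blow-up only through degrees.
    fibre-eigenvector : ∀ m f → (∀ c → π c ≢ v → f c ≡ 0ℚ) → sum f ≡ 0ℚ → Δ M f ≋ m · f →
      laplacianℚ X *ᵥ f ≋ (ι n * degℚ G v + m) · f
    fibre-eigenvector m f support total Mf a = begin
      (laplacianℚ X *ᵥ f) a                          ≡⟨ laplacian-X f a ⟩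
      Δ↑ f a + Δ M f a                               ≡⟨ cong₂ _+_ up (Mf a) ⟩
      ι n * degℚ G v * f a + m * f a                 ≡⟨ sym (ℚ.*-distribʳ-+ (f a) (ι n * degℚ G v) m) ⟩
      (ι n * degℚ G v + m) * f a                     ∎
      where
      open ≡-Reasoning
      α : Vector ℚ (n ℕ.* k)
      α b = adjℚ G (π a) (π b)
      only-v : ∀ b → Dec (π b ≡ v) → α b * f b ≡ adjℚ G (π a) v * f b
      only-v b (yes πb≡v) = cong (λ w → adjℚ G (π a) w * f b) πb≡v
      only-v b (no  πb≢v) = trans (cong (α b *_) (support b πb≢v)) (trans (ℚ.*-zeroʳ (α b))
        (sym (trans (cong (adjℚ G (π a) v *_) (support b πb≢v)) (ℚ.*-zeroʳ (adjℚ G (π a) v)))))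
      degree : Dec (π a ≡ v) → degℚ G (π a) * f a ≡ degℚ G v * f a
      degree (yes πa≡v) = cong (λ w → degℚ G w * f a) πa≡v
      degree (no  πa≢v) = trans (cong (degℚ G (π a) *_) (support a πa≢v)) (trans (ℚ.*-zeroʳ (degℚ G (π a)))
        (sym (trans (cong (degℚ G v *_) (support a πa≢v)) (ℚ.*-zeroʳ (degℚ G v)))))
      up : Δ↑ f a ≡ ι n * degℚ G v * f a
      up = begin
        dot α (λ b → f a - f b)                      ≡⟨ dot--ʳ α (λ _ → f a) f ⟩
        dot α (λ _ → f a) - dot α f                  ≡⟨ cong₂ _-_
            (trans (sym (*-distribʳ-sum (f a) α)) (cong (_* f a) (sum-remainder n (adjℚ G (π a)))))
            (trans (sum-cong-≋ (λ b → only-v b (π b Fin.≟ v)))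
              (trans (sym (*-distribˡ-sum (adjℚ G (π a) v) f)) (cong (adjℚ G (π a) v *_) total))) ⟩
        ι n * degℚ G (π a) * f a - adjℚ G (π a) v * 0ℚ ≡⟨ simplify (ι n) (degℚ G (π a)) (f a) (adjℚ G (π a) v) ⟩
        ι n * (degℚ G (π a) * f a)                   ≡⟨ cong (ι n *_) (degree (π a Fin.≟ v)) ⟩
        ι n * (degℚ G v * f a)                       ≡⟨ sym (ℚ.*-assoc (ι n) (degℚ G v) (f a)) ⟩
        ι n * degℚ G v * f a                         ∎
        where
        simplify : ∀ n d f g → n * d * f - g * 0ℚ ≡ n * (d * f)
        simplify = solve-∀ ℚ-acr

    fibre : Vector ℚ (n ℕ.* k)
    fibre = 𝐞 v ∘ π

    average : Vector ℚ (n ℕ.* k)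
    average = inv (ι n) · fibre

    -- The vertex serves as evidence that n ≠ 0, so that the n copies of the value 1/n do add up to
    -- 1.
    sum-average : Fin (n ℕ.* k) → sum average ≡ 1ℚ
    sum-average a = trans (sym (*-distribˡ-sum (inv (ι n)) fibre)) (trans
      (cong (inv (ι n) *_) (trans (sum-remainder n (𝐞 v)) (trans (cong (ι n *_) (sum-𝐞 v)) (ℚ.*-identityʳ (ι n)))))
      (inv-inverseˡ (n≢0 n a)))
      where
      n≢0 : ∀ n → Fin (n ℕ.* k) → ι n ≢ 0ℚ
      n≢0 (suc n) _ = pos⇒≢0 (ι-suc-pos n)

    support-average : ∀ c → π c ≢ v → average c ≡ 0ℚ
    support-average c πc≢v = trans (cong (inv (ι n) *_) (𝐞-off (πc≢v ∘ sym))) (ℚ.*-zeroʳ (inv (ι n)))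

    support-𝐞 : ∀ {a} → π a ≡ v → ∀ c → π c ≢ v → 𝐞 a c ≡ 0ℚ
    support-𝐞 πa≡v c πc≢v = 𝐞-off λ a≡c → πc≢v (trans (cong π (sym a≡c)) πa≡v)

    average-constant : ∀ a b → a ∼[ M ] b → average a ≡ average b
    average-constant a b a∼b = cong (λ w → inv (ι n) * 𝐞 v w) (trans (edge-πˡ {a} {b} a∼b) (sym (edge-πʳ {a} {b} a∼b)))

    Δ-0 : ∀ f → Δ M f ≋ 𝟎 → Δ M f ≋ 0ℚ · f
    Δ-0 f Δf≋0 a = trans (Δf≋0 a) (sym (ℚ.*-zeroˡ (f a)))

    isolated-eigenvector : ∀ a → π a ≡ v → (∀ b → ¬ (a ∼[ M ] b)) →
      laplacianℚ X *ᵥ (𝐞 a -ᵥ average) ≋ (ι n * degℚ G v + 0ℚ) · (𝐞 a -ᵥ average)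
    isolated-eigenvector a πa≡v isolated = fibre-eigenvector 0ℚ (𝐞 a -ᵥ average)
      (λ c πc≢v → cong₂ _-_ (support-𝐞 πa≡v c πc≢v) (support-average c πc≢v))
      (trans (∑-distrib-+ (𝐞 a) (λ c → - average c)) (trans (cong₂ _+_ (sum-𝐞 a) (trans (sum-neg average) (cong -_ (sum-average a)))) (ℚ.+-inverseʳ 1ℚ)))
      (Δ-0 (𝐞 a -ᵥ average) (Δ-constant-on-edges M (𝐞 a -ᵥ average) (λ c d c∼d →
        cong₂ _-_ (trans (𝐞-off (λ a≡c → isolated d (subst (λ c → c ∼[ M ] d) (sym a≡c) c∼d)))
                    (sym (𝐞-off (λ a≡d → isolated c (trans (symm M a c) (subst (λ d → c ∼[ M ] d) (sym a≡d) c∼d))))))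
          (average-constant c d c∼d))))
      where
      sum-neg : ∀ {k} (f : Vector ℚ k) → sum (λ c → - f c) ≡ - sum f
      sum-neg {zero}  f = refl
      sum-neg {suc k} f = trans (cong (- f zero +_) (sum-neg (f ∘ suc))) (sym (ℚ.neg-distrib-+ (f zero) (sum (f ∘ suc))))

    module Edge (a b : Fin (n ℕ.* k)) (a∼b : a ∼[ M ] b) where
      b∼a : b ∼[ M ] a
      b∼a = trans (symm M b a) a∼b

      a≢b : a ≢ b
      a≢b refl with trans (sym a∼b) (irrefl M a)
      ... | ()

      sym-part anti-part : Vector ℚ (n ℕ.* k)
      anti-part = 𝐞 a -ᵥ 𝐞 b
      sym-part  = (½ · 𝐞 a +ᵥ ½ · 𝐞 b) -ᵥ average

      -- In a matching, an edge that meets a or b is the edge ab itself, in one of its two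
      -- orientations; all other edges avoid both ends.
      data Position (c d : Fin (n ℕ.* k)) : Set where
        at-ab   : c ≡ a → d ≡ b → Position c d
        at-ba   : c ≡ b → d ≡ a → Position c d
        outside : a ≢ c → b ≢ c → a ≢ d → b ≢ d → Position c d

      position : ∀ c d → c ∼[ M ] d → Position c d
      position c d c∼d with a Fin.≟ c | b Fin.≟ c
      ... | yes refl | _        = at-ab refl (matching a d b c∼d a∼b)
      ... | no  _    | yes refl = at-ba refl (matching b d a c∼d b∼a)
      ... | no  a≢c  | no  b≢c  = outside a≢c b≢c
        (λ a≡d → b≢c (matching a b c a∼b (trans (symm M a c) (subst (λ d → c ∼[ M ] d) (sym a≡d) c∼d))))
        (λ b≡d → a≢c (matching b a c b∼a (trans (symm M b c) (subst (λ d → c ∼[ M ] d) (sym b≡d) c∼d))))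

      halves-constant : ∀ c d → c ∼[ M ] d → ½ * 𝐞 a c + ½ * 𝐞 b c ≡ ½ * 𝐞 a d + ½ * 𝐞 b d
      halves-constant c d c∼d with position c d c∼d
      ... | at-ab refl refl = trans (cong₂ (λ s t → ½ * s + ½ * t) (trans (𝐞-self a) (sym (𝐞-self b))) (trans (𝐞-off (a≢b ∘ sym)) (sym (𝐞-off a≢b))))
              (ℚ.+-comm (½ * 𝐞 b b) (½ * 𝐞 a b))
      ... | at-ba refl refl = trans (cong₂ (λ s t → ½ * s + ½ * t) (trans (𝐞-off a≢b) (sym (𝐞-off (a≢b ∘ sym)))) (trans (𝐞-self b) (sym (𝐞-self a))))
              (ℚ.+-comm (½ * 𝐞 b a) (½ * 𝐞 a a))
      ... | outside a≢c b≢c a≢d b≢d = cong₂ (λ s t → ½ * s + ½ * t)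
              (trans (𝐞-off a≢c) (sym (𝐞-off a≢d))) (trans (𝐞-off b≢c) (sym (𝐞-off b≢d)))

      πa≡v : π a ≡ v
      πa≡v = edge-πˡ {a} {b} a∼b
      πb≡v : π b ≡ v
      πb≡v = edge-πʳ {a} {b} a∼b

      sym-eigenvector : laplacianℚ X *ᵥ sym-part ≋ (ι n * degℚ G v + 0ℚ) · sym-part
      sym-eigenvector = fibre-eigenvector 0ℚ sym-part
        (λ c πc≢v → trans (cong₂ (λ s t → (½ * s + ½ * t) - average c) (support-𝐞 πa≡v c πc≢v) (support-𝐞 πb≡v c πc≢v))
          (trans (cong (λ t → (½ * 0ℚ + ½ * 0ℚ) - t) (support-average c πc≢v)) refl))
        total
        (Δ-0 sym-part (Δ-constant-on-edges M sym-part (λ c d c∼d → cong₂ _-_ (halves-constant c d c∼d) (average-constant c d c∼d))))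
        where
        ones : Vector ℚ (n ℕ.* k)
        ones _ = 1ℚ
        dot-ones : ∀ x → dot ones x ≡ sum x
        dot-ones x = sum-cong-≋ (λ i → ℚ.*-identityˡ (x i))
        total : sum sym-part ≡ 0ℚ
        total = trans (sym (dot-ones sym-part)) (trans (dot--ʳ ones (½ · 𝐞 a +ᵥ ½ · 𝐞 b) average)
          (cong₂ _-_ (trans (dot-+ʳ ones (½ · 𝐞 a) (½ · 𝐞 b)) (cong₂ _+_ (half a) (half b))) (trans (dot-ones average) (sum-average a))))
          where
          half : ∀ c → dot ones (½ · 𝐞 c) ≡ ½ * 1ℚ
          half c = trans (dot-·ʳ ones ½ (𝐞 c)) (cong (½ *_) (trans (dot-ones (𝐞 c)) (sum-𝐞 c)))

      anti-eigenvector : laplacianℚ X *ᵥ anti-part ≋ (ι n * degℚ G v + (1ℚ + 1ℚ)) · anti-part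
      anti-eigenvector = fibre-eigenvector (1ℚ + 1ℚ) anti-part
        (λ c πc≢v → cong₂ _-_ (support-𝐞 πa≡v c πc≢v) (support-𝐞 πb≡v c πc≢v))
        total
        (λ c → trans (sum-cong-≋ (λ d → term c d (Edge? M c d))) (collect c))
        where
        f : Vector ℚ (n ℕ.* k)
        f = anti-part
        total : sum anti-part ≡ 0ℚ
        total = trans (sum-cong-≋ (λ c → cong₂ _-_ (sym (ℚ.*-identityˡ (𝐞 a c))) (sym (ℚ.*-identityˡ (𝐞 b c)))))
          (trans (sum-cong-≋ (λ c → factor (𝐞 a c) (𝐞 b c)))
            (trans (dot--ʳ (λ _ → 1ℚ) (𝐞 a) (𝐞 b)) (cong₂ _-_ (trans (dot-comm (λ _ → 1ℚ) (𝐞 a)) (dot-𝐞ˡ a (λ _ → 1ℚ)))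
              (trans (dot-comm (λ _ → 1ℚ) (𝐞 b)) (dot-𝐞ˡ b (λ _ → 1ℚ))))))
          where
          factor : ∀ x y → 1ℚ * x - 1ℚ * y ≡ 1ℚ * (x - y)
          factor = solve-∀ ℚ-acr
        -- Where e_a - e_b is nonzero, ab is the only edge of M, and the difference along it is ±2.
        -- The right-hand side separates c from d, so that `collect` can sum it over d to 2 (e_a -
        -- e_b).
        term : ∀ c d → c ∼[ M ] d ⊎ adjℚ M c d ≡ 0ℚ →
          adjℚ M c d * (f c - f d) ≡ 𝐞 a c * (𝐞 b d * (1ℚ + 1ℚ)) - 𝐞 b c * (𝐞 a d * (1ℚ + 1ℚ))
        term c d (inj₁ c∼d) with position c d c∼d
        ... | at-ab refl refl = values (adj-true M c∼d) (𝐞-self a) (𝐞-off (a≢b ∘ sym)) (𝐞-off a≢b) (𝐞-self b)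
          where
          values : ∀ {m x y z w} → m ≡ 1ℚ → x ≡ 1ℚ → y ≡ 0ℚ → z ≡ 0ℚ → w ≡ 1ℚ →
            m * ((x - y) - (z - w)) ≡ x * (w * (1ℚ + 1ℚ)) - y * (z * (1ℚ + 1ℚ))
          values refl refl refl refl refl = refl
        ... | at-ba refl refl = values (adj-true M c∼d) (𝐞-off a≢b) (𝐞-self b) (𝐞-self a) (𝐞-off (a≢b ∘ sym))
          where
          values : ∀ {m x y z w} → m ≡ 1ℚ → x ≡ 0ℚ → y ≡ 1ℚ → z ≡ 1ℚ → w ≡ 0ℚ →
            m * ((x - y) - (z - w)) ≡ x * (w * (1ℚ + 1ℚ)) - y * (z * (1ℚ + 1ℚ))
          values refl refl refl refl refl = refl
        ... | outside a≢c b≢c a≢d b≢d = values (adj-true M c∼d) (𝐞-off a≢c) (𝐞-off b≢c) (𝐞-off a≢d) (𝐞-off b≢d)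
          where
          values : ∀ {m x y z w} → m ≡ 1ℚ → x ≡ 0ℚ → y ≡ 0ℚ → z ≡ 0ℚ → w ≡ 0ℚ →
            m * ((x - y) - (z - w)) ≡ x * (w * (1ℚ + 1ℚ)) - y * (z * (1ℚ + 1ℚ))
          values refl refl refl refl refl = refl
        term c d (inj₂ none) = trans (cong (_* (f c - f d)) none) (trans (ℚ.*-zeroˡ (f c - f d)) (sym (vanish none)))
          where
          no-edge : ∀ {x y} → adjℚ M c d ≡ 0ℚ → x ∼[ M ] y → x ≡ c → y ≢ d
          no-edge none x∼y refl refl = ℚ.1≢0 (trans (sym (adj-true M x∼y)) none)
          product-vanish : ∀ x y → (x ≡ c → y ≢ d) → 𝐞 x c * (𝐞 y d * (1ℚ + 1ℚ)) ≡ 0ℚ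
          product-vanish x y apart = by-cases (x Fin.≟ c)
            where
            by-cases : Dec (x ≡ c) → 𝐞 x c * (𝐞 y d * (1ℚ + 1ℚ)) ≡ 0ℚ
            by-cases (yes x≡c) = trans (cong (λ t → 𝐞 x c * (t * (1ℚ + 1ℚ))) (𝐞-off (apart x≡c)))
              (trans (cong (𝐞 x c *_) (ℚ.*-zeroˡ (1ℚ + 1ℚ))) (ℚ.*-zeroʳ (𝐞 x c)))
            by-cases (no  x≢c) = trans (cong (_* (𝐞 y d * (1ℚ + 1ℚ))) (𝐞-off x≢c)) (ℚ.*-zeroˡ (𝐞 y d * (1ℚ + 1ℚ)))
          vanish : adjℚ M c d ≡ 0ℚ → 𝐞 a c * (𝐞 b d * (1ℚ + 1ℚ)) - 𝐞 b c * (𝐞 a d * (1ℚ + 1ℚ)) ≡ 0ℚ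
          vanish none = cong₂ _-_ (product-vanish a b (no-edge none a∼b)) (product-vanish b a (no-edge none b∼a))
        collect : ∀ c → sum (λ d → 𝐞 a c * (𝐞 b d * (1ℚ + 1ℚ)) - 𝐞 b c * (𝐞 a d * (1ℚ + 1ℚ))) ≡ (1ℚ + 1ℚ) * f c
        collect c = trans (sum-cong-≋ (λ d → regroup (𝐞 a c) (𝐞 b d) (𝐞 b c) (𝐞 a d)))
          (trans (dot--ˡ (𝐞 a c · 𝐞 b) (𝐞 b c · 𝐞 a) (λ _ → 1ℚ + 1ℚ))
            (trans (cong₂ _-_ (trans (dot-·ˡ (𝐞 a c) (𝐞 b) (λ _ → 1ℚ + 1ℚ)) (cong (𝐞 a c *_) (dot-𝐞ˡ b (λ _ → 1ℚ + 1ℚ))))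
                (trans (dot-·ˡ (𝐞 b c) (𝐞 a) (λ _ → 1ℚ + 1ℚ)) (cong (𝐞 b c *_) (dot-𝐞ˡ a (λ _ → 1ℚ + 1ℚ)))))
              (factor (𝐞 a c) (𝐞 b c))))
          where
          regroup : ∀ x y z w → x * (y * (1ℚ + 1ℚ)) - z * (w * (1ℚ + 1ℚ)) ≡ (x * y - z * w) * (1ℚ + 1ℚ)
          regroup = solve-∀ ℚ-acr
          factor : ∀ x y → x * (1ℚ + 1ℚ) - y * (1ℚ + 1ℚ) ≡ (1ℚ + 1ℚ) * (x - y)
          factor = solve-∀ ℚ-acr

-- Phases of the eigenvectors and the action of the walk on the copies of v.

module TransferOnCopies where

  open import Data.Rational.Base
  open ≡
  open Defs using (_∼[_]_; blowUp; _∪_; IsMatching; Copies)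
  open Rationals
  open Reals
  open RationalVectors
  open IntegralSupport
  open Convergence
  open TransitionMatrices
  open BlowUps
  open LAℚ

  half-positive : ∀ x → 0ℝ ℝ.< x → 0ℝ ℝ.< fromℚ ½ ℝ.* x
  half-positive x 0<x = let δ , 0<δ , N , h = positive-eventually {x} 0<x in
    eventually-positive {fromℚ ½ ℝ.* x} (½ * δ) (½*-pos 0<δ)
      (N , λ p N≤p → *-monoˡ ½ (ℚ.<⇒≤ 0<½) (h p N≤p))

  module Transfer {k} (G : Graph k) (n : ℕ) (4∣n : 4 ∣ n) (v : Fin k)
    (integral : eigenvalueSupport G v ⊆ IsInteger)
    (M : Graph (n ℕ.* k)) (matching : IsMatching M)
    (inside : ∀ a b → a ∼[ M ] b → a ∈ Copies n v × b ∈ Copies n v)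
    (τ : ℝ) (cosτ≈0 : Cos τ 0ℝ) where

    open MatchedBlowUp G n v M matching inside
    open Transition X τ
    open Trigonometry τ cosτ≈0
    open Column cosτ≈0

    unit-n* : ∀ m → Unit (ι n * ι m) 1ℚ
    unit-n* m = subst (λ q → Unit q 1ℚ) eq (unit-ι4* (q ℕ.* m))
      where
      open ≡-Reasoning
      q = _∣_.quotient 4∣n
      eq : ι (4 ℕ.* (q ℕ.* m)) ≡ ι n * ι m
      eq = begin
        ι (4 ℕ.* (q ℕ.* m))   ≡⟨ cong ι (sym (ℕ.*-assoc 4 q m)) ⟩
        ι (4 ℕ.* q ℕ.* m)     ≡⟨ cong (λ t → ι (t ℕ.* m)) (trans (ℕ.*-comm 4 q) (sym (_∣_.equality 4∣n))) ⟩
        ι (n ℕ.* m)           ≡⟨ ι-homo-* n m ⟩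
        ι n * ι m             ∎

    unit-degree : Unit (ι n * degℚ G v) 1ℚ
    unit-degree = let d , eq = degree-natural G v in
      subst (λ q → Unit (ι n * q) 1ℚ) (sym eq) (unit-n* d)

    unit-degree+0 : Unit (ι n * degℚ G v + 0ℚ) 1ℚ
    unit-degree+0 = subst (λ q → Unit q 1ℚ) (sym (ℚ.+-identityʳ (ι n * degℚ G v))) unit-degree

    unit-difference : ∀ i j → Unit (ι n * (ι i - ι j)) 1ℚ
    unit-difference i j = subst (λ q → Unit q 1ℚ) (factor (ι n) (ι i) (ι j))
      (unit-+ {ι n * ι i} { - (ι n * ι j) } {1ℚ} {1ℚ} (unit-n* i) (unit-neg {ι n * ι j} {1ℚ} (unit-n* j)))
      where
      factor : ∀ n i j → n * i + - (n * j) ≡ n * (i - j)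
      factor = solve-∀ ℚ-acr

    maps-self : ∀ {θ} x → laplacianℚ X *ᵥ x ≋ θ · x → Unit θ 1ℚ → Maps x x
    maps-self {θ} x Lx≋θx unit = maps-cong {x} {x} {1ℚ · x} {x} (λ _ → refl) (λ i → ℚ.*-identityˡ (x i))
      (maps-eigen {θ} {1ℚ} x Lx≋θx unit)

    maps-lift : ∀ {N C u} → IntegralSpectrum.EigenvectorSum (laplacianℚ G) C N u → Maps (u ∘ π) (u ∘ π)
    maps-lift {u = u} (IntegralSpectrum.nil u≋0) =
      maps-cong {u ∘ π} {u ∘ π} {𝟎} {u ∘ π} (λ _ → refl) (λ i → sym (u≋0 (π i))) (maps-0 {u ∘ π} (λ i → u≋0 (π i)))
    maps-lift {N} {C} {u} (IntegralSpectrum.cons j x y j<N Lx≋μx s u≋x+y) =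
      maps-cong {(x ∘ π) +ᵥ (y ∘ π)} {u ∘ π} {(x ∘ π) +ᵥ (y ∘ π)} {u ∘ π}
        (λ i → sym (u≋x+y (π i))) (λ i → sym (u≋x+y (π i)))
        (maps-+ {x ∘ π} {y ∘ π} {x ∘ π} {y ∘ π}
          (maps-self {ι n * (ι j - ι C)} (x ∘ π) (lift-eigenvector (ι j - ι C) x Lx≋μx) (unit-difference j C))
          (maps-lift {N} {C} {y} s))

    maps-average : Maps average average
    maps-average = maps-· {fibre} {fibre} (inv (ι n)) (lift (integral-support⇒sum G v (λ {x} → integral {x})))
      where
      lift : ∃[ N ] ∃[ C ] IntegralSpectrum.EigenvectorSum (laplacianℚ G) C N (𝐞 v) → Maps fibre fibre
      lift (N , C , s) = maps-lift {N} {C} {𝐞 v} s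

    maps-isolated : ∀ a → a ∈ Copies n v → (∀ b → ¬ (a ∼[ M ] b)) → Maps (𝐞 a) (𝐞 a)
    maps-isolated a a∈T isolated =
      maps-cong {(𝐞 a -ᵥ average) +ᵥ average} {𝐞 a} {(𝐞 a -ᵥ average) +ᵥ average} {𝐞 a}
        (λ i → rejoin (𝐞 a i) (average i)) (λ i → rejoin (𝐞 a i) (average i))
        (maps-+ {𝐞 a -ᵥ average} {average} {𝐞 a -ᵥ average} {average}
          (maps-self {ι n * degℚ G v + 0ℚ} (𝐞 a -ᵥ average) (isolated-eigenvector a (copies⇒π a∈T) isolated) unit-degree+0)
          maps-average)
      where
      rejoin : ∀ x y → (x - y) + y ≡ x
      rejoin = solve-∀ ℚ-acr

    maps-edge : ∀ a b → a ∼[ M ] b → Maps (𝐞 a) (𝐞 b)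
    maps-edge a b a∼b =
      maps-cong {½ · anti-part +ᵥ (sym-part +ᵥ average)} {𝐞 a} {½ · ((- 1ℚ) · anti-part) +ᵥ (sym-part +ᵥ average)} {𝐞 b}
        (λ i → before (𝐞 a i) (𝐞 b i) (average i)) (λ i → after (𝐞 a i) (𝐞 b i) (average i))
        (maps-+ {½ · anti-part} {sym-part +ᵥ average} {½ · ((- 1ℚ) · anti-part)} {sym-part +ᵥ average}
          -- The phase is exp (iτ n deg v) · exp (2iτ) = 1 · (-1): the first factor by 4 ∣ n, the
          -- second from the eigenvalue 2 of the matching edge.
          (maps-· {anti-part} {(- 1ℚ) · anti-part} ½ (maps-eigen {ι n * degℚ G v + (1ℚ + 1ℚ)} { - 1ℚ } anti-part anti-eigenvector
            (subst (Unit (ι n * degℚ G v + (1ℚ + 1ℚ))) (ℚ.*-identityˡ (- 1ℚ))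
              (unit-+ {ι n * degℚ G v} {1ℚ + 1ℚ} {1ℚ} { - 1ℚ } unit-degree unit-2))))
          (maps-+ {sym-part} {average} {sym-part} {average}
            (maps-self {ι n * degℚ G v + 0ℚ} sym-part sym-eigenvector unit-degree+0)
            maps-average))
      where
      open Edge a b a∼b
      before : ∀ x y z → ½ * (x - y) + (((½ * x + ½ * y) - z) + z) ≡ x
      before = solve-∀ ℚ-acr
      after : ∀ x y z → ½ * (- 1ℚ * (x - y)) + (((½ * x + ½ * y) - z) + z) ≡ y
      after = solve-∀ ℚ-acr

open import Defs

theorem10 : ∀ {k} (G : Graph k) (n : ℕ) → 4 ∣ n →
  (v : Fin k) → eigenvalueSupport G v ⊆ IsInteger →
  (M : Graph (n ℕ.* k)) → IsMatching M →
  (∀ a b → a ∼[ M ] b → a ∈ Copies n v × b ∈ Copies n v) →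
  (π : ℝ) → IsPi π →
  (∀ a b → a ∼[ M ] b → LaplacianPST (blowUp n G ∪ M) (fromℚ ½ * π) a b)
  × (∀ a → a ∈ Copies n v → (∀ b → ¬ (a ∼[ M ] b)) →
       PeriodicAt (blowUp n G ∪ M) (fromℚ ½ * π) a)
theorem10 G n 4∣n v integral M matching inside π (0<π , cos≈0 , _) =
  (λ a b a∼b → maps⇒PST (blowUp n G ∪ M) (fromℚ ½ * π) cos≈0 a b (maps-edge a b a∼b)) ,
  (λ a a∈T isolated → maps⇒periodic (blowUp n G ∪ M) (fromℚ ½ * π) cos≈0 (half-positive π 0<π) a
    (maps-isolated a a∈T isolated))
  where
  open TransitionMatrices using (maps⇒PST; maps⇒periodic)
  open TransferOnCopies
  open Transfer G n 4∣n v (λ {x} → integral {x}) M matching inside (fromℚ ½ * π) cos≈0
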